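{- Let $G$ be a connected graph of size $m$ (i.e. with $m$ edges) such that $G$ is not isomorphic to $C_4$. Then $$\iota(G,C_4) \leq \frac{m+1}{6}.$$ Moreover, equality holds if and only if $G \in \{K_4^-\} \cup \mathcal{G}_4$.
   Context: All graphs are finite and simple. $C_k$ denotes the cycle of length $k$. For a graph $G$ and $D\subseteq V(G)$, $N[D]$ is the closed neighbourhood of $D$ (the vertices of $D$ together with all their neighbours), and $G-N[D]$ is the subgraph induced by $V(G)\setminus N[D]$. A set $D\subseteq V(G)$ is a $C_k$-isolating set of $G$ if $G-N[D]$ contains no subgraph isomorphic to $C_k$; the $C_k$-isolation number $\iota(G,C_k)$ is the minimum cardinality of a $C_k$-isolating set of $G$. $K_4^-$ is the diamond graph, obtained from $K_4$ by deleting one edge. For a tree $T$, ${\rm cons}(T,C_k)$ is the graph obtained from $T$ and $|V(T)|$ pairwise vertex-disjoint copies of $C_k$ (also disjoint from $T$), one for each vertex of $T$, by joining each vertex of $T$ by a single edge to one vertex of its own copy of $C_k$. $\mathcal{G}_k=\{{\rm cons}(T,C_k): T \text{ is a tree}\}$ (for $k\ge 3$). -}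

module Defs where

open import Data.Nat using (ℕ; zero; suc; _+_; _*_; _∸_; _≤_; _<ᵇ_)
open import Data.Bool using (Bool; true; false; _∧_; _∨_; if_then_else_)
open import Data.Bool.Properties using (∨-comm; ∧-zeroʳ)
open import Data.Fin using (Fin; toℕ; _≟_) renaming (zero to fz; suc to fs)
open import Data.Fin.Subset using (Subset; _∈_; ∣_∣)
open import Data.Product using (Σ; Σ-syntax; _×_; _,_)
open import Data.Unit using (⊤)
open import Data.Sum using (_⊎_; inj₁; inj₂)
open import Relation.Nullary using (¬_; yes; no)
open import Relation.Nullary.Decidable using (⌊_⌋)
open import Relation.Binary.PropositionalEquality using (_≡_; refl; sym)
open import Relation.Binary.Construct.Closure.ReflexiveTransitive using (Star)
open import Function.Bundles using (_↔_; Inverse)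
open import Function.Definitions using (Injective)

record Graph (V : Set) : Set where
  field
    adj    : V → V → Bool
    adj-sym : ∀ x y → adj x y ≡ adj y x
    irrefl : ∀ x → adj x x ≡ false
open Graph public

_~[_]_ : {V : Set} → V → Graph V → V → Set
x ~[ G ] y = adj G x y ≡ true

sumFin : (n : ℕ) → (Fin n → ℕ) → ℕ
sumFin zero    f = 0
sumFin (suc n) f = f fz + sumFin n (λ i → f (fs i))

size : {n : ℕ} → Graph (Fin n) → ℕ
size {n} G = sumFin n (λ i → sumFin n (λ j →
  if (toℕ i <ᵇ toℕ j) ∧ adj G i j then 1 else 0))

Connected : {V : Set} → Graph V → Set
Connected {V} G = V × (∀ x y → Star (λ a b → a ~[ G ] b) x y)

_≅_ : {A B : Set} → Graph A → Graph B → Set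
_≅_ {A} {B} G H = Σ (A ↔ B) λ e →
  ∀ x y → adj H (Inverse.to e x) (Inverse.to e y) ≡ adj G x y

CycSucc : (k : ℕ) → Fin k → Fin k → Set
CycSucc k i j = (toℕ j ≡ suc (toℕ i)) ⊎ ((toℕ i ≡ k ∸ 1) × (toℕ j ≡ 0))

HasCycleIn : {V : Set} → (k : ℕ) → Graph V → (V → Set) → Set
HasCycleIn {V} k G P = Σ (Fin k → V) λ f →
  Injective _≡_ _≡_ f × (∀ i → P (f i)) × (∀ i j → CycSucc k i j → f i ~[ G ] f j)

Acyclic : {V : Set} → Graph V → Set
Acyclic G = ∀ k → 3 ≤ k → ¬ HasCycleIn k G (λ _ → ⊤)

Tree : {V : Set} → Graph V → Set
Tree G = Connected G × Acyclic G

InClosedNbhd : {n : ℕ} → Graph (Fin n) → Subset n → Fin n → Set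
InClosedNbhd G D v = (v ∈ D) ⊎ (Σ[ u ∈ _ ] (u ∈ D × u ~[ G ] v))

IsCkIsolating : {n : ℕ} → ℕ → Graph (Fin n) → Subset n → Set
IsCkIsolating k G D = ¬ HasCycleIn k G (λ v → ¬ InClosedNbhd G D v)

IsIsolationNumber : {n : ℕ} → Graph (Fin n) → ℕ → ℕ → Set
IsIsolationNumber {n} G k ι =
  (Σ (Subset n) λ D → IsCkIsolating k G D × ∣ D ∣ ≡ ι) ×
  (∀ (D : Subset n) → IsCkIsolating k G D → ι ≤ ∣ D ∣)

next4 : Fin 4 → Fin 4
next4 fz = fs fz
next4 (fs fz) = fs (fs fz)
next4 (fs (fs fz)) = fs (fs (fs fz))
next4 (fs (fs (fs fz))) = fz

c4adj : Fin 4 → Fin 4 → Bool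
c4adj a b = ⌊ b ≟ next4 a ⌋ ∨ ⌊ a ≟ next4 b ⌋

c4irr : ∀ a → c4adj a a ≡ false
c4irr fz = refl
c4irr (fs fz) = refl
c4irr (fs (fs fz)) = refl
c4irr (fs (fs (fs fz))) = refl

C4 : Graph (Fin 4)
C4 = record { adj = c4adj ; adj-sym = λ a b → ∨-comm ⌊ b ≟ next4 a ⌋ ⌊ a ≟ next4 b ⌋ ; irrefl = c4irr }

-- The diamond K_4^- on Fin 4: K_4 minus the edge {2,3}.

k4mAdj : Fin 4 → Fin 4 → Bool
k4mAdj a b with a ≟ b
... | yes _ = false
... | no _ with toℕ a + toℕ b
...   | 5 = false
...   | _ = true

k4mSym : ∀ a b → k4mAdj a b ≡ k4mAdj b a
k4mSym fz fz = refl
k4mSym fz (fs fz) = refl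
k4mSym fz (fs (fs fz)) = refl
k4mSym fz (fs (fs (fs fz))) = refl
k4mSym (fs fz) fz = refl
k4mSym (fs fz) (fs fz) = refl
k4mSym (fs fz) (fs (fs fz)) = refl
k4mSym (fs fz) (fs (fs (fs fz))) = refl
k4mSym (fs (fs fz)) fz = refl
k4mSym (fs (fs fz)) (fs fz) = refl
k4mSym (fs (fs fz)) (fs (fs fz)) = refl
k4mSym (fs (fs fz)) (fs (fs (fs fz))) = refl
k4mSym (fs (fs (fs fz))) fz = refl
k4mSym (fs (fs (fs fz))) (fs fz) = refl
k4mSym (fs (fs (fs fz))) (fs (fs fz)) = refl
k4mSym (fs (fs (fs fz))) (fs (fs (fs fz))) = refl

k4mIrr : ∀ a → k4mAdj a a ≡ false
k4mIrr fz = refl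
k4mIrr (fs fz) = refl
k4mIrr (fs (fs fz)) = refl
k4mIrr (fs (fs (fs fz))) = refl

K4⁻ : Graph (Fin 4)
K4⁻ = record { adj = k4mAdj ; adj-sym = k4mSym ; irrefl = k4mIrr }

-- cons(T, C_4): vertex set V(T) ⊎ (V(T) × Fin 4); the copy of C_4 at
-- vertex i is {i} × Fin 4, and i is joined to (i , 0).

eqb : {t : ℕ} → Fin t → Fin t → Bool
eqb i j = ⌊ i ≟ j ⌋

eqb-sym : {t : ℕ} (i j : Fin t) → eqb i j ≡ eqb j i
eqb-sym i j with i ≟ j | j ≟ i
... | yes _ | yes _ = refl
... | no _  | no _  = refl
... | yes p | no q  = Data.Empty.⊥-elim (q (sym p))
  where import Data.Empty
... | no p  | yes q = Data.Empty.⊥-elim (p (sym q))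
  where import Data.Empty

eqb-refl : {t : ℕ} (i : Fin t) → eqb i i ≡ true
eqb-refl i with i ≟ i
... | yes _ = refl
... | no p = Data.Empty.⊥-elim (p refl)
  where import Data.Empty

module _ {t : ℕ} (T : Graph (Fin t)) where

  consAdj : Fin t ⊎ (Fin t × Fin 4) → Fin t ⊎ (Fin t × Fin 4) → Bool
  consAdj (inj₁ i) (inj₁ j) = adj T i j
  consAdj (inj₁ i) (inj₂ (j , a)) = eqb i j ∧ eqb a fz
  consAdj (inj₂ (i , a)) (inj₁ j) = eqb j i ∧ eqb a fz
  consAdj (inj₂ (i , a)) (inj₂ (j , b)) = eqb i j ∧ c4adj a b

  consSym : ∀ x y → consAdj x y ≡ consAdj y x
  consSym (inj₁ i) (inj₁ j) = Graph.adj-sym T i j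
  consSym (inj₁ i) (inj₂ _) = refl
  consSym (inj₂ _) (inj₁ j) = refl
  consSym (inj₂ (i , a)) (inj₂ (j , b))
    rewrite eqb-sym i j | Graph.adj-sym C4 a b = refl

  consIrr : ∀ x → consAdj x x ≡ false
  consIrr (inj₁ i) = irrefl T i
  consIrr (inj₂ (i , a)) rewrite c4irr a = ∧-zeroʳ (eqb i i)

  cons : Graph (Fin t ⊎ (Fin t × Fin 4))
  cons = record { adj = consAdj ; adj-sym = consSym ; irrefl = consIrr }

{-# OPTIONS --safe #-}

-- Induction on the number m of edges, for connected edge sets: either 6|D| ≤ m for some isolating D, or the
-- graph is K₄⁻, C₄, or cons(T, C₄), which is encoded by disjoint 5-vertex blocks (a vertex of T with its C₄).
--
-- An edge in no C₄ may be deleted if it is not a bridge.  If it is a bridge, treat both sides separately; two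
-- exceptional sides either share a dominating vertex or combine to another cons(T, C₄).  A side that is a C₄
-- hangs at a vertex x: put x into D and remove x with this C₄; the five removed edges and one edge gained from
-- any other component of the rest pay for x.
--
-- If every edge lies in a C₄, put v into D and remove a set L ⊇ N[v].  Each component C of the rest is charged the
-- edges touching it, of which at least two leave C, so that the induction hypothesis costs nothing for C, and it
-- suffices to find v with (edges inside L) + (surplus of one component) ≥ 6.  An induced C₄ with at most two
-- outgoing edges gives such a v; so does a C₄ with a chord, or a C₄ in which a vertex of degree at least 3 is
-- opposite to one of degree at most 3.  Otherwise a vertex v of degree at least 4 works, with the component of
-- the vertex opposite to v in some C₄.
--
-- In case of equality T is acyclic because deleting an edge of a cycle of T would contradict the bound.
module Submission where

open import Defs
open import Data.Bool using (Bool; true; false; _∧_; if_then_else_; T)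
import Data.Bool as Bool
open import Data.Empty using (⊥; ⊥-elim)
open import Data.Fin using (Fin; toℕ; fromℕ; fromℕ<; punchIn; punchOut; splitAt; _↑ˡ_; _↑ʳ_; _≟_) renaming (zero to fz; suc to fs)
open import Data.Fin.Patterns using (0F; 1F; 2F; 3F; 4F; 5F)
open import Data.Fin.Properties using (all?; any?; injective⇒≤; punchIn-punchOut; splitAt-↑ˡ; splitAt-↑ʳ; splitAt⁻¹-↑ˡ; splitAt⁻¹-↑ʳ; toℕ<n; toℕ-fromℕ; toℕ-fromℕ<; toℕ-injective)
import Data.Fin.Subset as Sub
open import Data.Fin.Subset.Properties using (∣⊥∣≡0)
open import Data.List using (List; []; _∷_; _++_; allFin; concat; length; lookup; map; tabulate)
open import Data.List.Membership.Propositional using (_∈_)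
open import Data.List.Membership.Propositional.Properties using (∈-allFin; ∈-lookup)
open import Data.List.Properties using (length-++; length-map; length-tabulate)
open import Data.List.Relation.Unary.All using (All; []; _∷_)
import Data.List.Relation.Unary.All as All
open import Data.List.Relation.Unary.AllPairs using (AllPairs; []; _∷_; allPairs?)
open import Data.List.Relation.Unary.Any using (Any; here; there)
import Data.List.Relation.Unary.Any as Any
open import Data.List.Relation.Unary.Any.Properties using (concat⁺; lookup-index; map⁺; tabulate⁺; ++⁺ˡ; ++⁺ʳ)
open import Data.List.Relation.Unary.Unique.Propositional using (Unique)
open import Data.Nat using (ℕ; zero; suc; _+_; _*_; _∸_; _≤_; _<_; _<ᵇ_; _≤?_; s≤s; s≤s⁻¹; z≤n)
open import Data.Nat.Properties
  using (*-distribˡ-+; *-monoʳ-≤; *-suc; +-cancelˡ-≤; +-comm; +-identityʳ; +-mono-≤; +-monoʳ-≤; +-monoˡ-≤; +-suc; <-asym; <-cmp; <-irrefl; <⇒<ᵇ; <⇒≤; <ᵇ⇒<; m≤m+n; m≤n+m; m≤n⇒m≤1+n; module ≤-Reasoning; n≤1+n; suc-injective; ≤-antisym; ≤-refl; ≤-reflexive; ≤-trans; ≰⇒>)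
open import Data.Nat.Tactic.RingSolver using (solve-∀)
open import Data.Product using (Σ; Σ-syntax; ∃-syntax; _×_; _,_; proj₁; proj₂)
open import Data.Sum using (_⊎_; inj₁; inj₂; [_,_]′)
open import Data.Unit using (⊤; tt)
open import Data.Vec using (Vec; []; _∷_)
import Data.Vec as Vec
import Data.Vec.Relation.Unary.All as VA
import Data.Vec.Relation.Unary.AllPairs as VP
import Data.Vec.Relation.Unary.Unique.Propositional as VU
import Data.Vec.Relation.Unary.Unique.Propositional.Properties as VUP
open import Function using (_∘_; id)
open import Function.Bundles using (_↔_; _⇔_; Inverse; mk↔ₛ′; mk⇔)
open import Function.Definitions using (Injective)
open import Relation.Binary.Construct.Closure.ReflexiveTransitive using (Star; ε; _◅_; _◅◅_; _⋆; reverse)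
import Relation.Binary.Construct.Closure.ReflexiveTransitive as Star
open import Relation.Binary.Definitions using (tri<; tri≈; tri>)
open import Relation.Binary.PropositionalEquality using (_≡_; _≢_; refl; sym; trans; cong; cong₂; subst; subst₂)
open import Relation.Nullary using (¬_; Dec; yes; no)
open import Relation.Nullary.Decidable using (⌊_⌋; _×-dec_; _⊎-dec_; _→-dec_; ¬?; from-yes; map′; toWitness)

-- All graphs of the induction live on the same `Fin n`: passing to a part only deletes edges, and
-- connectedness concerns endpoints of edges only. On its own edges a strict component breaks even,
-- K₄⁻ or cons(T, C₄) has deficit 1 and C₄ deficit 2, which is why C₄ is a result of its own. Each
-- boundary edge of a component raises its surplus by one, and a cut crossed by a C₄ has at least
-- two edges; so no component costs anything once every edge lies in a C₄. The price 6 of `v` is met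
-- as (edges inside L) + surplus: 6 + 0 for an induced C₄ with two outgoing edges, 5 + 1 for a
-- pendant C₄, a chord or an opposite vertex of degree 2, 3 + 3 for an opposite vertex of degree 3,
-- and 4 + 2 for large degree. The obstacle is a component that is C₄ or cons(T, C₄): it gets such a
-- surplus from the edges touching one of its C₄s. This is why C₄s with few outgoing edges are
-- settled beforehand, which leaves at least 7 edges touching a chordless C₄ that has an outgoing
-- edge, and why opposite corners of degree at least 4 matter: they raise 7 to 8.

⌊⌋⁺ : {A : Set} (d : Dec A) → A → ⌊ d ⌋ ≡ true
⌊⌋⁺ (yes _) _ = refl
⌊⌋⁺ (no ¬a) a = ⊥-elim (¬a a)

⌊⌋⁻ : {A : Set} (d : Dec A) → ⌊ d ⌋ ≡ true → A
⌊⌋⁻ (yes a) _ = a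

-- Subgraphs cut out by a symmetric relation

Adj : ∀ {n} → Graph (Fin n) → Fin n → Fin n → Set
Adj G x y = x ~[ G ] y

_⊆ᴳ_ : ∀ {n} → Graph (Fin n) → Graph (Fin n) → Set
H ⊆ᴳ G = ∀ {x y} → Adj H x y → Adj G x y

adj? : ∀ {n} (G : Graph (Fin n)) (x y : Fin n) → Dec (Adj G x y)
adj? G x y = adj G x y Bool.≟ true

~-sym : ∀ {n} (G : Graph (Fin n)) {x y : Fin n} → Adj G x y → Adj G y x
~-sym G {x} {y} p = trans (adj-sym G y x) p

~-irr : ∀ {n} (G : Graph (Fin n)) {x : Fin n} → ¬ Adj G x x
~-irr G {x} p with trans (sym p) (irrefl G x)
... | ()

~⇒≢ : ∀ {n} (G : Graph (Fin n)) {x y : Fin n} → Adj G x y → x ≢ y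
~⇒≢ G p refl = ~-irr G p

graphOf : ∀ {n} (R : Fin n → Fin n → Set) → (∀ x y → Dec (R x y)) →
  (∀ {x y} → R x y → R y x) → (∀ {x} → ¬ R x x) → Graph (Fin n)
graphOf R R? R-sym R-irr = record
  { adj = λ x y → ⌊ R? x y ⌋
  ; adj-sym = λ x y → eq (R? x y) (R? y x)
  ; irrefl = λ x → no-eq (R? x x) }
  where
  eq : ∀ {x y} (d : Dec (R x y)) (e : Dec (R y x)) → ⌊ d ⌋ ≡ ⌊ e ⌋
  eq (yes p) (yes q) = refl
  eq (yes p) (no ¬q) = ⊥-elim (¬q (R-sym p))
  eq (no ¬p) (yes q) = ⊥-elim (¬p (R-sym q))
  eq (no ¬p) (no ¬q) = refl
  no-eq : ∀ {x} (d : Dec (R x x)) → ⌊ d ⌋ ≡ false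
  no-eq (yes p) = ⊥-elim (R-irr p)
  no-eq (no _) = refl

record SymRel (n : ℕ) : Set₁ where
  constructor symRel
  field
    Holds  : Fin n → Fin n → Set
    holds? : ∀ x y → Dec (Holds x y)
    flip   : ∀ {x y} → Holds x y → Holds y x
open SymRel public

infixl 6 _∩_
opaque
  _∩_ : ∀ {n} → Graph (Fin n) → SymRel n → Graph (Fin n)
  G ∩ P = graphOf (λ x y → Adj G x y × Holds P x y)
    (λ x y → adj? G x y ×-dec holds? P x y)
    (λ (p , q) → ~-sym G p , flip P q) (λ (p , _) → ~-irr G p)

  ∩⁺ : ∀ {n} (G : Graph (Fin n)) (P : SymRel n) {x y} → Adj G x y → Holds P x y → Adj (G ∩ P) x y
  ∩⁺ G P {x} {y} p q = ⌊⌋⁺ (adj? G x y ×-dec holds? P x y) (p , q)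

  ∩⁻ : ∀ {n} (G : Graph (Fin n)) (P : SymRel n) {x y} → Adj (G ∩ P) x y → Adj G x y × Holds P x y
  ∩⁻ G P {x} {y} = ⌊⌋⁻ (adj? G x y ×-dec holds? P x y)

∩-⊆ : ∀ {n} (G : Graph (Fin n)) (P : SymRel n) → (G ∩ P) ⊆ᴳ G
∩-⊆ G P p = proj₁ (∩⁻ G P p)

VSet : ℕ → Set
VSet n = Fin n → Bool

infix 4 _∈ᵇ_ _∉ᵇ_
_∈ᵇ_ _∉ᵇ_ : ∀ {n} → Fin n → VSet n → Set
x ∈ᵇ S = S x ≡ true
x ∉ᵇ S = ¬ (x ∈ᵇ S)

_∈ᵇ?_ : ∀ {n} (x : Fin n) (S : VSet n) → Dec (x ∈ᵇ S)
x ∈ᵇ? S = S x Bool.≟ true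

inside touch : ∀ {n} → VSet n → SymRel n
inside S = symRel (λ x y → x ∈ᵇ S × y ∈ᵇ S) (λ x y → (x ∈ᵇ? S) ×-dec (y ∈ᵇ? S)) (λ (p , q) → q , p)
touch S = symRel (λ x y → x ∈ᵇ S ⊎ y ∈ᵇ S) (λ x y → (x ∈ᵇ? S) ⊎-dec (y ∈ᵇ? S))
  (λ { (inj₁ p) → inj₂ p ; (inj₂ p) → inj₁ p })

not-rel : ∀ {n} → SymRel n → SymRel n
not-rel P = symRel (λ x y → ¬ Holds P x y) (λ x y → ¬? (holds? P x y)) (λ ¬p q → ¬p (flip P q))

SameEdge : ∀ {n} → Fin n × Fin n → Fin n × Fin n → Set
SameEdge (a , b) (x , y) = (x ≡ a × y ≡ b) ⊎ (x ≡ b × y ≡ a)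

sameEdge? : ∀ {n} (e f : Fin n × Fin n) → Dec (SameEdge e f)
sameEdge? (a , b) (x , y) = ((x ≟ a) ×-dec (y ≟ b)) ⊎-dec ((x ≟ b) ×-dec (y ≟ a))

edge : ∀ {n} → Fin n → Fin n → SymRel n
edge a b = symRel (λ x y → SameEdge (a , b) (x , y)) (λ x y → sameEdge? (a , b) (x , y))
  (λ { (inj₁ (p , q)) → inj₂ (q , p) ; (inj₂ (p , q)) → inj₁ (q , p) })

del : ∀ {n} → Graph (Fin n) → Fin n → Fin n → Graph (Fin n)
del G a b = G ∩ not-rel (edge a b)

-- Counting edges

private
  ind : Bool → Bool → ℕ
  ind c e = if c ∧ e then 1 else 0

  ind-mono : ∀ c {h g} → (h ≡ true → g ≡ true) → ind c h ≤ ind c g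
  ind-mono false _ = z≤n
  ind-mono true {false} _ = z≤n
  ind-mono true {true} p rewrite p refl = ≤-refl

  ind-super : ∀ c {h₁ h₂ g} → (h₁ ≡ true → g ≡ true) → (h₂ ≡ true → g ≡ true) →
    (h₁ ≡ true → h₂ ≡ true → ⊥) → ind c h₁ + ind c h₂ ≤ ind c g
  ind-super false _ _ _ = z≤n
  ind-super true {false} {h₂} _ q _ = ind-mono true {h₂} q
  ind-super true {true} {false} p _ _ rewrite p refl = ≤-refl
  ind-super true {true} {true} _ _ r = ⊥-elim (r refl refl)

  ind-sub : ∀ c {h₁ h₂ g} → (g ≡ true → h₁ ≡ true ⊎ h₂ ≡ true) → ind c g ≤ ind c h₁ + ind c h₂
  ind-sub false _ = z≤n
  ind-sub true {g = false} _ = z≤n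
  ind-sub true {true} {g = true} _ = s≤s z≤n
  ind-sub true {false} {g = true} r with r refl
  ... | inj₂ refl = ≤-refl

sumFin-mono : ∀ n {f g : Fin n → ℕ} → (∀ i → f i ≤ g i) → sumFin n f ≤ sumFin n g
sumFin-mono zero _ = z≤n
sumFin-mono (suc n) p = +-mono-≤ (p fz) (sumFin-mono n (λ i → p (fs i)))

sumFin-+ : ∀ n (f g : Fin n → ℕ) → sumFin n f + sumFin n g ≡ sumFin n (λ i → f i + g i)
sumFin-+ zero f g = refl
sumFin-+ (suc n) f g = trans (shuffle (f fz) _ (g fz) _) (cong (f fz + g fz +_) (sumFin-+ n _ _))
  where
  shuffle : ∀ a b c d → (a + b) + (c + d) ≡ (a + c) + (b + d)
  shuffle = solve-∀

sumFin-0 : ∀ n {f : Fin n → ℕ} → (∀ i → f i ≤ 0) → sumFin n f ≤ 0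
sumFin-0 zero _ = z≤n
sumFin-0 (suc n) p = +-mono-≤ (p fz) (sumFin-0 n (λ i → p (fs i)))

sumFin-≥ : ∀ n (f : Fin n → ℕ) i → f i ≤ sumFin n f
sumFin-≥ (suc n) f fz = m≤m+n _ _
sumFin-≥ (suc n) f (fs i) = ≤-trans (sumFin-≥ n (λ j → f (fs j)) i) (m≤n+m _ _)

sumFin-only : ∀ n {f : Fin n → ℕ} p → (∀ i → i ≢ p → f i ≤ 0) → sumFin n f ≤ f p
sumFin-only (suc n) {f} fz h = ≤-trans (+-mono-≤ (≤-refl {f fz}) (sumFin-0 n (λ i → h (fs i) (λ ()))))
  (≤-reflexive (+-identityʳ (f fz)))
sumFin-only (suc n) (fs p) h =
  +-mono-≤ (h fz (λ ())) (sumFin-only n p (λ i i≢p → h (fs i) (λ { refl → i≢p refl })))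

size-mono : ∀ {n} (H G : Graph (Fin n)) → H ⊆ᴳ G → size H ≤ size G
size-mono {n} H G sub = sumFin-mono n λ i → sumFin-mono n λ j → ind-mono (toℕ i <ᵇ toℕ j) sub

private
  size-+ : ∀ {n} (H₁ H₂ : Graph (Fin n)) → size H₁ + size H₂ ≡
    sumFin n (λ i → sumFin n (λ j → ind (toℕ i <ᵇ toℕ j) (adj H₁ i j) + ind (toℕ i <ᵇ toℕ j) (adj H₂ i j)))
  size-+ {n} H₁ H₂ = trans (sumFin-+ n _ _)
    (≤-antisym (sumFin-mono n λ i → ≤-reflexive (sumFin-+ n _ _))
               (sumFin-mono n λ i → ≤-reflexive (sym (sumFin-+ n _ _))))

size-super : ∀ {n} (H₁ H₂ G : Graph (Fin n)) → H₁ ⊆ᴳ G → H₂ ⊆ᴳ G →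
  (∀ {x y} → Adj H₁ x y → Adj H₂ x y → ⊥) → size H₁ + size H₂ ≤ size G
size-super {n} H₁ H₂ G s₁ s₂ dis = ≤-trans (≤-reflexive (size-+ H₁ H₂))
  (sumFin-mono n λ i → sumFin-mono n λ j → ind-super (toℕ i <ᵇ toℕ j) s₁ s₂ dis)

size-sub : ∀ {n} (H₁ H₂ G : Graph (Fin n)) → (∀ {x y} → Adj G x y → Adj H₁ x y ⊎ Adj H₂ x y) →
  size G ≤ size H₁ + size H₂
size-sub {n} H₁ H₂ G cov = ≤-trans
  (sumFin-mono n λ i → sumFin-mono n λ j → ind-sub (toℕ i <ᵇ toℕ j) cov) (≤-reflexive (sym (size-+ H₁ H₂)))

private
  T⇒≡ : ∀ {b} → T b → b ≡ true
  T⇒≡ {true} _ = refl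

  ≡⇒T : ∀ {b} → b ≡ true → T b
  ≡⇒T refl = tt

  size-1≤ : ∀ {n} (H : Graph (Fin n)) {a b : Fin n} → toℕ a < toℕ b → Adj H a b → 1 ≤ size H
  size-1≤ {n} H {a} {b} a<b ab = ≤-trans (≤-reflexive (sym val))
    (≤-trans (sumFin-≥ n (λ j → ind (toℕ a <ᵇ toℕ j) (adj H a j)) b)
             (sumFin-≥ n (λ i → sumFin n (λ j → ind (toℕ i <ᵇ toℕ j) (adj H i j))) a))
    where
    val : ind (toℕ a <ᵇ toℕ b) (adj H a b) ≡ 1
    val rewrite T⇒≡ (<⇒<ᵇ a<b) | ab = refl

  size-≤1 : ∀ {n} (H : Graph (Fin n)) (p q : Fin n) →
    (∀ {i j} → toℕ i < toℕ j → Adj H i j → i ≡ p × j ≡ q) → size H ≤ 1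
  size-≤1 {n} H p q only = ≤-trans
    (sumFin-only n p λ i i≢p → sumFin-0 n λ j → z i j (λ (e , _) → i≢p e))
    (≤-trans (sumFin-only n q λ j j≢q → z p j (λ (_ , e) → j≢q e)) (le (toℕ p <ᵇ toℕ q) (adj H p q)))
    where
    le : ∀ c e → ind c e ≤ 1
    le false _ = z≤n
    le true false = z≤n
    le true true = ≤-refl
    z : ∀ i j → ¬ (i ≡ p × j ≡ q) → ind (toℕ i <ᵇ toℕ j) (adj H i j) ≤ 0
    z i j ¬e with toℕ i <ᵇ toℕ j in lt | adj H i j in ij
    ... | false | _ = z≤n
    ... | true | false = z≤n
    ... | true | true = ⊥-elim (¬e (only (<ᵇ⇒< (toℕ i) (toℕ j) (≡⇒T lt)) ij))

size-nonempty : ∀ {n} (H : Graph (Fin n)) {a b} → Adj H a b → 1 ≤ size H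
size-nonempty H {a} {b} ab with <-cmp (toℕ a) (toℕ b)
... | tri< lt _ _ = size-1≤ H lt ab
... | tri≈ _ eq _ = ⊥-elim (~⇒≢ H ab (toℕ-injective eq))
... | tri> _ _ gt = size-1≤ H gt (~-sym H ab)

size-single : ∀ {n} (H : Graph (Fin n)) (a b : Fin n) →
  (∀ {x y} → Adj H x y → SameEdge (a , b) (x , y)) → size H ≤ 1
size-single H a b only with toℕ a ≤? toℕ b
... | yes a≤b = size-≤1 H a b λ { lt ij → case lt (only ij) }
  where
  case : ∀ {i j} → toℕ i < toℕ j → SameEdge (a , b) (i , j) → i ≡ a × j ≡ b
  case lt (inj₁ p) = p
  case lt (inj₂ (refl , refl)) = ⊥-elim (<-irrefl refl (≤-trans lt a≤b))
... | no a≰b = size-≤1 H b a λ { lt ij → case lt (only ij) }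
  where
  case : ∀ {i j} → toℕ i < toℕ j → SameEdge (a , b) (i , j) → i ≡ b × j ≡ a
  case lt (inj₂ p) = p
  case lt (inj₁ (refl , refl)) = ⊥-elim (<-asym lt (≰⇒> a≰b))

size-del≥ : ∀ {n} (G : Graph (Fin n)) a b → size G ≤ suc (size (del G a b))
size-del≥ G a b = ≤-trans (size-sub (G ∩ edge a b) (del G a b) G split)
  (+-mono-≤ (size-single (G ∩ edge a b) a b (λ p → proj₂ (∩⁻ G (edge a b) p))) ≤-refl)
  where
  split : ∀ {x y} → Adj G x y → Adj (G ∩ edge a b) x y ⊎ Adj (del G a b) x y
  split {x} {y} p with sameEdge? (a , b) (x , y)
  ... | yes s = inj₁ (∩⁺ G (edge a b) p s)
  ... | no ¬s = inj₂ (∩⁺ G (not-rel (edge a b)) p ¬s)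

size-del< : ∀ {n} (G : Graph (Fin n)) {a b} → Adj G a b → suc (size (del G a b)) ≤ size G
size-del< G {a} {b} ab = ≤-trans
  (+-mono-≤ (size-nonempty (G ∩ edge a b) (∩⁺ G (edge a b) ab (inj₁ (refl , refl)))) ≤-refl)
  (size-super (G ∩ edge a b) (del G a b) G (∩-⊆ G (edge a b)) (∩-⊆ G (not-rel (edge a b)))
    λ p q → proj₂ (∩⁻ G (not-rel (edge a b)) q) (proj₂ (∩⁻ G (edge a b) p)))

size-⊂ : ∀ {n} (H G : Graph (Fin n)) {a b} → H ⊆ᴳ G → Adj G a b → ¬ Adj H a b → size H < size G
size-⊂ H G {a} {b} sub ab ¬ab = ≤-trans (s≤s (size-mono H (del G a b) sub′)) (size-del< G ab)
  where
  sub′ : H ⊆ᴳ del G a b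
  sub′ p = ∩⁺ G (not-rel (edge a b)) (sub p)
    λ { (inj₁ (refl , refl)) → ¬ab p ; (inj₂ (refl , refl)) → ¬ab (~-sym H p) }

size-cover : ∀ {n} (H : Graph (Fin n)) (es : List (Fin n × Fin n)) →
  (∀ {x y} → Adj H x y → Any (λ e → SameEdge e (x , y)) es) → size H ≤ length es
size-cover {n} H [] cov = sumFin-0 n λ i → sumFin-0 n λ j → zero-val i j
  where
  zero-val : ∀ i j → ind (toℕ i <ᵇ toℕ j) (adj H i j) ≤ 0
  zero-val i j with toℕ i <ᵇ toℕ j | adj H i j in ij
  ... | false | _ = z≤n
  ... | true | false = z≤n
  ... | true | true with cov ij
  ...   | ()
size-cover H ((a , b) ∷ es) cov = ≤-trans (size-del≥ H a b) (s≤s (size-cover (del H a b) es cov′))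
  where
  cov′ : ∀ {x y} → Adj (del H a b) x y → Any (λ e → SameEdge e (x , y)) es
  cov′ p with ∩⁻ H (not-rel (edge a b)) p
  ... | h , ¬s with cov h
  ...   | here s = ⊥-elim (¬s s)
  ...   | there c = c

Distinct : ∀ {k} → List (Fin k × Fin k) → Set
Distinct = AllPairs (λ e f → ¬ SameEdge e f)

Embeds : ∀ {n k} → Graph (Fin n) → (Fin k → Fin n) → List (Fin k × Fin k) → Set
Embeds H f = All (λ (i , j) → Adj H (f i) (f j))

-- The listed edges are deleted in turn; distinctness as unordered pairs, carried over by
-- injectivity of `f`, keeps the later ones present.
size-embed : ∀ {n k} (H : Graph (Fin n)) (f : Fin k → Fin n) → Injective _≡_ _≡_ f →
  (es : List (Fin k × Fin k)) → Distinct es → Embeds H f es → length es ≤ size H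
size-embed H f inj [] _ _ = z≤n
size-embed H f inj ((i , j) ∷ es) (d ∷ ds) (h ∷ hs) = ≤-trans
  (s≤s (size-embed (del H (f i) (f j)) f inj es ds (keep es d hs))) (size-del< H h)
  where
  keep : ∀ es → All (λ e → ¬ SameEdge (i , j) e) es → Embeds H f es → Embeds (del H (f i) (f j)) f es
  keep [] [] [] = []
  keep (_ ∷ es) (¬s ∷ ds) (h ∷ hs) = ∩⁺ H (not-rel (edge (f i) (f j))) h
    (λ { (inj₁ (p , q)) → ¬s (inj₁ (inj p , inj q)) ; (inj₂ (p , q)) → ¬s (inj₂ (inj p , inj q)) }) ∷ keep es ds hs

-- An edge outside the list could be deleted, and the list would still embed in a graph with fewer
-- edges than its length. This turns an edge count into a complete description of a graph.
size-tight : ∀ {n k} (H : Graph (Fin n)) (f : Fin k → Fin n) → Injective _≡_ _≡_ f →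
  (es : List (Fin k × Fin k)) → Distinct es → Embeds H f es → size H ≤ length es →
  ∀ {x y} → Adj H x y → Any (λ (i , j) → SameEdge (f i , f j) (x , y)) es
size-tight H f inj es ds hs le {x} {y} xy with Any.any? (λ (i , j) → sameEdge? (f i , f j) (x , y)) es
... | yes p = p
... | no ¬p = ⊥-elim (<-irrefl refl (≤-trans
    (s≤s (≤-trans le (size-embed (del H x y) f inj es ds (keep es hs ¬p)))) (size-del< H xy)))
  where
  keep : ∀ es → Embeds H f es → ¬ Any (λ (i , j) → SameEdge (f i , f j) (x , y)) es → Embeds (del H x y) f es
  keep [] [] _ = []
  keep (_ ∷ es) (h ∷ hs) ¬p = ∩⁺ H (not-rel (edge x y)) h
    (λ { (inj₁ (refl , refl)) → ¬p (here (inj₁ (refl , refl)))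
       ; (inj₂ (refl , refl)) → ¬p (here (inj₂ (refl , refl))) }) ∷ keep es hs (λ q → ¬p (there q))

-- Vertex sets, induced subgraphs and connected components

opaque
  setOf : ∀ {n} {P : Fin n → Set} → (∀ x → Dec (P x)) → VSet n
  setOf P? x = ⌊ P? x ⌋

  set⁺ : ∀ {n} {P : Fin n → Set} (P? : ∀ x → Dec (P x)) {x} → P x → x ∈ᵇ setOf P?
  set⁺ P? {x} = ⌊⌋⁺ (P? x)

  set⁻ : ∀ {n} {P : Fin n → Set} (P? : ∀ x → Dec (P x)) {x} → x ∈ᵇ setOf P? → P x
  set⁻ P? {x} = ⌊⌋⁻ (P? x)

_∈?_ : ∀ {n} (x : Fin n) (xs : List (Fin n)) → Dec (x ∈ xs)
x ∈? xs = Any.any? (x ≟_) xs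

opaque
  ∁ : ∀ {n} → VSet n → VSet n
  ∁ S = setOf (λ x → ¬? (x ∈ᵇ? S))

  ∁⁺ : ∀ {n} (S : VSet n) {x} → x ∉ᵇ S → x ∈ᵇ ∁ S
  ∁⁺ S = set⁺ (λ x → ¬? (x ∈ᵇ? S))

  ∁⁻ : ∀ {n} (S : VSet n) {x} → x ∈ᵇ ∁ S → x ∉ᵇ S
  ∁⁻ S = set⁻ (λ x → ¬? (x ∈ᵇ? S))

∁-by : ∀ {n} (S : VSet n) {x} → x ∉ᵇ ∁ S → x ∈ᵇ S
∁-by S {x} p with x ∈ᵇ? S
... | yes q = q
... | no ¬q = ⊥-elim (p (∁⁺ S ¬q))

_∖_ : ∀ {n} → VSet n → VSet n → VSet n
U ∖ C = setOf (λ x → (x ∈ᵇ? U) ×-dec ¬? (x ∈ᵇ? C))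

opaque
  ⟦_⟧ : ∀ {n} → List (Fin n) → VSet n
  ⟦ xs ⟧ = setOf (λ x → x ∈? xs)

  ⟦⟧⁺ : ∀ {n} (xs : List (Fin n)) {x} → x ∈ xs → x ∈ᵇ ⟦ xs ⟧
  ⟦⟧⁺ xs = set⁺ (λ x → x ∈? xs)

  ⟦⟧⁻ : ∀ {n} (xs : List (Fin n)) {x} → x ∈ᵇ ⟦ xs ⟧ → x ∈ xs
  ⟦⟧⁻ xs = set⁻ (λ x → x ∈? xs)

_[_] : ∀ {n} → Graph (Fin n) → VSet n → Graph (Fin n)
G [ S ] = G ∩ inside S

ind⁺ : ∀ {n} (G : Graph (Fin n)) (S : VSet n) {x y} → Adj G x y → x ∈ᵇ S → y ∈ᵇ S → Adj (G [ S ]) x y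
ind⁺ G S p q r = ∩⁺ G (inside S) p (q , r)

ind⁻ : ∀ {n} (G : Graph (Fin n)) (S : VSet n) {x y} → Adj (G [ S ]) x y → Adj G x y × x ∈ᵇ S × y ∈ᵇ S
ind⁻ G S = ∩⁻ G (inside S)

-- Boundary edges count as well as inner ones, so that these numbers for the components of the
-- complement of a set `L`, together with the edges inside `L`, add up to at most `size G`.
τ : ∀ {n} → Graph (Fin n) → VSet n → ℕ
τ G S = size (G ∩ touch S)

-- Finite search: either some vertex already yields the wanted result, or its failure everywhere
-- becomes a hypothesis for the rest of the proof.
allOr : ∀ {n} {A : Set} {P : Fin n → Set} → (∀ x → A ⊎ P x) → A ⊎ (∀ x → P x)
allOr {zero} f = inj₂ (λ ())
allOr {suc n} f with f fz | allOr (λ x → f (fs x))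
... | inj₁ a | _ = inj₁ a
... | inj₂ _ | inj₁ a = inj₁ a
... | inj₂ p | inj₂ q = inj₂ λ { fz → p ; (fs x) → q x }

unique-lookup : ∀ {A : Set} {xs : List A} → Unique xs → ∀ {i j} → lookup xs i ≡ lookup xs j → i ≡ j
unique-lookup (_ ∷ _) {fz} {fz} _ = refl
unique-lookup (p ∷ _) {fz} {fs j} e = ⊥-elim (All.lookup p (∈-lookup j) e)
unique-lookup (p ∷ _) {fs i} {fz} e = ⊥-elim (All.lookup p (∈-lookup i) (sym e))
unique-lookup (_ ∷ u) {fs i} {fs j} e = cong fs (unique-lookup u e)

unique-length : ∀ {n} {xs : List (Fin n)} → Unique xs → length xs ≤ n
unique-length u = injective⇒≤ (unique-lookup u)

fresh : ∀ {A : Set} {y : A} {S : List A} → ¬ y ∈ S → All (y ≢_) S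
fresh {S = []} _ = []
fresh {S = x ∷ S} p = (λ e → p (here e)) ∷ fresh (λ q → p (there q))

module _ {n : ℕ} (G : Graph (Fin n)) (Inv : List (Fin n) → Set)
  (step : ∀ {S x y} → Inv S → x ∈ S → ¬ y ∈ S → Adj G x y → Inv (y ∷ S)) where

  -- A set is grown along single edges, carrying an invariant, until it is closed. The invariant is
  -- reachability when components are built and a spanning tree when the edges of a tree are
  -- counted.
  record Grown (S : List (Fin n)) : Set where
    field
      set    : List (Fin n)
      unique : Unique set
      inv    : Inv set
      sub    : ∀ {z} → z ∈ S → z ∈ set
      closed : ∀ {x y} → x ∈ set → Adj G x y → y ∈ set

  private
    exit? : ∀ S → Dec (∃[ x ] ∃[ y ] (x ∈ S × ¬ y ∈ S × Adj G x y))
    exit? S = any? λ x → any? λ y → (x ∈? S) ×-dec (¬? (y ∈? S) ×-dec adj? G x y)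

    grow′ : ∀ k S → n ≤ k + length S → Unique S → Inv S → Grown S
    grow′ k S le u i with exit? S
    grow′ k S le u i | no ¬e = record
      { set = S ; unique = u ; inv = i ; sub = id ; closed = closed }
      where
      closed : ∀ {x y} → x ∈ S → Adj G x y → y ∈ S
      closed {x} {y} p q with y ∈? S
      ... | yes r = r
      ... | no ¬r = ⊥-elim (¬e (x , y , p , ¬r , q))
    -- The fuel cannot run out: `y ∷ S` would have more than `n` distinct entries.
    grow′ zero S le u i | yes (x , y , p , q , r) = ⊥-elim (<-irrefl refl (≤-trans (unique-length (fresh q ∷ u)) le))
    grow′ (suc k) S le u i | yes (x , y , p , q , r) =
      let g = grow′ k (y ∷ S) (≤-trans le (≤-reflexive (sym (+-suc k (length S))))) (fresh q ∷ u) (step i p q r)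
      in record { Grown g ; sub = λ z → Grown.sub g (there z) }

  grow : ∀ u → Inv (u ∷ []) → Grown (u ∷ [])
  grow u i = grow′ n (u ∷ []) (m≤m+n n _) ([] ∷ []) i

record IsComp {n : ℕ} (G : Graph (Fin n)) (U : VSet n) (u : Fin n) (C : VSet n) : Set where
  field
    sub    : ∀ {x} → x ∈ᵇ C → x ∈ᵇ U
    closed : ∀ {x y} → x ∈ᵇ C → Adj G x y → y ∈ᵇ U → y ∈ᵇ C
    root∈  : u ∈ᵇ C
    paths  : ∀ {x} → x ∈ᵇ C → Star (Adj (G [ C ])) u x

star-closed : ∀ {n} (G : Graph (Fin n)) (C : VSet n) → (∀ {x y} → x ∈ᵇ C → Adj G x y → y ∈ᵇ C) →
  ∀ {x y} → x ∈ᵇ C → Star (Adj G) x y → Star (Adj (G [ C ])) x y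
star-closed G C cl p ε = ε
star-closed G C cl p (e ◅ s) = ind⁺ G C e p (cl p e) ◅ star-closed G C cl (cl p e) s

component : ∀ {n} (G : Graph (Fin n)) (U : VSet n) (u : Fin n) → u ∈ᵇ U → Σ[ C ∈ VSet n ] IsComp G U u C
component {n} G U u u∈ = ⟦ Grown.set g ⟧ , record
  { sub = λ p → star⊆ (All.lookup (Grown.inv g) (⟦⟧⁻ _ p))
  ; closed = λ p e q → ⟦⟧⁺ _ (Grown.closed g (⟦⟧⁻ _ p) (ind⁺ G U e (star⊆ (All.lookup (Grown.inv g) (⟦⟧⁻ _ p))) q))
  ; root∈ = ⟦⟧⁺ _ (Grown.sub g (here refl))
  ; paths = λ p → Star.map (λ e → let e′ , c = ind⁻ (G [ U ]) ⟦ Grown.set g ⟧ e in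
      ind⁺ G ⟦ Grown.set g ⟧ (proj₁ (ind⁻ G U e′)) (proj₁ c) (proj₂ c))
      (star-closed (G [ U ]) ⟦ Grown.set g ⟧ (λ q e → ⟦⟧⁺ _ (Grown.closed g (⟦⟧⁻ _ q) e))
        (⟦⟧⁺ _ (Grown.sub g (here refl))) (All.lookup (Grown.inv g) (⟦⟧⁻ _ p))) }
  where
  Reach : List (Fin n) → Set
  Reach = All (Star (Adj (G [ U ])) u)
  g : Grown (G [ U ]) Reach (λ i p _ e → (All.lookup i p ◅◅ (e ◅ ε)) ∷ i) (u ∷ [])
  g = grow (G [ U ]) Reach (λ i p _ e → (All.lookup i p ◅◅ (e ◅ ε)) ∷ i) u (ε ∷ [])
  star⊆′ : ∀ {x y} → x ∈ᵇ U → Star (Adj (G [ U ])) x y → y ∈ᵇ U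
  star⊆′ p ε = p
  star⊆′ p (e ◅ s) = star⊆′ (proj₂ (proj₂ (ind⁻ G U e))) s
  star⊆ : ∀ {y} → Star (Adj (G [ U ])) u y → y ∈ᵇ U
  star⊆ = star⊆′ u∈

-- Isolated vertices are ignored, since every subgraph keeps the vertex set `Fin n` and the vertices
-- outside the part at hand become isolated.
Conn : ∀ {n} → Graph (Fin n) → Set
Conn {n} H = Σ[ u ∈ Fin n ] (∀ {x y} → Adj H x y → Star (Adj H) u x)

comp-conn : ∀ {n} (G : Graph (Fin n)) {U u C} → IsComp G U u C → Conn (G [ C ])
comp-conn G {C = C} ic = _ , λ p → IsComp.paths ic (proj₁ (proj₂ (ind⁻ G C p)))

conn-path : ∀ {n} (H : Graph (Fin n)) → Conn H → ∀ {x x′ y y′} → Adj H x x′ → Adj H y y′ → Star (Adj H) x y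
conn-path H (u , c) p q = reverse (~-sym H) (c p) ◅◅ c q

star-touched : ∀ {n} (H : Graph (Fin n)) {x y} → x ≢ y → Star (Adj H) x y → ∃[ z ] Adj H x z
star-touched H x≢y ε = ⊥-elim (x≢y refl)
star-touched H x≢y (e ◅ _) = _ , e

exit : ∀ {n} (H : Graph (Fin n)) (S : VSet n) {x y} → x ∈ᵇ S → y ∉ᵇ S → Star (Adj H) x y →
  ∃[ p ] ∃[ q ] (p ∈ᵇ S × q ∉ᵇ S × Adj H p q)
exit H S p q ε = ⊥-elim (q p)
exit H S {x} p q (_◅_ {j = z} e s) with z ∈ᵇ? S
... | yes r = exit H S r q s
... | no ¬r = x , z , p , ¬r , e

-- Squares and isolating lists

-- Consecutive corners differ because they are adjacent, so the two inequalities make all four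
-- distinct. Chords are allowed.
record Sq {n : ℕ} (G : Graph (Fin n)) (a b c d : Fin n) : Set where
  constructor sq
  field
    ab : Adj G a b
    bc : Adj G b c
    cd : Adj G c d
    da : Adj G d a
    a≢c : a ≢ c
    b≢d : b ≢ d

rot : ∀ {n} {G : Graph (Fin n)} {a b c d} → Sq G a b c d → Sq G b c d a
rot (sq ab bc cd da ac bd) = sq bc cd da ab bd (ac ∘ sym)

mirror : ∀ {n} {G : Graph (Fin n)} {a b c d} → Sq G a b c d → Sq G a d c b
mirror {G = G} (sq ab bc cd da ac bd) = sq (~-sym G da) (~-sym G cd) (~-sym G bc) (~-sym G ab) ac (bd ∘ sym)

sq-map : ∀ {n} (G H : Graph (Fin n)) {a b c d} → G ⊆ᴳ H → Sq G a b c d → Sq H a b c d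
sq-map G H f (sq ab bc cd da ac bd) = sq (f ab) (f bc) (f cd) (f da) ac bd

sq-ind : ∀ {n} {G : Graph (Fin n)} {S : VSet n} {a b c d} → Sq G a b c d →
  All (_∈ᵇ S) (a ∷ b ∷ c ∷ d ∷ []) → Sq (G [ S ]) a b c d
sq-ind {G = G} {S} (sq ab bc cd da ac bd) (p ∷ q ∷ r ∷ s ∷ []) =
  sq (ind⁺ G S ab p q) (ind⁺ G S bc q r) (ind⁺ G S cd r s) (ind⁺ G S da s p) ac bd

sq? : ∀ {n} (G : Graph (Fin n)) a b c d → Dec (Sq G a b c d)
sq? G a b c d = map′ (λ (p , q , r , s , t , u) → sq p q r s t u) (λ (sq p q r s t u) → p , q , r , s , t , u)
  (adj? G a b ×-dec (adj? G b c ×-dec (adj? G c d ×-dec (adj? G d a ×-dec (¬? (a ≟ c) ×-dec ¬? (b ≟ d))))))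

InSq : ∀ {n} → Graph (Fin n) → Fin n → Fin n → Set
InSq G a b = ∃[ c ] ∃[ d ] Sq G a b c d

inSq? : ∀ {n} (G : Graph (Fin n)) a b → Dec (InSq G a b)
inSq? G a b = any? λ c → any? λ d → sq? G a b c d

inSq-sym : ∀ {n} (G : Graph (Fin n)) {a b} → InSq G a b → InSq G b a
inSq-sym G (c , d , s) = d , c , rot (rot (rot (mirror s)))

quad : ∀ {n} → Fin n → Fin n → Fin n → Fin n → List (Fin n)
quad a b c d = a ∷ b ∷ c ∷ d ∷ []

Near : ∀ {n} → Graph (Fin n) → List (Fin n) → Fin n → Set
Near G D x = Any (λ u → u ≡ x ⊎ Adj G u x) D

near-map : ∀ {n} (G H : Graph (Fin n)) {D x} → G ⊆ᴳ H → Near G D x → Near H D x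
near-map G H f = Any.map λ { (inj₁ e) → inj₁ e ; (inj₂ e) → inj₂ (f e) }

-- The positive form of isolation, which produces a dominated corner. Lists in place of subsets make
-- the size of a union additive.
Isol : ∀ {n} → Graph (Fin n) → List (Fin n) → Set
Isol G D = ∀ {a b c d} → Sq G a b c d → Any (Near G D) (quad a b c d)

Bounded : ∀ {n} → ℕ → Graph (Fin n) → Set
Bounded {n} m G = Σ[ D ∈ List (Fin n) ] (Isol G D × 6 * length D ≤ m)

Strict Weak : ∀ {n} → Graph (Fin n) → Set
Strict G = Bounded (size G) G
Weak G = Bounded (suc (size G)) G

rotAny : ∀ {n} {P : Fin n → Set} {a b c d} → Any P (quad b c d a) → Any P (quad a b c d)
rotAny (here p) = there (here p)
rotAny (there (here p)) = there (there (here p))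
rotAny (there (there (here p))) = there (there (there (here p)))
rotAny (there (there (there (here p)))) = here p

-- By rotation, the corner with property `P` may be taken to be the first one.
sq-first : ∀ {n} {G : Graph (Fin n)} {P Q : Fin n → Set} →
  (∀ {a b c d} → Sq G a b c d → P a → Any Q (quad a b c d)) →
  ∀ {a b c d} → Sq G a b c d → Any P (quad a b c d) → Any Q (quad a b c d)
sq-first f s (here p) = f s p
sq-first f s (there (here p)) = rotAny (f (rot s) p)
sq-first f s (there (there (here p))) = rotAny (rotAny (f (rot (rot s)) p))
sq-first f s (there (there (there (here p)))) = rotAny (rotAny (rotAny (f (rot (rot (rot s))) p)))

-- Charging edges to components

module _ {n : ℕ} (G : Graph (Fin n)) (v : Fin n) where

  -- `k` is the surplus left at `S` after paying for `D`. Squares inside `S` may also be hit by `v`,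
  -- which is paid for once, in `discharge`.
  record Chg (S : VSet n) (k : ℕ) : Set where
    constructor chg
    field
      D     : List (Fin n)
      hits  : ∀ {a b c d} → Sq G a b c d → All (_∈ᵇ S) (quad a b c d) → Any (Near G (v ∷ D)) (quad a b c d)
      bound : 6 * length D + k ≤ τ G S
  open Chg

  -- No edge joins the two parts, so the edges charged to them are disjoint and a square that starts
  -- in one part stays in it.
  chg-∪ : ∀ {S S₁ S₂ k₁ k₂} → (∀ {x} → x ∈ᵇ S → x ∈ᵇ S₁ ⊎ x ∈ᵇ S₂) →
    (∀ {x} → x ∈ᵇ S₁ → x ∈ᵇ S) → (∀ {x} → x ∈ᵇ S₂ → x ∈ᵇ S) → (∀ {x} → x ∈ᵇ S₁ → x ∉ᵇ S₂) →
    (∀ {x y} → x ∈ᵇ S₁ → y ∈ᵇ S₂ → ¬ Adj G x y) → Chg S₁ k₁ → Chg S₂ k₂ → Chg S (k₁ + k₂)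
  chg-∪ {S} {S₁} {S₂} {k₁} {k₂} cov i₁ i₂ dis nox (chg D₁ h₁ b₁) (chg D₂ h₂ b₂) =
    chg (D₁ ++ D₂) hit bd
    where
    near₁ : ∀ {x} → Near G (v ∷ D₁) x → Near G (v ∷ D₁ ++ D₂) x
    near₁ (here p) = here p
    near₁ (there p) = there (++⁺ˡ p)
    near₂ : ∀ {x} → Near G (v ∷ D₂) x → Near G (v ∷ D₁ ++ D₂) x
    near₂ (here p) = here p
    near₂ (there p) = there (++⁺ʳ D₁ p)
    go₁ : ∀ {x y} → Adj G x y → x ∈ᵇ S₁ → y ∈ᵇ S → y ∈ᵇ S₁
    go₁ e p q with cov q
    ... | inj₁ r = r
    ... | inj₂ r = ⊥-elim (nox p r e)
    go₂ : ∀ {x y} → Adj G x y → x ∈ᵇ S₂ → y ∈ᵇ S → y ∈ᵇ S₂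
    go₂ e p q with cov q
    ... | inj₁ r = ⊥-elim (nox r p (~-sym G e))
    ... | inj₂ r = r
    hit : ∀ {a b c d} → Sq G a b c d → All (_∈ᵇ S) (quad a b c d) → Any (Near G (v ∷ D₁ ++ D₂)) (quad a b c d)
    hit s@(sq ab bc cd da _ _) (p ∷ q ∷ r ∷ t ∷ []) with cov p
    ... | inj₁ p₁ = let q₁ = go₁ ab p₁ q ; r₁ = go₁ bc q₁ r ; t₁ = go₁ cd r₁ t in
          Any.map near₁ (h₁ s (p₁ ∷ q₁ ∷ r₁ ∷ t₁ ∷ []))
    ... | inj₂ p₂ = let q₂ = go₂ ab p₂ q ; r₂ = go₂ bc q₂ r ; t₂ = go₂ cd r₂ t in
          Any.map near₂ (h₂ s (p₂ ∷ q₂ ∷ r₂ ∷ t₂ ∷ []))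
    disj : ∀ {x y} → Adj (G ∩ touch S₁) x y → Adj (G ∩ touch S₂) x y → ⊥
    disj p q with ∩⁻ G (touch S₁) p | ∩⁻ G (touch S₂) q
    ... | e , inj₁ x₁ | _ , inj₁ x₂ = dis x₁ x₂
    ... | e , inj₁ x₁ | _ , inj₂ y₂ = nox x₁ y₂ e
    ... | e , inj₂ y₁ | _ , inj₁ x₂ = nox y₁ x₂ (~-sym G e)
    ... | e , inj₂ y₁ | _ , inj₂ y₂ = dis y₁ y₂
    grow-touch : ∀ {R} → (∀ {x} → x ∈ᵇ R → x ∈ᵇ S) → (G ∩ touch R) ⊆ᴳ (G ∩ touch S)
    grow-touch {R} i p with ∩⁻ G (touch R) p
    ... | e , inj₁ x = ∩⁺ G (touch S) e (inj₁ (i x))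
    ... | e , inj₂ x = ∩⁺ G (touch S) e (inj₂ (i x))
    shuffle : ∀ a b c d → 6 * (a + b) + (c + d) ≡ (6 * a + c) + (6 * b + d)
    shuffle = solve-∀
    bd : 6 * length (D₁ ++ D₂) + (k₁ + k₂) ≤ τ G S
    bd = begin
      6 * length (D₁ ++ D₂) + (k₁ + k₂)       ≡⟨ cong (λ l → 6 * l + (k₁ + k₂)) (length-++ D₁) ⟩
      6 * (length D₁ + length D₂) + (k₁ + k₂) ≡⟨ shuffle (length D₁) (length D₂) k₁ k₂ ⟩
      (6 * length D₁ + k₁) + (6 * length D₂ + k₂) ≤⟨ +-mono-≤ b₁ b₂ ⟩
      τ G S₁ + τ G S₂ ≤⟨ size-super (G ∩ touch S₁) (G ∩ touch S₂) (G ∩ touch S) (grow-touch i₁) (grow-touch i₂) disj ⟩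
      τ G S ∎
      where open ≤-Reasoning

  chg-split : ∀ {U U′ u C k₁ k₂} → (∀ {x} → x ∈ᵇ U′ → x ∈ᵇ U) → IsComp G U u C → (∀ {x} → x ∈ᵇ C → x ∈ᵇ U′) →
    Chg C k₁ → Chg (U′ ∖ C) k₂ → Chg U′ (k₁ + k₂)
  chg-split {U} {U′} {u} {C} U′⊆U ic C⊆U′ = chg-∪ cov C⊆U′ (λ p → proj₁ (out p))
    (λ p q → proj₂ (out q) p) (λ p q e → proj₂ (out q) (IsComp.closed ic p e (U′⊆U (proj₁ (out q)))))
    where
    out : ∀ {x} → x ∈ᵇ (U′ ∖ C) → x ∈ᵇ U′ × x ∉ᵇ C
    out = set⁻ (λ x → (x ∈ᵇ? U′) ×-dec ¬? (x ∈ᵇ? C))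
    cov : ∀ {x} → x ∈ᵇ U′ → x ∈ᵇ C ⊎ x ∈ᵇ (U′ ∖ C)
    cov {x} p with x ∈ᵇ? C
    ... | yes q = inj₁ q
    ... | no ¬q = inj₂ (set⁺ (λ x → (x ∈ᵇ? U′) ×-dec ¬? (x ∈ᵇ? C)) (p , ¬q))

  module _ {U : VSet n} (all : ∀ {u C} → IsComp G U u C → Chg C 0) where

    -- Components are peeled off one by one, while `vs` shrinks and still lists the remaining
    -- vertices. As `U′` is closed in `U`, a component of `U′` is also one of `U`.
    chg-closed : ∀ vs U′ → (∀ {x} → x ∈ᵇ U′ → x ∈ vs) → (∀ {x} → x ∈ᵇ U′ → x ∈ᵇ U) →
      (∀ {x y} → x ∈ᵇ U′ → Adj G x y → y ∈ᵇ U → y ∈ᵇ U′) → Chg U′ 0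
    chg-closed [] U′ lst _ _ = chg [] (λ { _ (p ∷ _) → ⊥-elim (case (lst p)) }) z≤n
      where
      case : ∀ {x} → x ∈ [] → ⊥
      case ()
    chg-closed (u ∷ vs) U′ lst sub cl with u ∈ᵇ? U′
    ... | no ¬p = chg-closed vs U′ (λ q → drop q (lst q)) sub cl
      where
      drop : ∀ {x} → x ∈ᵇ U′ → x ∈ (u ∷ vs) → x ∈ vs
      drop q (here refl) = ⊥-elim (¬p q)
      drop q (there r) = r
    ... | yes p with component G U′ u p
    ...   | C , ic = chg-split sub ic′ (IsComp.sub ic) (all ic′) (chg-closed vs (U′ ∖ C)
              (λ q → drop (proj₂ (out q)) (lst (proj₁ (out q)))) (λ q → sub (proj₁ (out q))) cl′)
      where
      ic′ : IsComp G U u C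
      ic′ = record { IsComp ic ; sub = λ q → sub (IsComp.sub ic q)
                   ; closed = λ q e r → IsComp.closed ic q e (cl (IsComp.sub ic q) e r) }
      out : ∀ {x} → x ∈ᵇ (U′ ∖ C) → x ∈ᵇ U′ × x ∉ᵇ C
      out = set⁻ (λ x → (x ∈ᵇ? U′) ×-dec ¬? (x ∈ᵇ? C))
      drop : ∀ {x} → x ∉ᵇ C → x ∈ (u ∷ vs) → x ∈ vs
      drop q (here refl) = ⊥-elim (q (IsComp.root∈ ic))
      drop q (there r) = r
      cl′ : ∀ {x y} → x ∈ᵇ (U′ ∖ C) → Adj G x y → y ∈ᵇ U → y ∈ᵇ (U′ ∖ C)
      cl′ q e r = set⁺ (λ x → (x ∈ᵇ? U′) ×-dec ¬? (x ∈ᵇ? C)) (cl (proj₁ (out q)) e r ,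
        λ y∈ → proj₂ (out q) (IsComp.closed ic y∈ (~-sym G e) (proj₁ (out q))))

    chg-all : Chg U 0
    chg-all = chg-closed (allFin n) U (λ {x} _ → ∈-allFin x) id (λ _ _ p → p)

    chg-one : ∀ {u C k} → IsComp G U u C → Chg C k → Chg U k
    chg-one {u} {C} {k} ic c = subst (Chg U) (+-identityʳ k) (chg-split id ic (IsComp.sub ic) c
      (chg-closed (allFin n) (U ∖ C) (λ {x} _ → ∈-allFin x) (λ q → proj₁ (out q)) cl))
      where
      out : ∀ {x} → x ∈ᵇ (U ∖ C) → x ∈ᵇ U × x ∉ᵇ C
      out = set⁻ (λ x → (x ∈ᵇ? U) ×-dec ¬? (x ∈ᵇ? C))
      cl : ∀ {x y} → x ∈ᵇ (U ∖ C) → Adj G x y → y ∈ᵇ U → y ∈ᵇ (U ∖ C)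
      cl q e r = set⁺ (λ x → (x ∈ᵇ? U) ×-dec ¬? (x ∈ᵇ? C)) (r ,
        λ y∈ → proj₂ (out q) (IsComp.closed ic y∈ (~-sym G e) (proj₁ (out q))))

  Kills : VSet n → Set
  Kills L = ∀ {a b c d} → Sq G a b c d → a ∈ᵇ L → Any (Near G (v ∷ [])) (quad a b c d)

  -- An edge inside `L` does not touch the complement, so the two edge counts do not overlap;
  -- together they pay the price 6 of `v`. A square meeting `L` is hit by `v`, any other lies in the
  -- complement and is hit there.
  discharge : ∀ {L k} → Kills L → Chg (∁ L) k → 6 ≤ size (G [ L ]) + k → Strict G
  discharge {L} {k} kill (chg D h b) le = v ∷ D , iso , bd
    where
    one : ∀ {x} → Near G (v ∷ []) x → Near G (v ∷ D) x
    one (here p) = here p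
    iso : Isol G (v ∷ D)
    iso {a} {b} {c} {d} s with Any.any? (_∈ᵇ? L) (quad a b c d)
    ... | yes p = Any.map one (sq-first kill s p)
    ... | no ¬p = h s (∁⁺ L (λ q → ¬p (here q)) ∷ ∁⁺ L (λ q → ¬p (there (here q))) ∷
        ∁⁺ L (λ q → ¬p (there (there (here q)))) ∷ ∁⁺ L (λ q → ¬p (there (there (there (here q))))) ∷ [])
    disj : ∀ {x y} → Adj (G [ L ]) x y → Adj (G ∩ touch (∁ L)) x y → ⊥
    disj p q with ind⁻ G L p | ∩⁻ G (touch (∁ L)) q
    ... | _ , x , _ | _ , inj₁ x′ = ∁⁻ L x′ x
    ... | _ , _ , y | _ , inj₂ y′ = ∁⁻ L y′ y
    bd : 6 * length (v ∷ D) ≤ size G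
    bd = begin
      6 * length (v ∷ D)         ≡⟨ *-suc 6 (length D) ⟩
      6 + 6 * length D           ≤⟨ +-monoˡ-≤ _ le ⟩
      size (G [ L ]) + k + 6 * length D ≡⟨ shuffle (size (G [ L ])) k (6 * length D) ⟩
      size (G [ L ]) + (6 * length D + k) ≤⟨ +-monoʳ-≤ (size (G [ L ])) b ⟩
      size (G [ L ]) + τ G (∁ L) ≤⟨ size-super (G [ L ]) (G ∩ touch (∁ L)) G (∩-⊆ G _) (∩-⊆ G _) disj ⟩
      size G ∎
      where
      open ≤-Reasoning
      shuffle : ∀ a b c → a + b + c ≡ a + (c + b)
      shuffle = solve-∀

  chg-isol : ∀ {S D k} → Isol (G [ S ]) D → 6 * length D + k ≤ τ G S → Chg S k
  chg-isol {S} {D} i b = chg D (λ s al → Any.map (λ p → there (near-map (G [ S ]) G (∩-⊆ G (inside S)) p)) (i (sq-ind s al))) b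

-- Concrete edge lists and squares on four vertices

distinct? : ∀ {k} (es : List (Fin k × Fin k)) → Dec (Distinct es)
distinct? = allPairs? (λ e f → ¬? (sameEdge? e f))

vec-inj : ∀ {n k} {vs : Vec (Fin n) k} → VU.Unique vs → Injective _≡_ _≡_ (Vec.lookup vs)
vec-inj u = VUP.lookup-injective u _ _

EdgeOf : ∀ {k} → List (Fin k × Fin k) → Fin k → Fin k → Set
EdgeOf es i j = Any (λ e → SameEdge e (i , j)) es

edgeOf? : ∀ {k} (es : List (Fin k × Fin k)) i j → Dec (EdgeOf es i j)
edgeOf? es i j = Any.any? (λ e → sameEdge? e (i , j)) es

edge-index : ∀ {n k} (f : Fin k → Fin n) (es : List (Fin k × Fin k)) {x y} →
  Any (λ (i , j) → SameEdge (f i , f j) (x , y)) es → ∃[ i ] ∃[ j ] (x ≡ f i × y ≡ f j × EdgeOf es i j)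
edge-index f ((i , j) ∷ es) (here (inj₁ (p , q))) = i , j , p , q , here (inj₁ (refl , refl))
edge-index f ((i , j) ∷ es) (here (inj₂ (p , q))) = j , i , p , q , here (inj₂ (refl , refl))
edge-index f (_ ∷ es) (there p) with edge-index f es p
... | i , j , q , r , s = i , j , q , r , there s

sq-unique : ∀ {n} (G : Graph (Fin n)) {a b c d} → Sq G a b c d → VU.Unique (a ∷ b ∷ c ∷ d ∷ [])
sq-unique G (sq ab bc cd da ac bd) = (~⇒≢ G ab VA.∷ ac VA.∷ (~⇒≢ G da ∘ sym) VA.∷ VA.[]) VP.∷
  (~⇒≢ G bc VA.∷ bd VA.∷ VA.[]) VP.∷ (~⇒≢ G cd VA.∷ VA.[]) VP.∷ VA.[] VP.∷ VP.[]

vec4 : ∀ {n} → Fin n → Fin n → Fin n → Fin n → Fin 4 → Fin n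
vec4 a b c d = Vec.lookup (a ∷ b ∷ c ∷ d ∷ [])

c4-edges k4m-edges : List (Fin 4 × Fin 4)
c4-edges = (0F , 1F) ∷ (1F , 2F) ∷ (2F , 3F) ∷ (3F , 0F) ∷ []
k4m-edges = (0F , 2F) ∷ c4-edges

private
  pigeon : (a b c d : Fin 4) → a ≢ b × a ≢ c × a ≢ d × b ≢ c × b ≢ d × c ≢ d → ∀ k → Any (_≡ k) (quad a b c d)
  pigeon = toWitness {a? = all? λ a → all? λ b → all? λ c → all? λ d →
    (¬? (a ≟ b) ×-dec ¬? (a ≟ c) ×-dec ¬? (a ≟ d) ×-dec ¬? (b ≟ c) ×-dec ¬? (b ≟ d) ×-dec ¬? (c ≟ d))
      →-dec all? λ k → Any.any? (_≟ k) (quad a b c d)} tt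

any-vec : ∀ {n k} (f : Fin k → Fin n) {a b c d : Fin n} {i j p q} → a ≡ f i → b ≡ f j → c ≡ f p → d ≡ f q →
  ∀ {r} → Any (_≡ r) (quad i j p q) → Any (_≡ f r) (quad a b c d)
any-vec f e _ _ _ (here refl) = here e
any-vec f _ e _ _ (there (here refl)) = there (here e)
any-vec f _ _ e _ (there (there (here refl))) = there (there (here e))
any-vec f _ _ _ e (there (there (there (here refl)))) = there (there (there (here e)))

-- The corners of a square are distinct, so they exhaust a support of four vertices. Hence
-- dominating any one vertex of a C₄ or K₄⁻ isolates it.
sq-covers : ∀ {n} (H : Graph (Fin n)) (f : Fin 4 → Fin n) → (∀ {x y} → Adj H x y → ∃[ i ] x ≡ f i) →
  ∀ {a b c d} → Sq H a b c d → ∀ k → Any (_≡ f k) (quad a b c d)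
sq-covers H f cov s@(sq ab bc cd da ac bd) k with cov ab | cov bc | cov cd | cov da
... | i , refl | j , refl | p , refl | q , refl = any-vec f refl refl refl refl
    (pigeon i j p q (ne (~⇒≢ H ab) , ne ac , ne (~⇒≢ H da ∘ sym) , ne (~⇒≢ H bc) , ne bd , ne (~⇒≢ H cd)) k)
  where
  ne : ∀ {u w} → f u ≢ f w → u ≢ w
  ne p refl = p refl

-- The exceptional graphs

-- By `size-tight`, a square and the number of edges determine every edge; nothing is said about the
-- isolated vertices of `Fin n`.
record C4G {n : ℕ} (G : Graph (Fin n)) : Set where
  constructor c4g
  field
    {q₀ q₁ q₂ q₃} : Fin n
    square : Sq G q₀ q₁ q₂ q₃
    size≡  : size G ≡ 4

  vert : Fin 4 → Fin n
  vert = vec4 q₀ q₁ q₂ q₃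

  class : ∀ {x y} → Adj G x y → ∃[ i ] ∃[ j ] (x ≡ vert i × y ≡ vert j × EdgeOf c4-edges i j)
  class p = edge-index vert c4-edges (size-tight G vert (vec-inj (sq-unique G square)) c4-edges
    (from-yes (distinct? c4-edges)) (Sq.ab square ∷ Sq.bc square ∷ Sq.cd square ∷ Sq.da square ∷ [])
    (≤-reflexive size≡) p)

  covers : ∀ {x y} → Adj G x y → ∃[ i ] x ≡ vert i
  covers p = let i , _ , e , _ = class p in i , e

record K4mG {n : ℕ} (G : Graph (Fin n)) : Set where
  constructor k4mg
  field
    {q₀ q₁ q₂ q₃} : Fin n
    square : Sq G q₀ q₁ q₂ q₃
    chord  : Adj G q₀ q₂
    size≡  : size G ≡ 5

  vert : Fin 4 → Fin n
  vert = vec4 q₀ q₁ q₂ q₃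

  class : ∀ {x y} → Adj G x y → ∃[ i ] ∃[ j ] (x ≡ vert i × y ≡ vert j × EdgeOf k4m-edges i j)
  class p = edge-index vert k4m-edges (size-tight G vert (vec-inj (sq-unique G square)) k4m-edges
    (from-yes (distinct? k4m-edges))
    (chord ∷ Sq.ab square ∷ Sq.bc square ∷ Sq.cd square ∷ Sq.da square ∷ [])
    (≤-reflexive size≡) p)

  covers : ∀ {x y} → Adj G x y → ∃[ i ] x ≡ vert i
  covers p = let i , _ , e , _ = class p in i , e

-- Vertex 0 of a block is the vertex of T; vertices 1, …, 4 are its copy of C₄, with 1 joined to 0.
b5 : Fin 5 → Fin 5 → Bool
b5 fz fz = false
b5 fz (fs b) = eqb b fz
b5 (fs a) fz = eqb a fz
b5 (fs a) (fs b) = c4adj a b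

module _ {n t : ℕ} (G : Graph (Fin n)) (bs : Fin t → Fin 5 → Fin n) where
  Local Top : Fin n → Fin n → Set
  Local x y = ∃[ i ] ∃[ j ] ∃[ j′ ] (x ≡ bs i j × y ≡ bs i j′ × b5 j j′ ≡ true)
  Top x y = ∃[ i ] ∃[ i′ ] (x ≡ bs i fz × y ≡ bs i′ fz)

  record Blocks : Set where
    field
      inj   : ∀ {i j i′ j′} → bs i j ≡ bs i′ j′ → i ≡ i′ × j ≡ j′
      local : ∀ i j j′ → b5 j j′ ≡ true → Adj G (bs i j) (bs i j′)
      class : ∀ {x y} → Adj G x y → Local x y ⊎ Top x y

-- The tree is represented only by a count: besides the `5t` local edges, `bound` demands at least
-- `t − 1` others. That they form a tree is recovered at the end, from the case of equality.
record ConsG {n : ℕ} (G : Graph (Fin n)) : Set where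
  constructor consg
  field
    {t}    : ℕ
    bs     : Fin t → Fin 5 → Fin n
    blocks : Blocks G bs
    base   : Fin t
    bound  : 6 * t ≤ suc (size G)

private
  b5-square : (a b c d : Fin 5) → b5 a b ≡ true × b5 b c ≡ true × b5 c d ≡ true × b5 d a ≡ true × a ≢ c × b ≢ d →
    ∀ k → Any (_≡ fs k) (quad a b c d)
  b5-square = toWitness {a? = all? λ a → all? λ b → all? λ c → all? λ d →
    ((b5 a b Bool.≟ true) ×-dec (b5 b c Bool.≟ true) ×-dec (b5 c d Bool.≟ true) ×-dec (b5 d a Bool.≟ true)
       ×-dec ¬? (a ≟ c) ×-dec ¬? (b ≟ d))
      →-dec all? λ k → Any.any? (_≟ fs k) (quad a b c d)} tt

b5-nbr : ∀ j → ∃[ j′ ] b5 j j′ ≡ true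
b5-nbr fz = 1F , refl
b5-nbr (fs fz) = 2F , refl
b5-nbr (fs (fs fz)) = 3F , refl
b5-nbr (fs (fs (fs fz))) = 4F , refl
b5-nbr (fs (fs (fs (fs fz)))) = 1F , refl

module _ {n t : ℕ} {G : Graph (Fin n)} {bs : Fin t → Fin 5 → Fin n} (B : Blocks G bs) where
  open Blocks B

  Whole : Fin t → List (Fin n) → Set
  Whole i xs = ∀ k → Any (_≡ bs i (fs k)) xs

  private
    -- Two local edges at a corner lie in one block, and the tree vertex is the only exit of a
    -- block. A square that left the block and came back would repeat this vertex or contain a loop,
    -- so all its edges are local and `b5-square` applies.
    corner : ∀ {a b c d} → Sq G a b c d → Local G bs d a → Local G bs a b → Local G bs b c ⊎ Top G bs b c →
      Local G bs c d ⊎ Top G bs c d → ∃[ i ] Whole i (quad a b c d)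
    corner s (i , jd , ja , refl , refl , da) (_ , _ , jb , e , refl , ab) e₂ e₃ with inj e
    corner s (i , jd , ja , refl , refl , da) (_ , _ , jb , e , refl , ab) (inj₁ (_ , _ , jc , e₂ , refl , bc)) e₃
      | refl , refl with inj e₂
    corner s (i , jd , ja , refl , refl , da) (_ , _ , jb , e , refl , ab) (inj₁ (_ , _ , jc , e₂ , refl , bc))
      (inj₁ (_ , _ , _ , e₃ , e₄ , cd)) | refl , refl | refl , refl with inj e₃ | inj e₄
    ... | refl , refl | _ , refl = i , λ k → any-vec (bs i) refl refl refl refl
          (b5-square ja jb jc jd (ab , bc , cd , da , (λ { refl → Sq.a≢c s refl }) , λ { refl → Sq.b≢d s refl }) k)
    corner s (i , jd , ja , refl , refl , da) (_ , _ , jb , e , refl , ab) (inj₁ (_ , _ , jc , e₂ , refl , bc))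
      (inj₂ (_ , _ , e₃ , e₄)) | refl , refl | refl , refl with inj e₃ | inj e₄
    ... | refl , refl | refl , refl = ⊥-elim (~-irr G (Sq.cd s))
    corner s (i , jd , ja , refl , refl , da) (_ , _ , jb , e , refl , ab) (inj₂ (_ , _ , e₂ , refl))
      (inj₁ (_ , _ , _ , e₃ , e₄ , cd)) | refl , refl with inj e₂ | inj e₃ | inj e₄
    ... | refl , refl | refl , refl | refl , _ = ⊥-elim (~-irr G (Sq.bc s))
    corner s (i , jd , ja , refl , refl , da) (_ , _ , jb , e , refl , ab) (inj₂ (_ , _ , e₂ , refl))
      (inj₂ (_ , _ , e₃ , e₄)) | refl , refl with inj e₂ | inj e₄
    ... | refl , refl | refl , refl = ⊥-elim (Sq.b≢d s refl)

  -- `Top G bs a b` says only that `a` and `b` are tree vertices. If `ab` is local and neither `a`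
  -- nor `b` is a corner with two local edges, then `da` and `bc` join tree vertices, so both
  -- corners are tree vertices.
  blocks-sq : ∀ {a b c d} → Sq G a b c d → (∃[ i ] Whole i (quad a b c d)) ⊎ Top G bs a b
  blocks-sq s@(sq ab bc cd da _ _) with class ab | class da | class bc
  ... | inj₂ p | _ | _ = inj₂ p
  ... | inj₁ p | inj₁ q | r = inj₁ (corner s q p r (class cd))
  ... | inj₁ p | inj₂ q | inj₁ r =
        let i , w = corner (rot s) p r (class cd) (inj₂ q) in inj₁ (i , λ k → rotAny (w k))
  ... | inj₁ _ | inj₂ (_ , _ , _ , e) | inj₂ (_ , _ , e′ , _) = inj₂ (_ , _ , e , e′)

  tops : List (Fin n)
  tops = tabulate (λ i → bs i fz)

  blocks-isol : Isol G tops
  blocks-isol s with blocks-sq s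
  ... | inj₁ (i , w) = Any.map (λ { refl → tabulate⁺ i (inj₂ (local i fz 1F refl)) }) (w fz)
  ... | inj₂ (i , _ , refl , _) = here (tabulate⁺ i (inj₁ refl))

  block-sq : ∀ i → Sq G (bs i 1F) (bs i 2F) (bs i 3F) (bs i 4F)
  block-sq i = sq (local i _ _ refl) (local i _ _ refl) (local i _ _ refl) (local i _ _ refl)
    (λ e → case (proj₂ (inj e))) (λ e → case′ (proj₂ (inj e)))
    where
    case : ¬ (_≡_ {A = Fin 5} 1F 3F)
    case ()
    case′ : ¬ (_≡_ {A = Fin 5} 2F 4F)
    case′ ()

  nbr-in-block : ∀ {i k u} → Adj G u (bs i (fs k)) → ∃[ j ] (u ≡ bs i j × b5 j (fs k) ≡ true)
  nbr-in-block p with class p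
  ... | inj₂ (_ , _ , _ , e) = case (proj₂ (inj e))
    where
    case : ∀ {k : Fin 4} {A : Set} → fs k ≡ fz → A
    case ()
  ... | inj₁ (_ , j , _ , e , e′ , l) with inj e′
  ...   | refl , refl = j , e , l

  private
    hit-in-block : ∀ {D i k} → Near G D (bs i (fs k)) → Any (λ u → ∃[ j ] u ≡ bs i j) D
    hit-in-block {k = k} = Any.map λ { (inj₁ e) → fs k , e ; (inj₂ p) → let j , e , _ = nbr-in-block p in j , e }

    hit-block : ∀ {D} → Isol G D → ∀ i → Any (λ u → ∃[ j ] u ≡ bs i j) D
    hit-block iso i with iso (block-sq i)
    ... | here p = hit-in-block p
    ... | there (here p) = hit-in-block p
    ... | there (there (here p)) = hit-in-block p
    ... | there (there (there (here p))) = hit-in-block p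

  -- The closed neighbourhoods of the copies of C₄ are disjoint.
  blocks-lower : ∀ D → Isol G D → t ≤ length D
  blocks-lower D iso = injective⇒≤ {f = λ i → Any.index (hit-block iso i)} λ {i} {i′} e →
    let j , p = lookup-index (hit-block iso i)
        j′ , p′ = lookup-index (hit-block iso i′)
    in proj₁ (inj (trans (sym p) (trans (cong (lookup D) e) p′)))

cons-weak : ∀ {n} {G : Graph (Fin n)} → ConsG G → Weak G
cons-weak (consg {t} bs B _ bd) = tops B , blocks-isol B ,
  subst (λ l → 6 * l ≤ _) (sym (length-tabulate (λ i → bs i fz))) bd

data Ext {n : ℕ} (G : Graph (Fin n)) : Set where
  isK4m  : K4mG G → Ext G
  isCons : ConsG G → Ext G

data Result {n : ℕ} (G : Graph (Fin n)) : Set where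
  isStrict : Strict G → Result G
  isExt    : Ext G → Result G
  isC4     : C4G G → Result G

ext-weak : ∀ {n} {G : Graph (Fin n)} → Ext G → Weak G
ext-weak {G = G} (isK4m k) = K4mG.q₀ k ∷ [] ,
  (λ s → Any.map (λ e → here (inj₁ (sym e))) (sq-covers G (K4mG.vert k) (K4mG.covers k) s fz)) ,
  s≤s (≤-reflexive (sym (K4mG.size≡ k)))
ext-weak (isCons c) = cons-weak c

c4-isol : ∀ {n} {G : Graph (Fin n)} (c : C4G G) → Isol G (C4G.q₀ c ∷ [])
c4-isol {G = G} c s = Any.map (λ e → here (inj₁ (sym e))) (sq-covers G (C4G.vert c) (C4G.covers c) s fz)

-- Here `a` only has to be dominated from outside, and 4 edges are left over for this. Two such
-- sides of a bridge share one new vertex, since 4 + 4 exceeds its price 6.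
Spare : ∀ {n} → Graph (Fin n) → Fin n → Set
Spare {n} G a = Σ[ D ∈ List (Fin n) ]
  ((∀ {p q r s} → Sq G p q r s → Any (λ x → x ≡ a ⊎ Near G D x) (quad p q r s)) × 6 * length D + 4 ≤ size G)

record Rooted {n : ℕ} (G : Graph (Fin n)) (a : Fin n) : Set where
  constructor rooted
  field
    consG : ConsG G
    index : Fin (ConsG.t consG)
    root≡ : a ≡ ConsG.bs consG index fz

c4-spare : ∀ {n} {G : Graph (Fin n)} {a b} → C4G G → Adj G a b → Spare G a
c4-spare {G = G} c ab with C4G.covers c ab
... | i , refl = [] , (λ s → Any.map inj₁ (sq-covers G (C4G.vert c) (C4G.covers c) s i)) , ≤-reflexive (sym (C4G.size≡ c))

ext-spare : ∀ {n} {G : Graph (Fin n)} {a b} → Ext G → Adj G a b → Spare G a ⊎ Rooted G a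
ext-spare {G = G} (isK4m c) ab with K4mG.covers c ab
... | i , refl = inj₁ ([] , (λ s → Any.map inj₁ (sq-covers G (K4mG.vert c) (K4mG.covers c) s i)) ,
      ≤-trans (n≤1+n 4) (≤-reflexive (sym (K4mG.size≡ c))))
ext-spare {n} {G} {a} (isCons c@(consg {t} bs B _ bd)) ab with Blocks.class B ab
... | inj₂ (i , _ , e , _) = inj₂ (rooted c i e)
... | inj₁ (i , fz , _ , e , _) = inj₂ (rooted c i e)
... | inj₁ (i , fs k , _ , refl , _) = inj₁ (spare i bs B bd)
  where
  spare : ∀ {t} (i : Fin t) (bs : Fin t → Fin 5 → Fin n) → Blocks G bs → 6 * t ≤ suc (size G) → Spare G (bs i (fs k))
  spare {suc t} i bs B bd = D , hit , bd′
    where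
    open Blocks B
    -- The tree vertex of block `i` is omitted, because every square covering that block passes
    -- through `bs i (fs k)`. From `6 * t ≤ size + 1` this leaves 5 edges over, one more than
    -- required.
    D : List (Fin n)
    D = tabulate (λ j → bs (punchIn i j) fz)
    inD : ∀ {i′ x} → i′ ≢ i → bs i′ fz ≡ x ⊎ Adj G (bs i′ fz) x → Near G D x
    inD {i′} ne p = tabulate⁺ (punchOut (ne ∘ sym)) (subst (λ j → bs j fz ≡ _ ⊎ Adj G (bs j fz) _)
      (sym (punchIn-punchOut (ne ∘ sym))) p)
    hit : ∀ {p q r s} → Sq G p q r s → Any (λ x → x ≡ bs i (fs k) ⊎ Near G D x) (quad p q r s)
    hit s with blocks-sq B s
    hit s | inj₁ (i′ , w) with i′ ≟ i
    ... | yes refl = Any.map inj₁ (w k)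
    ... | no ne = Any.map (λ { refl → inj₂ (inD ne (inj₂ (local i′ fz 1F refl))) }) (w fz)
    hit s | inj₂ (i₁ , i₂ , refl , refl) with i₁ ≟ i
    ... | no ne = here (inj₂ (inD ne (inj₁ refl)))
    ... | yes refl = there (here (inj₂ (inD (λ { refl → ~-irr G (Sq.ab s) }) (inj₁ refl))))
    bd′ : 6 * length D + 4 ≤ size G
    bd′ = begin
      6 * length D + 4 ≡⟨ cong (λ l → 6 * l + 4) (length-tabulate (λ j → bs (punchIn i j) fz)) ⟩
      6 * t + 4        ≤⟨ +-monoʳ-≤ (6 * t) (n≤1+n 4) ⟩
      6 * t + 5        ≤⟨ s≤s⁻¹ (≤-trans (≤-reflexive (shuffle t)) bd) ⟩
      size G ∎
      where
      open ≤-Reasoning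
      shuffle : ∀ t → suc (6 * t + 5) ≡ 6 * suc t
      shuffle = solve-∀

-- Edges in no C₄: deletion, bridges and pendant squares

sq-del : ∀ {n} (G : Graph (Fin n)) {a b} → ¬ InSq G a b → ∀ {p q r s} → Sq G p q r s → Sq (del G a b) p q r s
sq-del G {a} {b} ¬i s = sq (keep s) (keep (rot s)) (keep (rot (rot s))) (keep (rot (rot (rot s)))) (Sq.a≢c s) (Sq.b≢d s)
  where
  keep : ∀ {p q r s} → Sq G p q r s → Adj (del G a b) p q
  keep t = ∩⁺ G (not-rel (edge a b)) (Sq.ab t)
    λ { (inj₁ (refl , refl)) → ¬i (_ , _ , t) ; (inj₂ (refl , refl)) → ¬i (inSq-sym G (_ , _ , t)) }

del-step : ∀ {n} (G : Graph (Fin n)) {a b} → Star (Adj (del G a b)) a b →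
  ∀ {x y} → Adj G x y → Star (Adj (del G a b)) x y
del-step G {a} {b} path {x} {y} p with sameEdge? (a , b) (x , y)
... | yes (inj₁ (refl , refl)) = path
... | yes (inj₂ (refl , refl)) = reverse (~-sym (del G a b)) path
... | no ¬s = ∩⁺ G (not-rel (edge a b)) p ¬s ◅ ε

del-conn : ∀ {n} (G : Graph (Fin n)) {a b} → Conn G → Star (Adj (del G a b)) a b → Conn (del G a b)
del-conn G (u , c) path = u , λ p → ((del-step G path) ⋆) (c (∩-⊆ G _ p))

root-touched : ∀ {n} (H : Graph (Fin n)) {a} → (∀ {x y} → Adj H x y → Star (Adj H) a x) →
  ∀ {p q} → Adj H p q → ∃[ z ] Adj H a z
root-touched H {a} c {p} pq with a ≟ p
... | yes refl = _ , pq
... | no a≢p = star-touched H a≢p (c pq)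

ext-edge : ∀ {n} {G : Graph (Fin n)} → Ext G → ∃[ x ] ∃[ y ] Adj G x y
ext-edge (isK4m k) = _ , _ , K4mG.chord k
ext-edge (isCons c) = _ , _ , Blocks.local (ConsG.blocks c) (ConsG.base c) fz 1F refl

-- The bridge case that separate treatment of the sides leaves open: a strict side and a C₄ side,
-- whose deficit 2 exceeds the single bridge edge. The neighbour `z` ensures that something besides
-- `x` remains on the other side.
record Pend {n : ℕ} (G : Graph (Fin n)) (x y : Fin n) : Set where
  field
    {p r q}   : Fin n
    square    : Sq G y p r q
    xy        : Adj G x y
    closed    : ∀ {z w} → z ∈ quad y p r q → Adj G z w → w ∈ quad y p r q ⊎ (z ≡ y × w ≡ x)
    chordless : ¬ Adj G y r
    x∉        : ¬ x ∈ quad y p r q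
    ¬inSq     : ¬ InSq G x y
    z         : Fin n
    xz        : Adj G x z
    z≢y       : z ≢ y

EdgeInfo : ∀ {n} → Graph (Fin n) → Fin n → Fin n → Set
EdgeInfo G a b = Result G ⊎ (InSq G a b ⊎ Pend G a b ⊎ Pend G b a)

module _ {n : ℕ} (G : Graph (Fin n)) where

  private
    opposite : ∀ {a b} → ¬ Adj (del G a b) a b → Adj G a b → (c : C4G (del G a b)) → ∀ i j →
      a ≡ C4G.vert c i → b ≡ C4G.vert c j → ∃[ p ] ∃[ q ] Sq G a p b q
    opposite {a} {b} ¬ab ab (c4g s _) = go
      where
      S = sq-map (del G a b) G (∩-⊆ G _) s
      flip′ : ∀ {x y} → Adj (del G x y) y x → Adj (del G x y) x y
      flip′ {x} {y} = ~-sym (del G x y)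
      go : ∀ i j → a ≡ vec4 _ _ _ _ i → b ≡ vec4 _ _ _ _ j → ∃[ p ] ∃[ q ] Sq G a p b q
      go 0F 0F refl refl = ⊥-elim (~-irr G ab)
      go 0F 1F refl refl = ⊥-elim (¬ab (Sq.ab s))
      go 0F 2F refl refl = _ , _ , S
      go 0F 3F refl refl = ⊥-elim (¬ab (flip′ (Sq.da s)))
      go 1F 0F refl refl = ⊥-elim (¬ab (flip′ (Sq.ab s)))
      go 1F 1F refl refl = ⊥-elim (~-irr G ab)
      go 1F 2F refl refl = ⊥-elim (¬ab (Sq.bc s))
      go 1F 3F refl refl = _ , _ , rot S
      go 2F 0F refl refl = _ , _ , rot (rot S)
      go 2F 1F refl refl = ⊥-elim (¬ab (flip′ (Sq.bc s)))
      go 2F 2F refl refl = ⊥-elim (~-irr G ab)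
      go 2F 3F refl refl = ⊥-elim (¬ab (Sq.cd s))
      go 3F 0F refl refl = ⊥-elim (¬ab (Sq.da s))
      go 3F 1F refl refl = _ , _ , rot (rot (rot S))
      go 3F 2F refl refl = ⊥-elim (¬ab (flip′ (Sq.cd s)))
      go 3F 3F refl refl = ⊥-elim (~-irr G ab)

  -- The deleted edge pays for a deficit of 1. Only a C₄ has a larger one; then `ab` joins opposite
  -- corners, as the sides are already present, and `G` is K₄⁻.
  nonbridge : ∀ {a b} → Adj G a b → ¬ InSq G a b → Star (Adj (del G a b)) a b → Result (del G a b) → Result G
  nonbridge {a} {b} ab ¬i path res = go res
    where
    lift : Weak (del G a b) → Strict G
    lift (D , i , bd) = D , (λ s → Any.map (near-map (del G a b) G (∩-⊆ G _)) (i (sq-del G ¬i s))) ,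
      ≤-trans bd (size-del< G ab)
    go : Result (del G a b) → Result G
    go (isStrict (D , i , bd)) = isStrict (lift (D , i , m≤n⇒m≤1+n bd))
    go (isExt e) = isStrict (lift (ext-weak e))
    go (isC4 c) with C4G.covers c (proj₂ (star-touched (del G a b) (~⇒≢ G ab) path))
                   | C4G.covers c (proj₂ (star-touched (del G a b) (~⇒≢ G ab ∘ sym) (reverse (~-sym (del G a b)) path)))
    ... | i , e | j , e′ with opposite (λ p → proj₂ (∩⁻ G (not-rel (edge a b)) p) (inj₁ (refl , refl))) ab c i j e e′
    ...   | _ , _ , s = isExt (isK4m (k4mg s ab (≤-antisym
              (≤-trans (size-del≥ G a b) (s≤s (≤-reflexive (C4G.size≡ c))))
              (≤-trans (s≤s (≤-reflexive (sym (C4G.size≡ c)))) (size-del< G ab)))))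

  record Bridge (a b : Fin n) (A B : VSet n) : Set where
    field
      ab    : Adj G a b
      ¬inSq : ¬ InSq G a b
      cov   : ∀ x → x ∈ᵇ A ⊎ x ∈ᵇ B
      disj  : ∀ {x} → x ∈ᵇ A → x ∉ᵇ B
      a∈    : a ∈ᵇ A
      b∈    : b ∈ᵇ B
      cross : ∀ {x y} → x ∈ᵇ A → y ∈ᵇ B → Adj G x y → x ≡ a × y ≡ b
      connA : ∀ {x y} → Adj (G [ A ]) x y → Star (Adj (G [ A ])) a x
      connB : ∀ {x y} → Adj (G [ B ]) x y → Star (Adj (G [ B ])) b x

  bridge-swap : ∀ {a b A B} → Bridge a b A B → Bridge b a B A
  bridge-swap br = record
    { ab = ~-sym G ab ; ¬inSq = ¬inSq ∘ inSq-sym G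
    ; cov = λ x → [ inj₂ , inj₁ ]′ (cov x) ; disj = λ p q → disj q p ; a∈ = b∈ ; b∈ = a∈
    ; cross = λ p q e → let u , w = cross q p (~-sym G e) in w , u
    ; connA = connB ; connB = connA }
    where open Bridge br

  c4-at : ∀ {H : Graph (Fin n)} {b z} → (c : C4G H) → Adj H b z → Σ[ c′ ∈ C4G H ] b ≡ C4G.q₀ c′
  c4-at c bz with C4G.covers c bz
  ... | 0F , e = c , e
  ... | 1F , e = c4g (rot (C4G.square c)) (C4G.size≡ c) , e
  ... | 2F , e = c4g (rot (rot (C4G.square c))) (C4G.size≡ c) , e
  ... | 3F , e = c4g (rot (rot (rot (C4G.square c)))) (C4G.size≡ c) , e

  private
    c4-edge-adj : ∀ i j → EdgeOf c4-edges i j → b5 (fs i) (fs j) ≡ true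
    c4-edge-adj = toWitness {a? = all? λ i → all? λ j → edgeOf? c4-edges i j →-dec (b5 (fs i) (fs j) Bool.≟ true)} tt

  module _ {a b A B} (br : Bridge a b A B) where
    open Bridge br

    private
      H₁ = G [ A ]
      H₂ = G [ B ]

      go₁ : ∀ {x y} → Adj (del G a b) x y → x ∈ᵇ A → y ∈ᵇ A
      go₁ {x} {y} e p with cov y
      ... | inj₁ q = q
      ... | inj₂ q with ∩⁻ G (not-rel (edge a b)) e
      ...   | e′ , ¬s = ⊥-elim (¬s (inj₁ (cross p q e′)))

      go₂ : ∀ {x y} → Adj (del G a b) x y → x ∈ᵇ B → y ∈ᵇ B
      go₂ {x} {y} e p with cov y
      ... | inj₂ q = q
      ... | inj₁ q with ∩⁻ G (not-rel (edge a b)) e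
      ...   | e′ , ¬s = let u , w = cross q p (~-sym G e′) in ⊥-elim (¬s (inj₂ (w , u)))

    -- The only edge between the sides lies in no square.
    sides : ∀ {p q r s} → Sq G p q r s → Sq H₁ p q r s ⊎ Sq H₂ p q r s
    sides {p} s with cov p | sq-del G ¬inSq s
    ... | inj₁ p∈ | sq ab bc cd _ _ _ = let q∈ = go₁ ab p∈ ; r∈ = go₁ bc q∈ ; s∈ = go₁ cd r∈ in
          inj₁ (sq-ind s (p∈ ∷ q∈ ∷ r∈ ∷ s∈ ∷ []))
    ... | inj₂ p∈ | sq ab bc cd _ _ _ = let q∈ = go₂ ab p∈ ; r∈ = go₂ bc q∈ ; s∈ = go₂ cd r∈ in
          inj₂ (sq-ind s (p∈ ∷ q∈ ∷ r∈ ∷ s∈ ∷ []))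

    sides-size : suc (size H₁ + size H₂) ≤ size G
    sides-size = ≤-trans (s≤s (size-super H₁ H₂ (del G a b) s₁ s₂
        λ e f → disj (proj₁ (proj₂ (ind⁻ G A e))) (proj₁ (proj₂ (ind⁻ G B f))))) (size-del< G ab)
      where
      s₁ : H₁ ⊆ᴳ del G a b
      s₁ e with ind⁻ G A e
      ... | e′ , p , q = ∩⁺ G (not-rel (edge a b)) e′
            λ { (inj₁ (refl , refl)) → disj q b∈ ; (inj₂ (refl , refl)) → disj p b∈ }
      s₂ : H₂ ⊆ᴳ del G a b
      s₂ e with ind⁻ G B e
      ... | e′ , p , q = ∩⁺ G (not-rel (edge a b)) e′
            λ { (inj₁ (refl , refl)) → disj a∈ p ; (inj₂ (refl , refl)) → disj a∈ q }

    near-A : ∀ {D x} → Near H₁ D x → Near G D x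
    near-A = near-map H₁ G (∩-⊆ G _)

    near-B : ∀ {D x} → Near H₂ D x → Near G D x
    near-B = near-map H₂ G (∩-⊆ G _)

    glue : ∀ {m₁ m₂} → Bounded m₁ H₁ → Bounded m₂ H₂ → m₁ + m₂ ≤ size G → Strict G
    glue (D₁ , i₁ , b₁) (D₂ , i₂ , b₂) le = D₁ ++ D₂ , iso , (begin
        6 * length (D₁ ++ D₂)         ≡⟨ cong (6 *_) (length-++ D₁) ⟩
        6 * (length D₁ + length D₂)   ≡⟨ *-distribˡ-+ 6 (length D₁) (length D₂) ⟩
        6 * length D₁ + 6 * length D₂ ≤⟨ +-mono-≤ b₁ b₂ ⟩
        _                             ≤⟨ le ⟩
        size G                        ∎)
      where
      open ≤-Reasoning
      iso : Isol G (D₁ ++ D₂)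
      iso s with sides s
      ... | inj₁ t = Any.map (λ p → ++⁺ˡ (near-A p)) (i₁ t)
      ... | inj₂ t = Any.map (λ p → ++⁺ʳ D₁ (near-B p)) (i₂ t)

    spare-spare : Spare H₁ a → Spare H₂ b → Strict G
    spare-spare (D₁ , i₁ , b₁) (D₂ , i₂ , b₂) = a ∷ D₁ ++ D₂ , iso , bd
      where
      iso : Isol G (a ∷ D₁ ++ D₂)
      iso s with sides s
      ... | inj₁ t = Any.map (λ { (inj₁ refl) → here (inj₁ refl) ; (inj₂ p) → there (++⁺ˡ (near-A p)) }) (i₁ t)
      ... | inj₂ t = Any.map (λ { (inj₁ refl) → here (inj₂ ab) ; (inj₂ p) → there (++⁺ʳ D₁ (near-B p)) }) (i₂ t)
      shuffle : ∀ x y → 6 * suc (x + y) + 2 ≡ (6 * x + 4) + (6 * y + 4)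
      shuffle = solve-∀
      bd : 6 * length (a ∷ D₁ ++ D₂) ≤ size G
      bd = begin
        6 * length (a ∷ D₁ ++ D₂)           ≡⟨ cong (λ l → 6 * suc l) (length-++ D₁) ⟩
        6 * suc (length D₁ + length D₂)     ≤⟨ m≤m+n _ 2 ⟩
        6 * suc (length D₁ + length D₂) + 2 ≡⟨ shuffle (length D₁) (length D₂) ⟩
        (6 * length D₁ + 4) + (6 * length D₂ + 4) ≤⟨ +-mono-≤ b₁ b₂ ⟩
        size H₁ + size H₂                   ≤⟨ <⇒≤ sides-size ⟩
        size G                              ∎
        where open ≤-Reasoning

    -- The tree vertex `a` is in the isolating list anyway and dominates `b`, so no vertex is added.
    -- The bridge edge pays for the deficit 1 of the cons(T, C₄) side.
    rooted-spare : Rooted H₁ a → Spare H₂ b → Strict G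
    rooted-spare (rooted c i refl) (D₂ , i₂ , b₂) = tops Bl ++ D₂ , iso , bd
      where
      Bl = ConsG.blocks c
      iso : Isol G (tops Bl ++ D₂)
      iso s with sides s
      ... | inj₁ t = Any.map (λ p → ++⁺ˡ (near-A p)) (blocks-isol Bl t)
      ... | inj₂ t = Any.map (λ { (inj₁ refl) → ++⁺ˡ (tabulate⁺ i (inj₂ ab)) ; (inj₂ p) → ++⁺ʳ (tops Bl) (near-B p) }) (i₂ t)
      bd : 6 * length (tops Bl ++ D₂) ≤ size G
      bd = begin
        6 * length (tops Bl ++ D₂)   ≡⟨ cong (6 *_) (length-++ (tops Bl)) ⟩
        6 * (length (tops Bl) + length D₂) ≡⟨ *-distribˡ-+ 6 (length (tops Bl)) (length D₂) ⟩
        6 * length (tops Bl) + 6 * length D₂ ≡⟨ cong (λ l → 6 * l + 6 * length D₂) (length-tabulate (λ i → ConsG.bs c i fz)) ⟩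
        6 * ConsG.t c + 6 * length D₂ ≤⟨ +-mono-≤ (ConsG.bound c) (≤-trans (m≤m+n _ 4) b₂) ⟩
        suc (size H₁ + size H₂)     ≤⟨ sides-size ⟩
        size G                      ∎
        where open ≤-Reasoning

    -- The bridge becomes an edge of the new T. Both sides have deficit 1 and the bridge edge
    -- cancels one of them, so deficit 1 remains.
    join-cons : Rooted H₁ a → Rooted H₂ b → ConsG G
    join-cons (rooted (consg {t₁} bs₁ B₁ base₁ bd₁) i₁ refl) (rooted (consg {t₂} bs₂ B₂ _ bd₂) i₂ refl) =
      consg bs (record { inj = inj ; local = local ; class = class }) (base₁ ↑ˡ t₂) bd
      where
      pick : Fin t₁ ⊎ Fin t₂ → Fin 5 → Fin n
      pick = [ bs₁ , bs₂ ]′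
      bs : Fin (t₁ + t₂) → Fin 5 → Fin n
      bs i = pick (splitAt t₁ i)
      bsL : ∀ i j → bs₁ i j ≡ bs (i ↑ˡ t₂) j
      bsL i j = cong (λ s → pick s j) (sym (splitAt-↑ˡ t₁ i t₂))
      bsR : ∀ i j → bs₂ i j ≡ bs (t₁ ↑ʳ i) j
      bsR i j = cong (λ s → pick s j) (sym (splitAt-↑ʳ t₁ t₂ i))
      in₁ : ∀ i j → bs₁ i j ∈ᵇ A
      in₁ i j = let j′ , e = b5-nbr j in proj₁ (proj₂ (ind⁻ G A (Blocks.local B₁ i j j′ e)))
      in₂ : ∀ i j → bs₂ i j ∈ᵇ B
      in₂ i j = let j′ , e = b5-nbr j in proj₁ (proj₂ (ind⁻ G B (Blocks.local B₂ i j j′ e)))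
      inj : ∀ {i j i′ j′} → bs i j ≡ bs i′ j′ → i ≡ i′ × j ≡ j′
      inj {i} {j} {i′} {j′} e with splitAt t₁ i in p | splitAt t₁ i′ in p′
      ... | inj₁ k | inj₁ k′ with Blocks.inj B₁ e
      ...   | refl , q = trans (sym (splitAt⁻¹-↑ˡ p)) (splitAt⁻¹-↑ˡ p′) , q
      inj {i} {j} {i′} {j′} e | inj₂ k | inj₂ k′ with Blocks.inj B₂ e
      ...   | refl , q = trans (sym (splitAt⁻¹-↑ʳ p)) (splitAt⁻¹-↑ʳ p′) , q
      inj {i} {j} {i′} {j′} e | inj₁ k | inj₂ k′ = ⊥-elim (disj (in₁ k j) (subst (_∈ᵇ B) (sym e) (in₂ k′ j′)))
      inj {i} {j} {i′} {j′} e | inj₂ k | inj₁ k′ = ⊥-elim (disj (in₁ k′ j′) (subst (_∈ᵇ B) e (in₂ k j)))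
      local : ∀ i j j′ → b5 j j′ ≡ true → Adj G (bs i j) (bs i j′)
      local i j j′ e with splitAt t₁ i
      ... | inj₁ k = ∩-⊆ G _ (Blocks.local B₁ k j j′ e)
      ... | inj₂ k = ∩-⊆ G _ (Blocks.local B₂ k j j′ e)
      cl₁ : ∀ {x y} → Local H₁ bs₁ x y ⊎ Top H₁ bs₁ x y → Local G bs x y ⊎ Top G bs x y
      cl₁ (inj₁ (i , j , j′ , p , q , e)) = inj₁ (i ↑ˡ t₂ , j , j′ , trans p (bsL i j) , trans q (bsL i j′) , e)
      cl₁ (inj₂ (i , i′ , p , q)) = inj₂ (i ↑ˡ t₂ , i′ ↑ˡ t₂ , trans p (bsL i fz) , trans q (bsL i′ fz))
      cl₂ : ∀ {x y} → Local H₂ bs₂ x y ⊎ Top H₂ bs₂ x y → Local G bs x y ⊎ Top G bs x y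
      cl₂ (inj₁ (i , j , j′ , p , q , e)) = inj₁ (t₁ ↑ʳ i , j , j′ , trans p (bsR i j) , trans q (bsR i j′) , e)
      cl₂ (inj₂ (i , i′ , p , q)) = inj₂ (t₁ ↑ʳ i , t₁ ↑ʳ i′ , trans p (bsR i fz) , trans q (bsR i′ fz))
      class : ∀ {x y} → Adj G x y → Local G bs x y ⊎ Top G bs x y
      class {x} {y} e with cov x | cov y
      ... | inj₁ p | inj₁ q = cl₁ (Blocks.class B₁ (ind⁺ G A e p q))
      ... | inj₂ p | inj₂ q = cl₂ (Blocks.class B₂ (ind⁺ G B e p q))
      ... | inj₁ p | inj₂ q = let u , w = cross p q e in
            inj₂ (i₁ ↑ˡ t₂ , t₁ ↑ʳ i₂ , trans u (bsL i₁ fz) , trans w (bsR i₂ fz))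
      ... | inj₂ p | inj₁ q = let u , w = cross q p (~-sym G e) in
            inj₂ (t₁ ↑ʳ i₂ , i₁ ↑ˡ t₂ , trans w (bsR i₂ fz) , trans u (bsL i₁ fz))
      bd : 6 * (t₁ + t₂) ≤ suc (size G)
      bd = begin
        6 * (t₁ + t₂)                     ≡⟨ *-distribˡ-+ 6 t₁ t₂ ⟩
        6 * t₁ + 6 * t₂                   ≤⟨ +-mono-≤ bd₁ bd₂ ⟩
        suc (size H₁) + suc (size H₂)     ≡⟨ cong suc (+-suc (size H₁) (size H₂)) ⟩
        suc (suc (size H₁ + size H₂))     ≤⟨ s≤s sides-size ⟩
        suc (size G)                      ∎
        where open ≤-Reasoning

    -- If `a` has an edge on its own side, the C₄ is pendant at `a`. Otherwise that side has no
    -- edges, being connected from `a`, and `G` is a single block with tree vertex `a`.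
    strict-c4 : C4G H₂ → Result G ⊎ Pend G a b
    strict-c4 c₀ with root-touched H₂ connB (Sq.ab (C4G.square c₀))
    ... | _ , bz with c4-at c₀ bz
    ...   | c@(c4g {q₀} {q₁} {q₂} {q₃} s m4) , refl with any? (λ z → adj? H₁ a z)
    ...     | yes (z , az) = inj₂ record
              { square = sq-map H₂ G (∩-⊆ G _) s ; xy = ab ; closed = closed ; chordless = chordless
              ; x∉ = λ p → disj a∈ (inB p) ; ¬inSq = ¬inSq ; z = z ; xz = ∩-⊆ G _ az
              ; z≢y = λ { refl → disj (proj₂ (proj₂ (ind⁻ G A az))) b∈ } }
      where
      inB : ∀ {x} → x ∈ quad q₀ q₁ q₂ q₃ → x ∈ᵇ B
      inB (here refl) = b∈
      inB (there (here refl)) = proj₁ (proj₂ (ind⁻ G B (Sq.bc s)))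
      inB (there (there (here refl))) = proj₁ (proj₂ (ind⁻ G B (Sq.cd s)))
      inB (there (there (there (here refl)))) = proj₁ (proj₂ (ind⁻ G B (Sq.da s)))
      listed : ∀ i → C4G.vert c i ∈ quad q₀ q₁ q₂ q₃
      listed 0F = here refl
      listed 1F = there (here refl)
      listed 2F = there (there (here refl))
      listed 3F = there (there (there (here refl)))
      closed : ∀ {z w} → z ∈ quad q₀ q₁ q₂ q₃ → Adj G z w → w ∈ quad q₀ q₁ q₂ q₃ ⊎ (z ≡ q₀ × w ≡ a)
      closed {z} {w} p e with cov w
      ... | inj₁ w∈ = let u , v = cross w∈ (inB p) (~-sym G e) in inj₂ (v , u)
      ... | inj₂ w∈ with C4G.covers c (~-sym H₂ (ind⁺ G B e (inB p) w∈))
      ...   | i , refl = inj₁ (listed i)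
      chordless : ¬ Adj G q₀ q₂
      chordless e with C4G.class c (ind⁺ G B e b∈ (inB (there (there (here refl)))))
      ... | i , j , p , q , m with vec-inj (sq-unique H₂ s) {0F} {i} p | vec-inj (sq-unique H₂ s) {2F} {j} q
      ...   | refl | refl = no-diag m
        where
        no-diag : ¬ EdgeOf c4-edges 0F 2F
        no-diag = toWitness {a? = ¬? (edgeOf? c4-edges 0F 2F)} tt
    ...     | no ¬z = inj₁ (isExt (isCons (consg bs (record { inj = inj ; local = local ; class = class }) fz bd)))
      where
      bs : Fin 1 → Fin 5 → Fin n
      bs _ = Vec.lookup (a ∷ q₀ ∷ q₁ ∷ q₂ ∷ q₃ ∷ [])
      a≢ : ∀ {x y} → Adj H₂ x y → a ≢ x
      a≢ e refl = disj a∈ (proj₁ (proj₂ (ind⁻ G B e)))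
      inj : ∀ {i j i′ j′} → bs i j ≡ bs i′ j′ → i ≡ i′ × j ≡ j′
      inj {fz} {_} {fz} e = refl , vec-inj ((a≢ (Sq.ab s) VA.∷ a≢ (Sq.bc s) VA.∷ a≢ (Sq.cd s) VA.∷ a≢ (Sq.da s) VA.∷ VA.[])
        VP.∷ sq-unique H₂ s) e
      up : H₂ ⊆ᴳ G
      up = ∩-⊆ G _
      local : ∀ i j j′ → b5 j j′ ≡ true → Adj G (bs i j) (bs i j′)
      local _ 0F 1F _ = ab
      local _ 1F 0F _ = ~-sym G ab
      local _ 1F 2F _ = up (Sq.ab s)
      local _ 2F 3F _ = up (Sq.bc s)
      local _ 3F 4F _ = up (Sq.cd s)
      local _ 4F 1F _ = up (Sq.da s)
      local _ 2F 1F _ = ~-sym G (up (Sq.ab s))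
      local _ 3F 2F _ = ~-sym G (up (Sq.bc s))
      local _ 4F 3F _ = ~-sym G (up (Sq.cd s))
      local _ 1F 4F _ = ~-sym G (up (Sq.da s))
      local _ 2F 4F ()
      local _ 4F 4F ()
      class : ∀ {x y} → Adj G x y → Local G bs x y ⊎ Top G bs x y
      class {x} {y} e with cov x | cov y
      ... | inj₁ p | inj₁ q = ⊥-elim (¬z (root-touched H₁ connA (ind⁺ G A e p q)))
      ... | inj₁ p | inj₂ q = let u , w = cross p q e in inj₁ (fz , 0F , 1F , u , w , refl)
      ... | inj₂ p | inj₁ q = let u , w = cross q p (~-sym G e) in inj₁ (fz , 1F , 0F , w , u , refl)
      ... | inj₂ p | inj₂ q = let i , j , u , w , m = C4G.class c (ind⁺ G B e p q) in
            inj₁ (fz , fs i , fs j , u , w , c4-edge-adj i j m)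
      bd : 6 * 1 ≤ suc (size G)
      bd = s≤s (≤-trans (s≤s (≤-trans (≤-reflexive (sym m4)) (m≤n+m _ (size H₁)))) sides-size)

  private
    spareOrRooted : ∀ {S a} → (∀ {x y} → Adj (G [ S ]) x y → Star (Adj (G [ S ])) a x) →
      Ext (G [ S ]) ⊎ C4G (G [ S ]) → Spare (G [ S ]) a ⊎ Rooted (G [ S ]) a
    spareOrRooted {S} c (inj₁ e) = ext-spare e (proj₂ (root-touched (G [ S ]) c (proj₂ (proj₂ (ext-edge e)))))
    spareOrRooted {S} c (inj₂ k) = inj₁ (c4-spare k (proj₂ (root-touched (G [ S ]) c (Sq.ab (C4G.square k)))))

  bridge : ∀ {a b A B} → Bridge a b A B → Result (G [ A ]) → Result (G [ B ]) → EdgeInfo G a b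
  bridge br r₁ r₂ = go r₁ r₂
    where
    open Bridge br
    le = sides-size br
    fin : _ → _ → EdgeInfo G _ _
    fin (inj₁ p) (inj₁ q) = inj₁ (isStrict (spare-spare br p q))
    fin (inj₂ p) (inj₁ q) = inj₁ (isStrict (rooted-spare br p q))
    fin (inj₁ p) (inj₂ q) = inj₁ (isStrict (rooted-spare (bridge-swap br) q p))
    fin (inj₂ p) (inj₂ q) = inj₁ (isExt (isCons (join-cons br p q)))
    go : _ → _ → EdgeInfo G _ _
    go (isStrict p) (isStrict q) = inj₁ (isStrict (glue br p q (<⇒≤ le)))
    go (isStrict p) (isExt q) = inj₁ (isStrict (glue br p (ext-weak q) (≤-trans (≤-reflexive (+-suc _ _)) le)))
    go (isExt p) (isStrict q) = inj₁ (isStrict (glue br (ext-weak p) q le))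
    go (isStrict p) (isC4 c) with strict-c4 br c
    ... | inj₁ r = inj₁ r
    ... | inj₂ r = inj₂ (inj₂ (inj₁ r))
    go (isC4 c) (isStrict p) with strict-c4 (bridge-swap br) c
    ... | inj₁ r = inj₁ r
    ... | inj₂ r = inj₂ (inj₂ (inj₂ r))
    go (isExt p) (isExt q) = fin (spareOrRooted connA (inj₁ p)) (spareOrRooted connB (inj₁ q))
    go (isExt p) (isC4 q) = fin (spareOrRooted connA (inj₁ p)) (spareOrRooted connB (inj₂ q))
    go (isC4 p) (isExt q) = fin (spareOrRooted connA (inj₂ p)) (spareOrRooted connB (inj₁ q))
    go (isC4 p) (isC4 q) = fin (spareOrRooted connA (inj₂ p)) (spareOrRooted connB (inj₂ q))

  module _ (conn : Conn G) (IH : ∀ (H : Graph (Fin n)) → size H < size G → Conn H → Result H) where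

    edge-info : ∀ {a b} → Adj G a b → EdgeInfo G a b
    edge-info {a} {b} ab with inSq? G a b
    ... | yes i = inj₂ (inj₁ i)
    ... | no ¬i with component (del G a b) (λ _ → true) a refl
    ...   | A , ic with b ∈ᵇ? A
    ...     | yes b∈ = inj₁ (nonbridge ab ¬i path (IH (del G a b) (size-del< G ab) (del-conn G conn path)))
      where
      path : Star (Adj (del G a b)) a b
      path = Star.map (∩-⊆ (del G a b) _) (IsComp.paths ic b∈)
    ...     | no b∉ = bridge br (IH (G [ A ]) (≤-trans (s≤s (m≤m+n _ _)) (sides-size br)) (a , Bridge.connA br))
                               (IH (G [ ∁ A ]) (≤-trans (s≤s (m≤n+m _ _)) (sides-size br)) (b , Bridge.connB br))
      where
      cov : ∀ x → x ∈ᵇ A ⊎ x ∈ᵇ ∁ A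
      cov x with x ∈ᵇ? A
      ... | yes p = inj₁ p
      ... | no p = inj₂ (∁⁺ A p)
      cross : ∀ {x y} → x ∈ᵇ A → y ∈ᵇ ∁ A → Adj G x y → x ≡ a × y ≡ b
      cross {x} {y} p q e with sameEdge? (a , b) (x , y)
      ... | yes (inj₁ s) = s
      ... | yes (inj₂ (refl , refl)) = ⊥-elim (b∉ p)
      ... | no ¬s = ⊥-elim (∁⁻ A q (IsComp.closed ic p (∩⁺ G (not-rel (edge a b)) e ¬s) refl))
      -- A path to `a` can leave the complement of `A` only along `ba`, so it reaches `b` before
      -- that.
      toB : ∀ {x} → x ∈ᵇ ∁ A → Star (Adj G) x a → Star (Adj (G [ ∁ A ])) x b
      toB p ε = ⊥-elim (∁⁻ A p (IsComp.root∈ ic))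
      toB p (_◅_ {j = y} e s) with cov y
      ... | inj₂ q = ind⁺ G (∁ A) e p q ◅ toB q s
      ... | inj₁ q with cross q p (~-sym G e)
      ...   | refl , refl = ε
      br : Bridge a b A (∁ A)
      br = record
        { ab = ab ; ¬inSq = ¬i ; cov = cov ; disj = λ p q → ∁⁻ A q p ; a∈ = IsComp.root∈ ic ; b∈ = ∁⁺ A b∉
        ; cross = cross
        ; connA = λ e → Star.map (λ f → let f′ , u , w = ind⁻ (del G a b) A f in ind⁺ G A (∩-⊆ G _ f′) u w)
            (IsComp.paths ic (proj₁ (proj₂ (ind⁻ G A e))))
        ; connB = λ e → let e′ , p , _ = ind⁻ G (∁ A) e in
            reverse (~-sym (G [ ∁ A ])) (toB p (conn-path G conn e′ ab)) }

-- Boundary edges and the surplus of a component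

bd : ∀ {n} → VSet n → SymRel n
bd C = symRel (λ x y → (x ∈ᵇ C × y ∉ᵇ C) ⊎ (y ∈ᵇ C × x ∉ᵇ C))
  (λ x y → ((x ∈ᵇ? C) ×-dec ¬? (y ∈ᵇ? C)) ⊎-dec ((y ∈ᵇ? C) ×-dec ¬? (x ∈ᵇ? C)))
  (λ { (inj₁ p) → inj₂ p ; (inj₂ p) → inj₁ p })

∂ : ∀ {n} → Graph (Fin n) → VSet n → Graph (Fin n)
∂ G C = G ∩ bd C

size-2 : ∀ {n} (H : Graph (Fin n)) {x y z w} → Adj H x y → Adj H z w → ¬ SameEdge (x , y) (z , w) → 2 ≤ size H
size-2 H {x} {y} p q ¬s = ≤-trans (s≤s (size-nonempty (del H x y) (∩⁺ H (not-rel (edge x y)) q ¬s))) (size-del< H p)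

size-3 : ∀ {n} (H : Graph (Fin n)) {x y z w s t} → Adj H x y → Adj H z w → Adj H s t →
  ¬ SameEdge (x , y) (z , w) → ¬ SameEdge (x , y) (s , t) → ¬ SameEdge (z , w) (s , t) → 3 ≤ size H
size-3 H {x} {y} p q r ¬1 ¬2 ¬3 = ≤-trans (s≤s (size-2 (del H x y) (∩⁺ H (not-rel (edge x y)) q ¬1)
  (∩⁺ H (not-rel (edge x y)) r ¬2) ¬3)) (size-del< H p)

τ-mono : ∀ {n} (G : Graph (Fin n)) {S S′ : VSet n} → (∀ {x} → x ∈ᵇ S → x ∈ᵇ S′) → τ G S ≤ τ G S′
τ-mono G {S} {S′} i = size-mono (G ∩ touch S) (G ∩ touch S′) λ e → let e′ , t = ∩⁻ G (touch S) e in
  ∩⁺ G (touch S′) e′ ([ (λ p → inj₁ (i p)) , (λ p → inj₂ (i p)) ]′ t)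

module _ {n : ℕ} (G : Graph (Fin n)) where

  τ-split : ∀ C → size (G [ C ]) + size (∂ G C) ≤ τ G C
  τ-split C = size-super (G [ C ]) (∂ G C) (G ∩ touch C)
    (λ e → let e′ , p , _ = ind⁻ G C e in ∩⁺ G (touch C) e′ (inj₁ p))
    (λ e → let e′ , t = ∩⁻ G (bd C) e in ∩⁺ G (touch C) e′ ([ (λ p → inj₁ (proj₁ p)) , (λ p → inj₂ (proj₁ p)) ]′ t))
    disj
    where
    disj : ∀ {x y} → Adj (G [ C ]) x y → Adj (∂ G C) x y → ⊥
    disj e f with ind⁻ G C e | ∩⁻ G (bd C) f
    ... | _ , _ , q | _ , inj₁ (_ , ¬q) = ¬q q
    ... | _ , p , _ | _ , inj₂ (_ , ¬p) = ¬p p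

  record Link (C : VSet n) : Set where
    constructor link
    field
      {x y} : Fin n
      x∈    : x ∈ᵇ C
      y∉    : y ∉ᵇ C
      xy    : Adj G x y

  ∂⁺ : ∀ {C x y} → x ∈ᵇ C → y ∉ᵇ C → Adj G x y → Adj (∂ G C) x y
  ∂⁺ {C} p q e = ∩⁺ G (bd C) e (inj₁ (p , q))

  link-1 : ∀ {C} → Link C → 1 ≤ size (∂ G C)
  link-1 {C} (link p q e) = size-nonempty (∂ G C) (∂⁺ p q e)

  -- A cycle crosses a cut at least twice, so the square through the linking edge supplies a second
  -- boundary edge; which one depends on the side of its other two corners.
  link-2 : ∀ {C} (l : Link C) → InSq G (Link.x l) (Link.y l) → 2 ≤ size (∂ G C)
  link-2 {C} (link {x} {y} x∈ y∉ xy) (z , w , s) with w ∈ᵇ? C | z ∈ᵇ? C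
  ... | no w∉ | _ = size-2 (∂ G C) (∂⁺ x∈ y∉ xy) (∂⁺ x∈ w∉ (~-sym G (Sq.da s)))
        λ { (inj₁ (_ , e)) → Sq.b≢d s (sym e) ; (inj₂ (refl , _)) → ~-irr G xy }
  ... | yes w∈ | yes z∈ = size-2 (∂ G C) (∂⁺ x∈ y∉ xy) (∂⁺ z∈ y∉ (~-sym G (Sq.bc s)))
        λ { (inj₁ (e , _)) → Sq.a≢c s (sym e) ; (inj₂ (refl , _)) → y∉ z∈ }
  ... | yes w∈ | no z∉ = size-2 (∂ G C) (∂⁺ x∈ y∉ xy) (∂⁺ w∈ z∉ (~-sym G (Sq.cd s)))
        λ { (inj₁ (refl , _)) → ~-irr G (Sq.da s) ; (inj₂ (refl , _)) → y∉ w∈ }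

  comp-link : Conn G → ∀ {U u C x x′ y y′} → IsComp G U u C → x ∈ᵇ C → Adj G x x′ → y ∉ᵇ U → Adj G y y′ → Link C
  comp-link conn {C = C} ic x∈ xx′ y∉ yy′ =
    let _ , _ , p , q , e = exit G C x∈ (λ y∈ → y∉ (IsComp.sub ic y∈)) (conn-path G conn xx′ yy′) in link p q e

  comp-path : ∀ {U u C x y} → IsComp G U u C → x ∈ᵇ C → y ∈ᵇ C → Star (Adj (G [ C ])) x y
  comp-path {C = C} ic p q = reverse (~-sym (G [ C ])) (IsComp.paths ic p) ◅◅ IsComp.paths ic q

  comp-touched : ∀ {U u C x y z} → IsComp G U u C → Adj (G [ C ]) y z → x ∈ᵇ C → ∃[ w ] Adj (G [ C ]) x w
  comp-touched {C = C} ic yz x∈ = root-touched (G [ C ]) (λ e → comp-path ic x∈ (proj₁ (proj₂ (ind⁻ G C e)))) yz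

  module _ (v : Fin n) where

    chg-strict : ∀ {C k} → Strict (G [ C ]) → k ≤ size (∂ G C) → Chg G v C k
    chg-strict {C} (D , i , b) le = chg-isol G v i (≤-trans (+-mono-≤ b le) (τ-split C))

    -- One of the `suc k` boundary edges covers the deficit 1.
    chg-ext : ∀ {C k} → Ext (G [ C ]) → suc k ≤ size (∂ G C) → Chg G v C k
    chg-ext {C} {k} e le with ext-weak e
    ... | D , i , b = chg-isol G v i (≤-trans (s≤s⁻¹ (≤-trans (≤-reflexive (sym (+-suc _ k))) (+-mono-≤ b le))) (τ-split C))

    chg-c4 : ∀ {C k} → C4G (G [ C ]) → 6 + k ≤ τ G C → Chg G v C k
    chg-c4 c le = chg-isol G v (c4-isol c) le

    chg-weaken : ∀ {C k} → Chg G v C k → Chg G v C 0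
    chg-weaken (chg D h b) = chg D h (≤-trans (+-monoʳ-≤ (6 * length D) z≤n) b)

quad-vec : ∀ {n} {a b c d x : Fin n} → x ∈ quad a b c d → ∃[ i ] x ≡ vec4 a b c d i
quad-vec (here e) = 0F , e
quad-vec (there (here e)) = 1F , e
quad-vec (there (there (here e))) = 2F , e
quad-vec (there (there (there (here e)))) = 3F , e

vec-quad : ∀ {n} {a b c d : Fin n} i → vec4 a b c d i ∈ quad a b c d
vec-quad 0F = here refl
vec-quad 1F = there (here refl)
vec-quad 2F = there (there (here refl))
vec-quad 3F = there (there (there (here refl)))

-- A pendant C₄ when every edge that lies in no C₄ is of this kind

module _ {n : ℕ} (G : Graph (Fin n)) (conn : Conn G)
  (IH : ∀ (H : Graph (Fin n)) → size H < size G → Conn H → Result H)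
  (info : ∀ {a b} → Adj G a b → InSq G a b ⊎ Pend G a b ⊎ Pend G b a)
  {x y : Fin n} (pe : Pend G x y) where

  open Pend pe

  private
    Q = quad y p r q

    L : VSet n
    L = ⟦ x ∷ Q ⟧

    stay : ∀ {a b c d} → Sq G a b c d → a ∈ Q → b ∈ Q
    stay s a∈ with closed a∈ (Sq.ab s)
    ... | inj₁ b∈ = b∈
    ... | inj₂ (refl , refl) = ⊥-elim (¬inSq (inSq-sym G (_ , _ , s)))

    kills : Kills G x L
    kills {a} {b} {c} {d} s a∈ with ⟦⟧⁻ (x ∷ Q) a∈
    ... | here refl = here (here (inj₁ refl))
    -- The only exit `yx` of the pendant C₄ lies in no square, so the square stays inside and passes
    -- through `y`, a neighbour of `x`.
    ... | there a∈Q = let b∈ = stay s a∈Q ; c∈ = stay (rot s) b∈ ; d∈ = stay (rot (rot s)) c∈ in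
          Any.map (λ { refl → here (inj₂ xy) }) (sq-covers (G [ ⟦ Q ⟧ ]) (vec4 y p r q)
            (λ e → quad-vec (⟦⟧⁻ Q (proj₁ (proj₂ (ind⁻ G ⟦ Q ⟧ e)))))
            (sq-ind s (⟦⟧⁺ Q a∈Q ∷ ⟦⟧⁺ Q b∈ ∷ ⟦⟧⁺ Q c∈ ∷ ⟦⟧⁺ Q d∈ ∷ [])) 0F)

    core : 5 ≤ size (G [ L ])
    core = size-embed (G [ L ]) (Vec.lookup (x ∷ y ∷ p ∷ r ∷ q ∷ []))
      (vec-inj (((λ e → x∉ (here e)) VA.∷ (λ e → x∉ (there (here e))) VA.∷ (λ e → x∉ (there (there (here e))))
        VA.∷ (λ e → x∉ (there (there (there (here e))))) VA.∷ VA.[]) VP.∷ sq-unique G square))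
      es (toWitness {a? = distinct? es} tt)
      (ind⁺ G L xy x∈ y∈ ∷ ind⁺ G L (Sq.ab square) y∈ p∈ ∷ ind⁺ G L (Sq.bc square) p∈ r∈ ∷
       ind⁺ G L (Sq.cd square) r∈ q∈ ∷ ind⁺ G L (Sq.da square) q∈ y∈ ∷ [])
      where
      es : List (Fin 5 × Fin 5)
      es = (0F , 1F) ∷ (1F , 2F) ∷ (2F , 3F) ∷ (3F , 4F) ∷ (4F , 1F) ∷ []
      x∈ = ⟦⟧⁺ (x ∷ Q) (here refl)
      y∈ = ⟦⟧⁺ (x ∷ Q) (there (here refl))
      p∈ = ⟦⟧⁺ (x ∷ Q) (there (there (here refl)))
      r∈ = ⟦⟧⁺ (x ∷ Q) (there (there (there (here refl))))
      q∈ = ⟦⟧⁺ (x ∷ Q) (there (there (there (there (here refl)))))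

    x∉C : ∀ {u C} → IsComp G (∁ L) u C → x ∉ᵇ C
    x∉C ic x∈ = ∁⁻ L (IsComp.sub ic x∈) (⟦⟧⁺ (x ∷ Q) (here refl))

    link-x : ∀ {u C} → IsComp G (∁ L) u C → (l : Link G C) → Link.y l ≡ x
    link-x ic (link {p′} {q′} p∈ q∉ e) with ⟦⟧⁻ (x ∷ Q) (∁-by L (λ q∈ → q∉ (IsComp.closed ic p∈ e q∈)))
    ... | here refl = refl
    ... | there q∈Q with closed q∈Q (~-sym G e)
    ...   | inj₁ p∈Q = ⊥-elim (∁⁻ L (IsComp.sub ic p∈) (⟦⟧⁺ (x ∷ Q) (there p∈Q)))
    ...   | inj₂ (_ , refl) = ⊥-elim (x∉C ic p∈)

    -- The linking vertex is adjacent to `x`, so `x` isolates `C` at no further cost and the linking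
    -- edge is the surplus.
    chg-killed : ∀ {u C} → IsComp G (∁ L) u C → (l : Link G C) →
      (∀ {a b c d} → Sq (G [ C ]) a b c d → Any (_≡ Link.x l) (quad a b c d)) → Chg G x C 1
    chg-killed {C = C} ic l h with link-x ic l
    ... | refl = chg [] (λ s al → Any.map (λ { refl → here (inj₂ (~-sym G (Link.xy l))) }) (h (sq-ind s al)))
          (≤-trans (link-1 G l) (≤-trans (m≤n+m _ (size (G [ C ]))) (τ-split G C)))

    -- An exceptional component needs a second boundary edge, which exists if the linking edge is in
    -- a square. If that edge leads to another C₄ pendant at `x`, then `C` lies in this C₄ and its
    -- squares pass through the linking vertex. In the reverse direction `x` would lie on a pendant
    -- C₄, which leaves no place for its neighbour `y`.
    chg-1 : ∀ {u C} → IsComp G (∁ L) u C → Link G C → Result (G [ C ]) → Chg G x C 1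
    chg-1 ic l (isStrict s) = chg-strict G x s (link-1 G l)
    chg-1 {C = C} ic l@(link {p′} p∈ _ _) (isC4 c)
      with C4G.covers c (proj₂ (comp-touched G ic (Sq.ab (C4G.square c)) p∈))
    ... | i , refl = chg-killed ic l (λ s → sq-covers (G [ C ]) (C4G.vert c) (C4G.covers c) s i)
    chg-1 {C = C} ic l (isExt e) with link-x ic l
    ... | refl with info (Link.xy l)
    ...   | inj₁ i = chg-ext G x e (link-2 G l i)
    ...   | inj₂ (inj₂ pe′) = chg-killed ic l λ s → sq-covers (G [ C ]) (vec4 _ _ _ _)
              (λ f → quad-vec (inQ (here refl) (comp-path G ic (Link.x∈ l) (proj₁ (proj₂ (ind⁻ G C f)))))) s 0F
      where
      inQ : ∀ {a b} → a ∈ quad _ (Pend.p pe′) (Pend.r pe′) (Pend.q pe′) → Star (Adj (G [ C ])) a b →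
        b ∈ quad _ (Pend.p pe′) (Pend.r pe′) (Pend.q pe′)
      inQ a∈ ε = a∈
      inQ a∈ (f ◅ s) with Pend.closed pe′ a∈ (proj₁ (ind⁻ G C f))
      ... | inj₁ b∈ = inQ b∈ s
      ... | inj₂ (_ , refl) = ⊥-elim (x∉C ic (proj₂ (proj₂ (ind⁻ G C f))))
    ...   | inj₂ (inj₁ pe′) = ⊥-elim (absurd (Pend.closed pe′ (here refl) xy))
      where
      absurd : y ∈ quad x (Pend.p pe′) (Pend.r pe′) (Pend.q pe′) ⊎ (x ≡ x × y ≡ Link.x l) → ⊥
      absurd (inj₁ (here refl)) = ~-irr G xy
      absurd (inj₁ (there (here refl))) = ¬inSq (_ , _ , Pend.square pe′)
      absurd (inj₁ (there (there (here refl)))) = Pend.chordless pe′ xy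
      absurd (inj₁ (there (there (there (here refl))))) = ¬inSq (_ , _ , mirror (Pend.square pe′))
      absurd (inj₂ (_ , refl)) = ∁⁻ L (IsComp.sub ic (Link.x∈ l)) (⟦⟧⁺ (x ∷ Q) (there (here refl)))

    x∉∁ : x ∉ᵇ ∁ L
    x∉∁ x∈ = ∁⁻ L x∈ (⟦⟧⁺ (x ∷ Q) (here refl))

    result : ∀ {u C} → IsComp G (∁ L) u C → Result (G [ C ])
    result {C = C} ic = IH (G [ C ]) (size-⊂ (G [ C ]) G (∩-⊆ G _) xy
      (λ e → x∉C ic (proj₁ (proj₂ (ind⁻ G C e))))) (comp-conn G ic)

    chg-0 : ∀ {u C} → IsComp G (∁ L) u C → Chg G x C 0
    chg-0 {C = C} ic = go (result ic)
      where
      touched : ∀ {a b} → Adj (G [ C ]) a b → Link G C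
      touched e = let e′ , a∈ , _ = ind⁻ G C e in comp-link G conn ic a∈ e′ x∉∁ xy
      go : Result (G [ C ]) → Chg G x C 0
      go (isStrict s) = chg-strict G x s z≤n
      go (isExt e) = chg-weaken G x (chg-1 ic (touched (proj₂ (proj₂ (ext-edge e)))) (isExt e))
      go (isC4 c) = chg-weaken G x (chg-1 ic (touched (Sq.ab (C4G.square c))) (isC4 c))

  pendant-strict : Strict G
  pendant-strict = go (component G (∁ L) z (∁⁺ L z∉))
    where
    z∉ : z ∉ᵇ L
    z∉ z∈ with ⟦⟧⁻ (x ∷ Q) z∈
    ... | here refl = ~-irr G xz
    ... | there z∈Q with closed z∈Q (~-sym G xz)
    ...   | inj₁ x∈Q = x∉ x∈Q
    ...   | inj₂ (e , _) = z≢y e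
    go : Σ[ C ∈ VSet n ] IsComp G (∁ L) z C → Strict G
    go (C , ic) = discharge G x kills (chg-one G x chg-0 ic (chg-1 ic l (result ic))) (+-monoˡ-≤ 1 core)
      where
      l : Link G C
      l = link (IsComp.root∈ ic) (x∉C ic) (~-sym G xz)

-- Closed balls, and chordless C₄s with two outgoing edges

module _ {n : ℕ} (G : Graph (Fin n)) where

  Nb : Fin n → Fin n → Set
  Nb v x = v ≡ x ⊎ Adj G v x

  nb? : ∀ v x → Dec (Nb v x)
  nb? v x = (v ≟ x) ⊎-dec adj? G v x

  opaque
    ball : Fin n → List (Fin n) → VSet n
    ball v xs = setOf (λ x → nb? v x ⊎-dec (x ∈? xs))

    ball⁺ˡ : ∀ {v xs x} → Nb v x → x ∈ᵇ ball v xs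
    ball⁺ˡ {v} {xs} p = set⁺ (λ x → nb? v x ⊎-dec (x ∈? xs)) (inj₁ p)

    ball⁺ʳ : ∀ {v xs x} → x ∈ xs → x ∈ᵇ ball v xs
    ball⁺ʳ {v} {xs} p = set⁺ (λ x → nb? v x ⊎-dec (x ∈? xs)) (inj₂ p)

    ball⁻ : ∀ {v xs x} → x ∈ᵇ ball v xs → Nb v x ⊎ x ∈ xs
    ball⁻ {v} {xs} = set⁻ (λ x → nb? v x ⊎-dec (x ∈? xs))

  ball-kills : ∀ v → Kills G v (ball v [])
  ball-kills v s a∈ with ball⁻ a∈
  ... | inj₁ p = here (here p)

sq-at : ∀ {n} {H : Graph (Fin n)} {a b c d x} → Sq H a b c d → x ∈ quad a b c d →
  ∃[ p ] ∃[ r ] ∃[ q ] (Sq H x p r q × (∀ {z} → z ∈ quad x p r q → z ∈ quad a b c d))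
sq-at s (here refl) = _ , _ , _ , s , id
sq-at s (there (here refl)) = _ , _ , _ , rot s , rotAny
sq-at s (there (there (here refl))) = _ , _ , _ , rot (rot s) , rotAny ∘ rotAny
sq-at s (there (there (there (here refl)))) = _ , _ , _ , rot (rot (rot s)) , rotAny ∘ rotAny ∘ rotAny

-- The combinatorial certificate that a C₄ with few outgoing edges is isolated by one vertex:
-- the C₄ has indices 0, …, 3, es lists all edges touching it, N lists indices dominated by that vertex.
Certified : ∀ {k} → List (Fin k × Fin k) → List (Fin k) → Set
Certified {k} es N = (∀ i → toℕ i < 4 ⊎ i ∈ N) ×
  (∀ i j l → toℕ i < 4 → EdgeOf es i j → EdgeOf es i l → j ≢ l →
    i ∈ N ⊎ j ∈ N ⊎ l ∈ N ⊎ (toℕ j < 4 × (∀ p → EdgeOf es j p → p ≢ i → p ∈ N)))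

certified? : ∀ {k} (es : List (Fin k × Fin k)) (N : List (Fin k)) → Dec (Certified es N)
certified? es N = (all? λ i → (suc (toℕ i) ≤? 4) ⊎-dec (i ∈? N)) ×-dec
  (all? λ i → all? λ j → all? λ l → (suc (toℕ i) ≤? 4) →-dec (edgeOf? es i j →-dec (edgeOf? es i l →-dec
    (¬? (j ≟ l) →-dec ((i ∈? N) ⊎-dec ((j ∈? N) ⊎-dec ((l ∈? N) ⊎-dec ((suc (toℕ j) ≤? 4) ×-dec
      (all? λ p → edgeOf? es j p →-dec (¬? (p ≟ i) →-dec (p ∈? N)))))))))))

module _ {n : ℕ} (G : Graph (Fin n)) (conn : Conn G)
  (IH : ∀ (H : Graph (Fin n)) → size H < size G → Conn H → Result H)
  (inSq : ∀ {a b} → Adj G a b → InSq G a b) where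

  module Core {v v′ : Fin n} {L : VSet n} (vv′ : Adj G v v′) (v∈ : v ∈ᵇ L) where
    v∉∁ : v ∉ᵇ ∁ L
    v∉∁ p = ∁⁻ L p v∈

    result : ∀ {u C} → IsComp G (∁ L) u C → Result (G [ C ])
    result {C = C} ic = IH (G [ C ]) (size-⊂ (G [ C ]) G (∩-⊆ G _) vv′
      (λ e → v∉∁ (IsComp.sub ic (proj₁ (proj₂ (ind⁻ G C e)))))) (comp-conn G ic)

    toLink : ∀ {u C a b} → IsComp G (∁ L) u C → Adj (G [ C ]) a b → Link G C
    toLink {C = C} ic e = let e′ , a∈ , _ = ind⁻ G C e in comp-link G conn ic a∈ e′ v∉∁ vv′

    -- The worst component is a C₄; its linking edge lies in a square and so comes with a second
    -- boundary edge: 4 + 2 = 6.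
    chg-0 : ∀ {u C} → IsComp G (∁ L) u C → Chg G v C 0
    chg-0 {C = C} ic = go (result ic)
      where
      go : Result (G [ C ]) → Chg G v C 0
      go (isStrict s) = chg-strict G v s z≤n
      go (isExt e) = chg-ext G v e (link-1 G (toLink ic (proj₂ (proj₂ (ext-edge e)))))
      go (isC4 c) = chg-c4 G v c (≤-trans (+-mono-≤ (≤-reflexive (sym (C4G.size≡ c))) (link-2 G l (inSq (Link.xy l)))) (τ-split G C))
        where l = toLink ic (Sq.ab (C4G.square c))

    core6 : Kills G v L → 6 ≤ size (G [ L ]) → Strict G
    core6 kills le = discharge G v kills (chg-all G v chg-0) (≤-trans le (m≤m+n _ 0))

  private
    touch-edge : ∀ xs {a b} → a ∈ xs → Adj G a b → Adj (G ∩ touch ⟦ xs ⟧) a b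
    touch-edge xs p e = ∩⁺ G (touch ⟦ xs ⟧) e (inj₁ (⟦⟧⁺ xs p))

  module _ {q₀ q₁ q₂ q₃ : Fin n} where
    private
      Q = quad q₀ q₁ q₂ q₃

      in-quad : ∀ {k} (ws : Vec (Fin n) k) (i : Fin (4 + k)) → toℕ i < 4 → Vec.lookup (q₀ ∷ q₁ ∷ q₂ ∷ q₃ ∷ ws) i ∈ Q
      in-quad ws 0F _ = here refl
      in-quad ws 1F _ = there (here refl)
      in-quad ws 2F _ = there (there (here refl))
      in-quad ws 3F _ = there (there (there (here refl)))
      in-quad ws (fs (fs (fs (fs i)))) (s≤s (s≤s (s≤s (s≤s ()))))

      quad-index : ∀ {k} (ws : Vec (Fin n) k) {x} → x ∈ Q → ∃[ i ] (toℕ i < 4 × x ≡ Vec.lookup (q₀ ∷ q₁ ∷ q₂ ∷ q₃ ∷ ws) i)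
      quad-index ws (here e) = 0F , s≤s z≤n , e
      quad-index ws (there (here e)) = 1F , s≤s (s≤s z≤n) , e
      quad-index ws (there (there (here e))) = 2F , s≤s (s≤s (s≤s z≤n)) , e
      quad-index ws (there (there (there (here e)))) = 3F , s≤s (s≤s (s≤s (s≤s z≤n))) , e

    -- Six listed edges and at most six edges touching the C₄ make `es` complete, so the squares
    -- through the C₄ can be checked on indices. All six edges lie inside `L`, the ball of `v` with
    -- the C₄ added, hence the components need no surplus.
    certificate : ∀ {k} (ws : Vec (Fin n) k) → VU.Unique (q₀ ∷ q₁ ∷ q₂ ∷ q₃ ∷ ws) →
      (es : List (Fin (4 + k) × Fin (4 + k))) → Distinct es → length es ≡ 6 →
      Embeds (G ∩ touch ⟦ Q ⟧) (Vec.lookup (q₀ ∷ q₁ ∷ q₂ ∷ q₃ ∷ ws)) es → τ G ⟦ Q ⟧ ≤ 6 →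
      ∀ {v v′} → Adj G v v′ → (N : List (Fin (4 + k))) →
      All (λ i → Nb G v (Vec.lookup (q₀ ∷ q₁ ∷ q₂ ∷ q₃ ∷ ws) i)) N → Certified es N → Strict G
    certificate {k} ws uniq es dist len emb le {v} vv′ N near (allIn , chk) =
      Core.core6 {L = L} vv′ (ball⁺ˡ G (inj₁ refl)) kills (subst (_≤ size (G [ L ])) len
        (size-embed (G [ L ]) f inj es dist (All.map (λ {(i , j)} e → ind⁺ G L (∩-⊆ G _ e) (f∈L i) (f∈L j)) emb)))
      where
      f : Fin (4 + k) → Fin n
      f = Vec.lookup (q₀ ∷ q₁ ∷ q₂ ∷ q₃ ∷ ws)
      inj : Injective _≡_ _≡_ f
      inj = vec-inj uniq
      L = ball G v Q
      f∈L : ∀ i → f i ∈ᵇ L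
      f∈L i with allIn i
      ... | inj₁ lt = ball⁺ʳ G (in-quad ws i lt)
      ... | inj₂ i∈ = ball⁺ˡ G (All.lookup near i∈)
      cls : ∀ {z w} → z ∈ Q → Adj G z w → ∃[ i ] ∃[ j ] (toℕ i < 4 × z ≡ f i × w ≡ f j × EdgeOf es i j)
      cls z∈ e with edge-index f es (size-tight (G ∩ touch ⟦ Q ⟧) f inj es dist emb
                      (subst (τ G ⟦ Q ⟧ ≤_) (sym len) le) (touch-edge Q z∈ e)) | quad-index ws z∈
      ... | i , j , p , q , m | i′ , lt , p′ = i , j , subst (λ i → toℕ i < 4) (inj {i′} {i} (trans (sym p′) p)) lt , p , q , m
      kills : Kills G v L
      kills {a} {b} {c} {d} s a∈ with ball⁻ G a∈
      ... | inj₁ p = here (here p)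
      ... | inj₂ a∈Q with cls a∈Q (Sq.ab s) | cls a∈Q (~-sym G (Sq.da s))
      ...   | i , j , lt , refl , refl , m | i′ , l , _ , p , refl , m′ with inj {i} {i′} p
      ...     | refl with chk i j l lt m m′ (λ { refl → Sq.b≢d s refl })
      ...       | inj₁ i∈ = here (here (All.lookup near i∈))
      ...       | inj₂ (inj₁ j∈) = there (here (here (All.lookup near j∈)))
      ...       | inj₂ (inj₂ (inj₁ l∈)) = there (there (there (here (here (All.lookup near l∈)))))
      -- Here `b` is again on the C₄, so its edges are listed too, and the corner `c` beyond it is
      -- dominated.
      ...       | inj₂ (inj₂ (inj₂ (lt′ , h))) with cls (in-quad ws j lt′) (Sq.bc s)
      ...         | j′ , p , _ , e , refl , m″ with inj {j} {j′} e
      ...           | refl = there (there (here (here (All.lookup near (h p m″ (λ { refl → Sq.a≢c s refl }))))))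

  private
    ∉-VA : ∀ {a b c d x : Fin n} → ¬ x ∈ quad a b c d → a ≢ x × b ≢ x × c ≢ x × d ≢ x
    ∉-VA x∉ = (λ e → x∉ (here (sym e))) , (λ e → x∉ (there (here (sym e)))) , (λ e → x∉ (there (there (here (sym e))))) ,
      λ e → x∉ (there (there (there (here (sym e)))))

    unique5 : ∀ {a b c d x} → Sq G a b c d → ¬ x ∈ quad a b c d → VU.Unique (a ∷ b ∷ c ∷ d ∷ x ∷ [])
    unique5 (sq ab bc cd da ac bd) x∉ = let p , q , r , s = ∉-VA x∉ in
      (~⇒≢ G ab VA.∷ ac VA.∷ (~⇒≢ G da ∘ sym) VA.∷ p VA.∷ VA.[]) VP.∷
      (~⇒≢ G bc VA.∷ bd VA.∷ q VA.∷ VA.[]) VP.∷ (~⇒≢ G cd VA.∷ r VA.∷ VA.[]) VP.∷ (s VA.∷ VA.[]) VP.∷ VA.[] VP.∷ VP.[]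

    unique6 : ∀ {a b c d x y} → Sq G a b c d → ¬ x ∈ quad a b c d → ¬ y ∈ quad a b c d → x ≢ y →
      VU.Unique (a ∷ b ∷ c ∷ d ∷ x ∷ y ∷ [])
    unique6 (sq ab bc cd da ac bd) x∉ y∉ x≢y = let p , q , r , s = ∉-VA x∉ ; p′ , q′ , r′ , s′ = ∉-VA y∉ in
      (~⇒≢ G ab VA.∷ ac VA.∷ (~⇒≢ G da ∘ sym) VA.∷ p VA.∷ p′ VA.∷ VA.[]) VP.∷
      (~⇒≢ G bc VA.∷ bd VA.∷ q VA.∷ q′ VA.∷ VA.[]) VP.∷ (~⇒≢ G cd VA.∷ r VA.∷ r′ VA.∷ VA.[]) VP.∷
      (s VA.∷ s′ VA.∷ VA.[]) VP.∷ (x≢y VA.∷ VA.[]) VP.∷ VA.[] VP.∷ VP.[]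

    ring : ∀ {k} → List (Fin (4 + k) × Fin (4 + k))
    ring = (0F , 1F) ∷ (1F , 2F) ∷ (2F , 3F) ∷ (3F , 0F) ∷ []

    ring-embeds : ∀ {a b c d k} {ws : Vec (Fin n) k} → Sq G a b c d → ∀ {es} →
      Embeds (G ∩ touch ⟦ quad a b c d ⟧) (Vec.lookup (a ∷ b ∷ c ∷ d ∷ ws)) es →
      Embeds (G ∩ touch ⟦ quad a b c d ⟧) (Vec.lookup (a ∷ b ∷ c ∷ d ∷ ws)) (ring {k} ++ es)
    ring-embeds {a} {b} {c} {d} s es = te (here refl) (Sq.ab s) ∷ te (there (here refl)) (Sq.bc s) ∷
      te (there (there (here refl))) (Sq.cd s) ∷ te (there (there (there (here refl)))) (Sq.da s) ∷ es
      where
      te : ∀ {x y} → x ∈ quad a b c d → Adj G x y → Adj (G ∩ touch ⟦ quad a b c d ⟧) x y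
      te = touch-edge (quad a b c d)

    -- Indices 4 and 5 are the outer ends of the outgoing edges. The dominating vertex is 0 for `N₁`
    -- and 4 for `N₂` and `N₃`; in `N₂` it dominates 5 by an edge that does not touch the C₄ and
    -- hence is not listed.
    es₁ es₂ : List (Fin 6 × Fin 6)
    es₁ = ring {2} ++ (0F , 4F) ∷ (0F , 5F) ∷ []
    es₂ = ring {2} ++ (0F , 4F) ∷ (1F , 5F) ∷ []
    es₃ : List (Fin 5 × Fin 5)
    es₃ = ring {1} ++ (0F , 4F) ∷ (2F , 4F) ∷ []
    N₁ N₂ : List (Fin 6)
    N₁ = 0F ∷ 1F ∷ 3F ∷ 4F ∷ 5F ∷ []
    N₂ = 4F ∷ 0F ∷ 5F ∷ []
    N₃ : List (Fin 5)
    N₃ = 4F ∷ 0F ∷ 2F ∷ []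

    chk₁ : Certified es₁ N₁
    chk₁ = toWitness {a? = certified? es₁ N₁} tt
    chk₂ : Certified es₂ N₂
    chk₂ = toWitness {a? = certified? es₂ N₂} tt
    chk₃ : Certified es₃ N₃
    chk₃ = toWitness {a? = certified? es₃ N₃} tt
    dist₁ : Distinct es₁
    dist₁ = toWitness {a? = distinct? es₁} tt
    dist₂ : Distinct es₂
    dist₂ = toWitness {a? = distinct? es₂} tt
    dist₃ : Distinct es₃
    dist₃ = toWitness {a? = distinct? es₃} tt

    -- As every edge lies in a C₄, these are the only ways for a chordless C₄ to have exactly two outgoing edges.
    two-at-one : ∀ {a b c d x z} → Sq G a b c d → ¬ x ∈ quad a b c d → ¬ z ∈ quad a b c d → x ≢ z →
      Adj G a x → Adj G a z → τ G ⟦ quad a b c d ⟧ ≤ 6 → Strict G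
    two-at-one {a} {b} {c} {d} s x∉ z∉ x≢z ax az le = certificate _ (unique6 s x∉ z∉ x≢z) es₁ dist₁ refl
      (ring-embeds s (touch-edge (quad a b c d) (here refl) ax ∷ touch-edge (quad a b c d) (here refl) az ∷ [])) le ax N₁
      (inj₁ refl ∷ inj₂ (Sq.ab s) ∷ inj₂ (~-sym G (Sq.da s)) ∷ inj₂ ax ∷ inj₂ az ∷ []) chk₁

    two-opposite : ∀ {a b c d x} → Sq G a b c d → ¬ x ∈ quad a b c d → Adj G a x → Adj G c x →
      τ G ⟦ quad a b c d ⟧ ≤ 6 → Strict G
    two-opposite {a} {b} {c} {d} s x∉ ax cx le = certificate _ (unique5 s x∉) es₃ dist₃ refl
      (ring-embeds s (touch-edge (quad a b c d) (here refl) ax ∷ touch-edge (quad a b c d) (there (there (here refl))) cx ∷ []))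
      le (~-sym G ax) N₃ (inj₁ refl ∷ inj₂ (~-sym G ax) ∷ inj₂ (~-sym G cx) ∷ []) chk₃

    two-adjacent : ∀ {a b c d x y} → Sq G a b c d → ¬ x ∈ quad a b c d → ¬ y ∈ quad a b c d → Adj G x y →
      Adj G a x → Adj G b y → τ G ⟦ quad a b c d ⟧ ≤ 6 → Strict G
    two-adjacent {a} {b} {c} {d} s x∉ y∉ xy ax by le = certificate _ (unique6 s x∉ y∉ (~⇒≢ G xy)) es₂ dist₂ refl
      (ring-embeds s (touch-edge (quad a b c d) (here refl) ax ∷ touch-edge (quad a b c d) (there (here refl)) by ∷ []))
      le xy N₂ (inj₁ refl ∷ inj₂ (~-sym G ax) ∷ inj₂ xy ∷ []) chk₂

    -- The square `t` uses the side `ab`. Its vertex `y` is outside, giving outgoing edges at `a`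
    -- and `b` with adjacent ends, or it is `c`, giving two edges to `x` from opposite corners; `d`
    -- would make `bd` a chord.
    side : ∀ {a b c d x y} → Sq G a b c d → ¬ Adj G b d → ¬ x ∈ quad a b c d → Sq G a x y b →
      τ G ⟦ quad a b c d ⟧ ≤ 6 → Strict G
    side {a} {b} {c} {d} {x} {y} s ¬bd x∉ t le with y ∈? quad a b c d
    ... | no y∉ = two-adjacent s x∉ y∉ (Sq.bc t) (Sq.ab t) (~-sym G (Sq.cd t)) le
    ... | yes (here refl) = ⊥-elim (Sq.a≢c t refl)
    ... | yes (there (here refl)) = ⊥-elim (~-irr G (Sq.cd t))
    ... | yes (there (there (here refl))) = two-opposite s x∉ (Sq.ab t) (~-sym G (Sq.bc t)) le
    ... | yes (there (there (there (here refl)))) = ⊥-elim (¬bd (~-sym G (Sq.cd t)))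

    mirror∈ : ∀ {a b c d x : Fin n} → x ∈ quad a d c b → x ∈ quad a b c d
    mirror∈ (here e) = here e
    mirror∈ (there (here e)) = there (there (there (here e)))
    mirror∈ (there (there (here e))) = there (there (here e))
    mirror∈ (there (there (there (here e)))) = there (here e)

    -- A square through the outgoing edge `ax` returns to `a` along another outgoing edge or along
    -- one of the two sides at `a`.
    few : ∀ {a b c d x} → Sq G a b c d → ¬ Adj G a c → ¬ Adj G b d → ¬ x ∈ quad a b c d → Adj G a x →
      τ G ⟦ quad a b c d ⟧ ≤ 6 → Strict G
    few {a} {b} {c} {d} s ¬ac ¬bd x∉ ax le with inSq ax
    ... | y , z , t with z ∈? quad a b c d
    ...   | no z∉ = two-at-one s x∉ z∉ (Sq.b≢d t) ax (~-sym G (Sq.da t)) le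
    ...   | yes (here refl) = ⊥-elim (~-irr G (Sq.da t))
    ...   | yes (there (here refl)) = side s ¬bd x∉ t le
    ...   | yes (there (there (here refl))) = ⊥-elim (¬ac (~-sym G (Sq.da t)))
    ...   | yes (there (there (there (here refl)))) = side (mirror s) (¬bd ∘ ~-sym G) (x∉ ∘ mirror∈) t
            (≤-trans (τ-mono G (λ p → ⟦⟧⁺ (quad a b c d) (mirror∈ (⟦⟧⁻ (quad a d c b) p)))) le)

  Leaves : Fin n → Fin n → Fin n → Fin n → Set
  Leaves a b c d = ∃[ x ] ∃[ y ] (x ∈ quad a b c d × ¬ y ∈ quad a b c d × Adj G x y)

  leaves? : ∀ a b c d → Dec (Leaves a b c d)
  leaves? a b c d = any? λ x → any? λ y → (x ∈? quad a b c d) ×-dec (¬? (y ∈? quad a b c d) ×-dec adj? G x y)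

  -- Seven is one more than the certificates handle: four sides and three outgoing edges. A C₄
  -- component then has surplus 1.
  Big : Fin n → Fin n → Fin n → Fin n → Set
  Big a b c d = Sq G a b c d → ¬ Adj G a c → ¬ Adj G b d → Leaves a b c d → 7 ≤ τ G ⟦ quad a b c d ⟧

  private
    few′ : ∀ {a b c d} → Sq G a b c d → ¬ Adj G a c → ¬ Adj G b d → Leaves a b c d →
      τ G ⟦ quad a b c d ⟧ ≤ 6 → Strict G
    few′ {a} {b} {c} {d} s ¬ac ¬bd (x , y , x∈ , y∉ , xy) le = go x∈
      where
      le′ : ∀ {xs} → (∀ {z} → z ∈ xs → z ∈ quad a b c d) → τ G ⟦ xs ⟧ ≤ 6
      le′ {xs} i = ≤-trans (τ-mono G (λ p → ⟦⟧⁺ (quad a b c d) (i (⟦⟧⁻ xs p)))) le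
      go : x ∈ quad a b c d → Strict G
      go (here refl) = few s ¬ac ¬bd y∉ xy le
      go (there (here refl)) = few (rot s) ¬bd (¬ac ∘ ~-sym G) (y∉ ∘ rotAny) xy (le′ rotAny)
      go (there (there (here refl))) = few (rot (rot s)) (¬ac ∘ ~-sym G) (¬bd ∘ ~-sym G) (y∉ ∘ rotAny ∘ rotAny) xy
        (le′ (rotAny ∘ rotAny))
      go (there (there (there (here refl)))) = few (rot (rot (rot s))) (¬bd ∘ ~-sym G) ¬ac
        (y∉ ∘ rotAny ∘ rotAny ∘ rotAny) xy (le′ (rotAny ∘ rotAny ∘ rotAny))

    big-at : ∀ a b c d → Strict G ⊎ Big a b c d
    big-at a b c d with 7 ≤? τ G ⟦ quad a b c d ⟧
    ... | yes p = inj₂ (λ _ _ _ _ → p)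
    ... | no ¬p with sq? G a b c d | adj? G a c | adj? G b d | leaves? a b c d
    ...   | no ¬s | _ | _ | _ = inj₂ (λ s _ _ _ → ⊥-elim (¬s s))
    ...   | yes s | yes ac | _ | _ = inj₂ (λ _ ¬ac _ _ → ⊥-elim (¬ac ac))
    ...   | yes s | no _ | yes bd | _ = inj₂ (λ _ _ ¬bd _ → ⊥-elim (¬bd bd))
    ...   | yes s | no _ | no _ | no ¬l = inj₂ (λ _ _ _ l → ⊥-elim (¬l l))
    ...   | yes s | no ¬ac | no ¬bd | yes l = inj₁ (few′ s ¬ac ¬bd l (s≤s⁻¹ (≰⇒> ¬p)))

  strict-or-big : Strict G ⊎ (∀ a b c d → Big a b c d)
  strict-or-big = allOr λ a → allOr λ b → allOr λ c → allOr λ d → big-at a b c d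

-- Edge counts at stars, squares and copies of C₄ in a component

b5-edges : List (Fin 5 × Fin 5)
b5-edges = (0F , 1F) ∷ (1F , 2F) ∷ (2F , 3F) ∷ (3F , 4F) ∷ (4F , 1F) ∷ []

b5-edge : ∀ i j → b5 i j ≡ true → EdgeOf b5-edges i j
b5-edge = toWitness {a? = all? λ i → all? λ j → (b5 i j Bool.≟ true) →-dec edgeOf? b5-edges i j} tt

module _ {n : ℕ} (G : Graph (Fin n)) where

  -- `G [ C ]` is induced, so a chord in `G` would be a fifth edge of it.
  chordless-c4 : ∀ {C} (c : C4G (G [ C ])) → let open C4G c in ¬ Adj G q₀ q₂ × ¬ Adj G q₁ q₃
  chordless-c4 {C} c = (λ e → none 0F 2F (toWitness {a? = ¬? (edgeOf? c4-edges 0F 2F)} tt) (C4G.class c (ind⁺ G C e (inC 0F) (inC 2F)))) ,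
    λ e → none 1F 3F (toWitness {a? = ¬? (edgeOf? c4-edges 1F 3F)} tt) (C4G.class c (ind⁺ G C e (inC 1F) (inC 3F)))
    where
    s = C4G.square c
    inC : ∀ i → C4G.vert c i ∈ᵇ C
    inC 0F = proj₁ (proj₂ (ind⁻ G C (Sq.ab s)))
    inC 1F = proj₁ (proj₂ (ind⁻ G C (Sq.bc s)))
    inC 2F = proj₁ (proj₂ (ind⁻ G C (Sq.cd s)))
    inC 3F = proj₁ (proj₂ (ind⁻ G C (Sq.da s)))
    none : ∀ p q → ¬ EdgeOf c4-edges p q →
      ¬ (∃[ i ] ∃[ j ] (C4G.vert c p ≡ C4G.vert c i × C4G.vert c q ≡ C4G.vert c j × EdgeOf c4-edges i j))
    none p q ¬m (i , j , e , e′ , m) with vec-inj (sq-unique (G [ C ]) s) {p} {i} e | vec-inj (sq-unique (G [ C ]) s) {q} {j} e′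
    ... | refl | refl = ¬m m

  sq-in : ∀ {C a b c d x} → Sq (G [ C ]) a b c d → x ∈ quad a b c d → x ∈ᵇ C
  sq-in {C} s (here refl) = proj₁ (proj₂ (ind⁻ G C (Sq.ab s)))
  sq-in {C} s (there (here refl)) = proj₁ (proj₂ (ind⁻ G C (Sq.bc s)))
  sq-in {C} s (there (there (here refl))) = proj₁ (proj₂ (ind⁻ G C (Sq.cd s)))
  sq-in {C} s (there (there (there (here refl)))) = proj₁ (proj₂ (ind⁻ G C (Sq.da s)))

  sq-up : ∀ {C a b c d} → Sq (G [ C ]) a b c d → Sq G a b c d
  sq-up {C} = sq-map (G [ C ]) G (∩-⊆ G _)

  sq-τ : ∀ {C a b c d} → Sq (G [ C ]) a b c d → τ G ⟦ quad a b c d ⟧ ≤ τ G C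
  sq-τ {C} s = τ-mono G (λ p → sq-in s (⟦⟧⁻ _ p))

  quad-τ : ∀ {xs ys : List (Fin n)} → (∀ {z} → z ∈ xs → z ∈ ys) → τ G ⟦ xs ⟧ ≤ τ G ⟦ ys ⟧
  quad-τ {xs} {ys} i = τ-mono G (λ p → ⟦⟧⁺ ys (i (⟦⟧⁻ xs p)))

  τ≤size : ∀ S → τ G S ≤ size G
  τ≤size S = size-mono (G ∩ touch S) G (∩-⊆ G _)

  degree-4 : ∀ {c p q a b} → Adj G c p → Adj G c q → Adj G c a → Adj G c b →
    p ≢ q → p ≢ a → p ≢ b → q ≢ a → q ≢ b → a ≢ b → 4 ≤ τ G ⟦ c ∷ [] ⟧
  degree-4 {c} {p} {q} {a} {b} cp cq ca cb pq pa pb qa qb ab =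
    size-embed (G ∩ touch ⟦ c ∷ [] ⟧) (Vec.lookup (c ∷ p ∷ q ∷ a ∷ b ∷ []))
      (vec-inj ((~⇒≢ G cp VA.∷ ~⇒≢ G cq VA.∷ ~⇒≢ G ca VA.∷ ~⇒≢ G cb VA.∷ VA.[]) VP.∷
        (pq VA.∷ pa VA.∷ pb VA.∷ VA.[]) VP.∷ (qa VA.∷ qb VA.∷ VA.[]) VP.∷ (ab VA.∷ VA.[]) VP.∷ VA.[] VP.∷ VP.[]))
      es (toWitness {a? = distinct? es} tt) (te cp ∷ te cq ∷ te ca ∷ te cb ∷ [])
    where
    es : List (Fin 5 × Fin 5)
    es = (0F , 1F) ∷ (0F , 2F) ∷ (0F , 3F) ∷ (0F , 4F) ∷ []
    te : ∀ {x} → Adj G c x → Adj (G ∩ touch ⟦ c ∷ [] ⟧) c x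
    te e = ∩⁺ G (touch ⟦ c ∷ [] ⟧) e (inj₁ (⟦⟧⁺ _ (here refl)))

  star-3 : ∀ {v a b w} → Adj G v a → Adj G v b → Adj G v w → a ≢ b → a ≢ w → b ≢ w → 3 ≤ size (G [ ball G v [] ])
  star-3 {v} va vb vw ab aw bw = size-3 (G [ ball G v [] ]) (st va) (st vb) (st vw)
    (ne va ab) (ne va aw) (ne vb bw)
    where
    st : ∀ {x} → Adj G v x → Adj (G [ ball G v [] ]) v x
    st e = ind⁺ G (ball G v []) e (ball⁺ˡ G (inj₁ refl)) (ball⁺ˡ G (inj₂ e))
    ne : ∀ {x y} → Adj G v x → x ≢ y → ¬ SameEdge (v , x) (v , y)
    ne e x≢y (inj₁ (_ , p)) = x≢y (sym p)
    ne e x≢y (inj₂ (p , _)) = ~⇒≢ G e p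

  star-4 : ∀ {v a b w w′} → Adj G v a → Adj G v b → Adj G v w → Adj G v w′ →
    a ≢ b → a ≢ w → a ≢ w′ → b ≢ w → b ≢ w′ → w ≢ w′ → 4 ≤ size (G [ ball G v [] ])
  star-4 {v} va vb vw vw′ ab aw aw′ bw bw′ ww′ = ≤-trans (degree-4 va vb vw vw′ ab aw aw′ bw bw′ ww′)
    (size-mono (G ∩ touch ⟦ v ∷ [] ⟧) (G [ ball G v [] ]) λ e → let e′ , t = ∩⁻ G (touch ⟦ v ∷ [] ⟧) e in st e′ t)
    where
    st : ∀ {x y} → Adj G x y → x ∈ᵇ ⟦ v ∷ [] ⟧ ⊎ y ∈ᵇ ⟦ v ∷ [] ⟧ → Adj (G [ ball G v [] ]) x y
    st e (inj₁ p) with ⟦⟧⁻ _ p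
    ... | here refl = ind⁺ G (ball G v []) e (ball⁺ˡ G (inj₁ refl)) (ball⁺ˡ G (inj₂ e))
    st e (inj₂ p) with ⟦⟧⁻ _ p
    ... | here refl = ind⁺ G (ball G v []) e (ball⁺ˡ G (inj₂ (~-sym G e))) (ball⁺ˡ G (inj₁ refl))

  -- Inside C at most five edges touch a copy of C₄; all others leave C.
  module _ {C : VSet n} (c : ConsG (G [ C ])) (i : Fin (ConsG.t c)) where
    open ConsG c

    copy : List (Fin n)
    copy = quad (bs i 1F) (bs i 2F) (bs i 3F) (bs i 4F)

    copy-sq : Sq (G [ C ]) (bs i 1F) (bs i 2F) (bs i 3F) (bs i 4F)
    copy-sq = block-sq blocks i

    private
      in-copy : ∀ {x} → x ∈ copy → ∃[ k ] x ≡ bs i (fs k)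
      in-copy (here e) = 0F , e
      in-copy (there (here e)) = 1F , e
      in-copy (there (there (here e))) = 2F , e
      in-copy (there (there (there (here e)))) = 3F , e

      outer : Graph (Fin n)
      outer = (G ∩ touch ⟦ copy ⟧) ∩ not-rel (inside C)

      inner≤5 : size ((G [ C ]) ∩ touch ⟦ copy ⟧) ≤ 5
      inner≤5 = size-cover ((G [ C ]) ∩ touch ⟦ copy ⟧) (map (λ (j , k) → bs i j , bs i k) b5-edges) cov
        where
        shift : ∀ es {j k} → EdgeOf es j k → Any (λ e → SameEdge e (bs i j , bs i k)) (map (λ (j , k) → bs i j , bs i k) es)
        shift (_ ∷ _) (here (inj₁ (refl , refl))) = here (inj₁ (refl , refl))
        shift (_ ∷ _) (here (inj₂ (refl , refl))) = here (inj₂ (refl , refl))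
        shift (_ ∷ es) (there p) = there (shift es p)
        swap : ∀ {es x y} → Any (λ e → SameEdge e (x , y)) es → Any (λ e → SameEdge e (y , x)) es
        swap = Any.map λ { (inj₁ (p , q)) → inj₂ (q , p) ; (inj₂ (p , q)) → inj₁ (q , p) }
        at : ∀ {x y} → Adj (G [ C ]) x y → y ∈ copy →
          Any (λ e → SameEdge e (x , y)) (map (λ (j , k) → bs i j , bs i k) b5-edges)
        at e y∈ with in-copy y∈
        ... | k , refl with nbr-in-block blocks e
        ...   | j , refl , l = shift b5-edges (b5-edge j (fs k) l)
        cov : ∀ {x y} → Adj ((G [ C ]) ∩ touch ⟦ copy ⟧) x y →
          Any (λ e → SameEdge e (x , y)) (map (λ (j , k) → bs i j , bs i k) b5-edges)
        cov e with ∩⁻ (G [ C ]) (touch ⟦ copy ⟧) e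
        ... | e′ , inj₁ p = swap (at (~-sym (G [ C ]) e′) (⟦⟧⁻ copy p))
        ... | e′ , inj₂ p = at e′ (⟦⟧⁻ copy p)

      outer≥ : ∀ {k} → 5 + k ≤ τ G ⟦ copy ⟧ → k ≤ size outer
      outer≥ {k} le = +-cancelˡ-≤ 5 k (size outer) (≤-trans le (≤-trans
        (size-sub ((G [ C ]) ∩ touch ⟦ copy ⟧) outer (G ∩ touch ⟦ copy ⟧) split) (+-monoˡ-≤ _ inner≤5)))
        where
        split : ∀ {x y} → Adj (G ∩ touch ⟦ copy ⟧) x y → Adj ((G [ C ]) ∩ touch ⟦ copy ⟧) x y ⊎ Adj outer x y
        split {x} {y} e with holds? (inside C) x y
        ... | yes (p , q) = let e′ , t = ∩⁻ G (touch ⟦ copy ⟧) e in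
              inj₁ (∩⁺ (G [ C ]) (touch ⟦ copy ⟧) (ind⁺ G C e′ p q) t)
        ... | no ¬p = inj₂ (∩⁺ (G ∩ touch ⟦ copy ⟧) (not-rel (inside C)) e ¬p)

      outer⊆∂ : outer ⊆ᴳ ∂ G C
      outer⊆∂ {x} {y} e with ∩⁻ (G ∩ touch ⟦ copy ⟧) (not-rel (inside C)) e
      ... | f , ¬in with ∩⁻ G (touch ⟦ copy ⟧) f
      ...   | g , inj₁ p = let x∈ = sq-in copy-sq (⟦⟧⁻ copy p) in ∩⁺ G (bd C) g (inj₁ (x∈ , λ y∈ → ¬in (x∈ , y∈)))
      ...   | g , inj₂ p = let y∈ = sq-in copy-sq (⟦⟧⁻ copy p) in ∩⁺ G (bd C) g (inj₂ (y∈ , λ x∈ → ¬in (x∈ , y∈)))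

    copy-links : ∀ {k} → 5 + k ≤ τ G ⟦ copy ⟧ → k ≤ size (∂ G C)
    copy-links le = ≤-trans (outer≥ le) (size-mono outer (∂ G C) outer⊆∂)

    -- The edges `ua` and `ub` leave `C` without touching the copy, so they come on top of those
    -- found by `copy-links`.
    copy-links′ : ∀ {k u a b} → 5 + k ≤ τ G ⟦ copy ⟧ → ¬ u ∈ copy → u ∈ᵇ C → a ∉ᵇ C → b ∉ᵇ C →
      Adj G u a → Adj G u b → a ≢ b → k + 2 ≤ size (∂ G C)
    copy-links′ {k} {u} {a} {b} le u∉ u∈ a∉ b∉ ua ub a≢b = ≤-trans
      (+-mono-≤ (outer≥ le) (size-2 at-u (te ua a∉) (te ub b∉)
        λ { (inj₁ (_ , e)) → a≢b (sym e) ; (inj₂ (e , _)) → ~⇒≢ G ua e }))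
      (size-super outer at-u (∂ G C) outer⊆∂ (∩-⊆ (∂ G C) _) disj)
      where
      at-u = ∂ G C ∩ touch ⟦ u ∷ [] ⟧
      te : ∀ {x} → Adj G u x → x ∉ᵇ C → Adj at-u u x
      te e x∉ = ∩⁺ (∂ G C) (touch ⟦ u ∷ [] ⟧) (∂⁺ G u∈ x∉ e) (inj₁ (⟦⟧⁺ _ (here refl)))
      one : ∀ {x} → x ∈ᵇ ⟦ u ∷ [] ⟧ → x ≡ u
      one p with ⟦⟧⁻ _ p
      ... | here e = e
      disj : ∀ {x y} → Adj outer x y → Adj at-u x y → ⊥
      disj {x} {y} e f with ∩⁻ (G ∩ touch ⟦ copy ⟧) (not-rel (inside C)) e | ∩⁻ (∂ G C) (touch ⟦ u ∷ [] ⟧) f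
      ... | g , ¬in | _ , t with ∩⁻ G (touch ⟦ copy ⟧) g
      disj {x} {y} e f | g , ¬in | _ , inj₁ p | _ , inj₁ q with one p
      ...   | refl = u∉ (⟦⟧⁻ copy q)
      disj {x} {y} e f | g , ¬in | _ , inj₁ p | _ , inj₂ q with one p
      ...   | refl = ¬in (u∈ , sq-in copy-sq (⟦⟧⁻ copy q))
      disj {x} {y} e f | g , ¬in | _ , inj₂ p | _ , inj₁ q with one p
      ...   | refl = ¬in (sq-in copy-sq (⟦⟧⁻ copy q) , u∈)
      disj {x} {y} e f | g , ¬in | _ , inj₂ p | _ , inj₂ q with one p
      ...   | refl = u∉ (⟦⟧⁻ copy q)

    copy-leaf : ¬ bs i 0F ∈ copy
    copy-leaf p with in-copy p
    ... | k , e with proj₂ (Blocks.inj blocks e)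
    ...   | ()

-- Chords, opposite degrees and large degree

module _ {n : ℕ} (G : Graph (Fin n)) (conn : Conn G)
  (IH : ∀ (H : Graph (Fin n)) → size H < size G → Conn H → Result H)
  (inSq : ∀ {a b} → Adj G a b → InSq G a b)
  (big : ∀ a b c d → Big G conn IH inSq a b c d) where

  private
    module Co {v v′ : Fin n} {L : VSet n} (vv′ : Adj G v v′) (v∈ : v ∈ᵇ L) = Core G conn IH inSq {v} {v′} {L} vv′ v∈

    c4-τ : ∀ {U u C} → IsComp G U u C → C4G (G [ C ]) → Link G C → 7 ≤ τ G C
    c4-τ {C = C} ic c (link x∈ y∉ xy) with C4G.covers c (proj₂ (comp-touched G ic (Sq.ab (C4G.square c)) x∈))
    ... | i , refl = ≤-trans (big _ _ _ _ (sq-up G s) (proj₁ (chordless-c4 G c)) (proj₂ (chordless-c4 G c))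
          (_ , _ , vec-quad i , (λ y∈ → y∉ (sq-in G s y∈)) , xy)) (sq-τ G s)
      where s = C4G.square c

    -- One more edge is wanted. Either `L` contains a sixth, or some edge has an end outside `L` and
    -- the component of that end has surplus 1: from two boundary edges if it is exceptional, from
    -- seven touching edges if it is a C₄.
    core5 : ∀ {v v′ L} → Adj G v v′ → v ∈ᵇ L → Kills G v L → 5 ≤ size (G [ L ]) → 6 ≤ size G → Strict G
    core5 {v} {v′} {L} vv′ v∈ kills le m with 6 ≤? size (G [ L ])
    ... | yes p = Co.core6 vv′ v∈ kills p
    ... | no ¬p with any? (λ x → any? (λ y → adj? G x y ×-dec ¬? (x ∈ᵇ? L)))
    ...   | no ¬e = ⊥-elim (¬p (≤-trans m (size-mono G (G [ L ]) (λ e → ind⁺ G L e (in-L e) (in-L (~-sym G e))))))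
      where
      in-L : ∀ {x y} → Adj G x y → x ∈ᵇ L
      in-L {x} {y} e with x ∈ᵇ? L
      ... | yes q = q
      ... | no ¬q = ⊥-elim (¬e (x , y , e , ¬q))
    ...   | yes (x , y , xy , x∉) = go (component G (∁ L) x (∁⁺ L x∉))
      where
      go : Σ[ C ∈ VSet n ] IsComp G (∁ L) x C → Strict G
      go (C , ic) = discharge G v kills (chg-one G v (Co.chg-0 vv′ v∈) ic (chg-1 (Co.result vv′ v∈ ic))) (+-monoˡ-≤ 1 le)
        where
        l : Link G C
        l = comp-link G conn ic (IsComp.root∈ ic) xy (Co.v∉∁ vv′ v∈) vv′
        chg-1 : Result (G [ C ]) → Chg G v C 1
        chg-1 (isStrict s) = chg-strict G v s (link-1 G l)
        chg-1 (isExt e) = chg-ext G v e (link-2 G l (inSq (Link.xy l)))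
        chg-1 (isC4 c) = chg-c4 G v c (c4-τ ic c l)

    -- The ball of `a` contains the square and its chord, hence five edges; if `G` has no sixth
    -- edge, it is K₄⁻.
    chorded : ∀ {a b c d} → Sq G a b c d → Adj G a c → Result G
    chorded {a} {b} {c} {d} s ac with 6 ≤? size G
    ... | yes p = isStrict (core5 ac a∈ (ball-kills G a) le p)
      where
      L = ball G a []
      a∈ : a ∈ᵇ L
      a∈ = ball⁺ˡ G (inj₁ refl)
      b∈ : b ∈ᵇ L
      b∈ = ball⁺ˡ G (inj₂ (Sq.ab s))
      c∈ : c ∈ᵇ L
      c∈ = ball⁺ˡ G (inj₂ ac)
      d∈ : d ∈ᵇ L
      d∈ = ball⁺ˡ G (inj₂ (~-sym G (Sq.da s)))
      le : 5 ≤ size (G [ L ])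
      le = size-embed (G [ L ]) (vec4 a b c d) (vec-inj (sq-unique G s)) k4m-edges (toWitness {a? = distinct? k4m-edges} tt)
        (ind⁺ G L ac a∈ c∈ ∷ ind⁺ G L (Sq.ab s) a∈ b∈ ∷ ind⁺ G L (Sq.bc s) b∈ c∈ ∷ ind⁺ G L (Sq.cd s) c∈ d∈ ∷
         ind⁺ G L (Sq.da s) d∈ a∈ ∷ [])
    ... | no ¬p = isExt (isK4m (k4mg s ac (≤-antisym (s≤s⁻¹ (≰⇒> ¬p)) (size-embed G (vec4 a b c d)
            (vec-inj (sq-unique G s)) k4m-edges (toWitness {a? = distinct? k4m-edges} tt)
            (ac ∷ Sq.ab s ∷ Sq.bc s ∷ Sq.cd s ∷ Sq.da s ∷ [])))))

    chord-at : ∀ a b c d → Result G ⊎ (Sq G a b c d → ¬ Adj G a c)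
    chord-at a b c d with sq? G a b c d | adj? G a c
    ... | no ¬s | _ = inj₂ (λ s → ⊥-elim (¬s s))
    ... | yes _ | no ¬ac = inj₂ (λ _ → ¬ac)
    ... | yes s | yes ac = inj₁ (chorded s ac)

  module _ (chordless : ∀ a b c d → Sq G a b c d → ¬ Adj G a c) where

    private
      leaving : ∀ {a b c d w} → Sq G a b c d → Adj G a w → w ≢ b → w ≢ d → ¬ w ∈ quad a b c d
      leaving s aw w≢b w≢d (here refl) = ~-irr G aw
      leaving s aw w≢b w≢d (there (here e)) = w≢b e
      leaving s aw w≢b w≢d (there (there (here refl))) = chordless _ _ _ _ s aw
      leaving s aw w≢b w≢d (there (there (there (here e)))) = w≢d e

      big′ : ∀ {a b c d} → Sq G a b c d → ∀ {x y} → x ∈ quad a b c d → ¬ y ∈ quad a b c d → Adj G x y →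
        7 ≤ τ G ⟦ quad a b c d ⟧
      big′ s x∈ y∉ xy = big _ _ _ _ s (chordless _ _ _ _ s) (chordless _ _ _ _ (rot s)) (_ , _ , x∈ , y∉ , xy)

      copy-big : ∀ {C} (c : ConsG (G [ C ])) i → 7 ≤ τ G ⟦ copy G c i ⟧
      copy-big {C} c i = big′ (sq-up G (copy-sq G c i)) (here refl) (copy-leaf G c i)
        (∩-⊆ G _ (Blocks.local (ConsG.blocks c) i 1F 0F refl))

      no-k4m : ∀ {C} → ¬ K4mG (G [ C ])
      no-k4m k = chordless _ _ _ _ (sq-up G (K4mG.square k)) (∩-⊆ G _ (K4mG.chord k))

      opp∉ : ∀ {v a c b} → Sq G v a c b → c ∈ᵇ ∁ (ball G v [])
      opp∉ {v} s = ∁⁺ (ball G v []) (λ c∈ → go (ball⁻ G c∈))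
        where
        go : _ → ⊥
        go (inj₁ (inj₁ e)) = Sq.a≢c s e
        go (inj₁ (inj₂ e)) = chordless _ _ _ _ s e
        go (inj₂ ())

      -- Adding `c` to the ball of `v` puts the square and `vw` inside `L`, five edges. It is safe
      -- because a square through `c` passes through `a` and `b`, neighbours of `v`.
      degree-2 : ∀ {v a c b w} → Sq G v a c b → Adj G v w → w ≢ a → w ≢ b →
        (∀ {z} → Adj G c z → z ≡ a ⊎ z ≡ b) → Strict G
      degree-2 {v} {a} {c} {b} {w} s vw w≢a w≢b only = core5 vw v∈ kills core
        (≤-trans (n≤1+n 6) (≤-trans (big′ s (here refl) w∉ vw) (τ≤size G _)))
        where
        L = ball G v (c ∷ [])
        w∉ = leaving s vw w≢a w≢b
        v∈ : v ∈ᵇ L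
        v∈ = ball⁺ˡ G (inj₁ refl)
        nb : ∀ {x} → Adj G v x → x ∈ᵇ L
        nb e = ball⁺ˡ G (inj₂ e)
        c∈ : c ∈ᵇ L
        c∈ = ball⁺ʳ G (here refl)
        vb = ~-sym G (Sq.da s)
        es : List (Fin 5 × Fin 5)
        es = (0F , 1F) ∷ (1F , 2F) ∷ (2F , 3F) ∷ (3F , 0F) ∷ (0F , 4F) ∷ []
        core : 5 ≤ size (G [ L ])
        core = size-embed (G [ L ]) (Vec.lookup (v ∷ a ∷ c ∷ b ∷ w ∷ []))
          (vec-inj ((~⇒≢ G (Sq.ab s) VA.∷ Sq.a≢c s VA.∷ ~⇒≢ G vb VA.∷ ~⇒≢ G vw VA.∷ VA.[]) VP.∷
            (~⇒≢ G (Sq.bc s) VA.∷ Sq.b≢d s VA.∷ (w≢a ∘ sym) VA.∷ VA.[]) VP.∷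
            (~⇒≢ G (Sq.cd s) VA.∷ (λ e → w∉ (there (there (here (sym e))))) VA.∷ VA.[]) VP.∷
            ((w≢b ∘ sym) VA.∷ VA.[]) VP.∷ VA.[] VP.∷ VP.[]))
          es (toWitness {a? = distinct? es} tt)
          (ind⁺ G L (Sq.ab s) v∈ (nb (Sq.ab s)) ∷ ind⁺ G L (Sq.bc s) (nb (Sq.ab s)) c∈ ∷ ind⁺ G L (Sq.cd s) c∈ (nb vb) ∷
           ind⁺ G L (Sq.da s) (nb vb) v∈ ∷ ind⁺ G L vw v∈ (nb vw) ∷ [])
        kills : Kills G v L
        kills t x∈ with ball⁻ G x∈
        ... | inj₁ p = here (here p)
        ... | inj₂ (here refl) with only (Sq.ab t)
        ...   | inj₁ refl = there (here (here (inj₂ (Sq.ab s))))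
        ...   | inj₂ refl = there (here (here (inj₂ vb)))

      -- Three star edges at `v` and surplus 3 at the component `C` of `c`. Inside `C` only `c′` can
      -- be a neighbour of `c`, so no square of `C` contains `c`: a C₄ component is impossible, and
      -- in cons(T, C₄) the edges `ca` and `cb` are counted besides those at a copy.
      degree-3 : ∀ {v a c b w c′} → Sq G v a c b → Adj G v w → w ≢ a → w ≢ b → Adj G c c′ → c′ ≢ a → c′ ≢ b →
        (∀ {z} → Adj G c z → z ≡ a ⊎ z ≡ b ⊎ z ≡ c′) → Strict G
      degree-3 {v} {a} {c} {b} {w} {c′} s vw w≢a w≢b cc′ c′≢a c′≢b only = go (component G (∁ L) c (opp∉ s))
        where
        L = ball G v []
        v∈ : v ∈ᵇ L
        v∈ = ball⁺ˡ G (inj₁ refl)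
        vb = ~-sym G (Sq.da s)
        ca = ~-sym G (Sq.bc s)
        go : Σ[ C ∈ VSet n ] IsComp G (∁ L) c C → Strict G
        go (C , ic) = discharge G v (ball-kills G v) (chg-one G v (Co.chg-0 vw v∈) ic (chg-3 (Co.result vw v∈ ic)))
          (+-monoˡ-≤ 3 (star-3 G (Sq.ab s) vb vw (Sq.b≢d s) (w≢a ∘ sym) (w≢b ∘ sym)))
          where
          out : ∀ {x} → Adj G v x → x ∉ᵇ C
          out e x∈ = ∁⁻ L (IsComp.sub ic x∈) (ball⁺ˡ G (inj₂ e))
          c∈ = IsComp.root∈ ic
          a∉ = out (Sq.ab s)
          b∉ = out vb
          three : ∀ {x y} → x ∈ᵇ C → y ∉ᵇ C → Adj G x y → (x ≡ c → y ≢ a × y ≢ b) → 3 ≤ size (∂ G C)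
          three {x} {y} x∈ y∉ xy ne = size-3 (∂ G C) (∂⁺ G c∈ a∉ ca) (∂⁺ G c∈ b∉ (Sq.cd s)) (∂⁺ G x∈ y∉ xy)
            (λ { (inj₁ (_ , e)) → Sq.b≢d s (sym e) ; (inj₂ (refl , _)) → ~-irr G ca })
            (λ { (inj₁ (e , f)) → proj₁ (ne e) f ; (inj₂ (refl , _)) → a∉ x∈ })
            (λ { (inj₁ (e , f)) → proj₂ (ne e) f ; (inj₂ (refl , _)) → b∉ x∈ })
          -- Besides `ca` and `cb`: if `c′` is in `C`, the square through `cc′` returns to `c` via
          -- `a` or `b`, so one of its two edges before that leaves `C`.
          third : 3 ≤ size (∂ G C)
          third with c′ ∈ᵇ? C
          ... | no c′∉ = three c∈ c′∉ cc′ (λ _ → c′≢a , c′≢b)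
          ... | yes c′∈ with inSq cc′
          ...   | y , z , t with y ∈ᵇ? C
          ...     | no y∉ = three c′∈ y∉ (Sq.bc t) (λ e → ⊥-elim (~⇒≢ G cc′ (sym e)))
          ...     | yes y∈ = three y∈ z∉ (Sq.cd t) (λ e → ⊥-elim (Sq.a≢c t (sym e)))
            where
            z∉ : z ∉ᵇ C
            z∉ with only (~-sym G (Sq.da t))
            ... | inj₁ refl = a∉
            ... | inj₂ (inj₁ refl) = b∉
            ... | inj₂ (inj₂ refl) = ⊥-elim (Sq.b≢d t refl)
          inner : ∀ {z} → Adj (G [ C ]) c z → z ≡ c′
          inner e with ind⁻ G C e
          ... | e′ , _ , z∈ with only e′
          ...   | inj₁ refl = ⊥-elim (a∉ z∈)
          ...   | inj₂ (inj₁ refl) = ⊥-elim (b∉ z∈)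
          ...   | inj₂ (inj₂ p) = p
          no-sq : ∀ {p q r t} → Sq (G [ C ]) p q r t → ¬ c ∈ quad p q r t
          no-sq t c∈q with sq-at t c∈q
          ... | _ , _ , _ , t′ , _ = Sq.b≢d t′ (trans (inner (Sq.ab t′)) (sym (inner (~-sym (G [ C ]) (Sq.da t′)))))
          chg-3 : Result (G [ C ]) → Chg G v C 3
          chg-3 (isStrict t) = chg-strict G v t third
          chg-3 (isExt (isK4m k)) = ⊥-elim (no-k4m k)
          -- From 7 = 5 + 2, two boundary edges at the copy and two more at `c`; one of these four
          -- covers the deficit.
          chg-3 (isExt (isCons k)) = chg-ext G v (isCons k) (copy-links′ G k i {2} (copy-big k i) (no-sq (copy-sq G k i))
              c∈ a∉ b∉ ca (Sq.cd s) (Sq.b≢d s))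
            where i = ConsG.base k
          chg-3 (isC4 k) with C4G.covers k (proj₂ (comp-touched G ic (Sq.ab (C4G.square k)) c∈))
          ... | i , e = ⊥-elim (no-sq (C4G.square k) (subst (_∈ _) (sym e) (vec-quad i)))

    -- Applied with `a` and `b` the neighbours of `c` on a square, so that `c` has degree at least
    -- 4.
    Extra : Fin n → Fin n → Fin n → Set
    Extra c a b = ∃[ w ] ∃[ w′ ] (Adj G c w × Adj G c w′ × w ≢ w′ × w ≢ a × w ≢ b × w′ ≢ a × w′ ≢ b)

    opposite-degree : ∀ {v a c b w} → Sq G v a c b → Adj G v w → w ≢ a → w ≢ b → Strict G ⊎ Extra c a b
    opposite-degree {v} {a} {c} {b} {w} s vw w≢a w≢b
      with any? (λ z → adj? G c z ×-dec (¬? (z ≟ a) ×-dec ¬? (z ≟ b)))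
    ... | no ¬z = inj₁ (degree-2 s vw w≢a w≢b only)
      where
      only : ∀ {z} → Adj G c z → z ≡ a ⊎ z ≡ b
      only {z} e with z ≟ a | z ≟ b
      ... | yes p | _ = inj₁ p
      ... | no _ | yes p = inj₂ p
      ... | no p | no q = ⊥-elim (¬z (z , e , p , q))
    ... | yes (c′ , cc′ , c′≢a , c′≢b)
      with any? (λ z → adj? G c z ×-dec (¬? (c′ ≟ z) ×-dec (¬? (z ≟ a) ×-dec ¬? (z ≟ b))))
    ...   | yes (c″ , cc″ , ne , p , q) = inj₂ (c′ , c″ , cc′ , cc″ , ne , c′≢a , c′≢b , p , q)
    ...   | no ¬z = inj₁ (degree-3 s vw w≢a w≢b cc′ c′≢a c′≢b only)
      where
      only : ∀ {z} → Adj G c z → z ≡ a ⊎ z ≡ b ⊎ z ≡ c′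
      only {z} e with z ≟ a | z ≟ b | c′ ≟ z
      ... | yes p | _ | _ = inj₁ p
      ... | no _ | yes p | _ = inj₂ (inj₁ p)
      ... | no _ | no _ | yes p = inj₂ (inj₂ (sym p))
      ... | no p | no q | no r = ⊥-elim (¬z (z , e , r , p , q))

    private
      -- `c` has degree at least 4, hence so has the opposite corner `r` unless `G` is strict; as
      -- `cr` is not a chord, the two stars share no edge.
      two-stars : ∀ {c p r q a b} → Sq G c p r q → Adj G c a → Adj G c b → a ≢ b → a ≢ p → a ≢ q → b ≢ p → b ≢ q →
        Strict G ⊎ 8 ≤ τ G ⟦ quad c p r q ⟧
      two-stars {c} {p} {r} {q} s ca cb ab ap aq bp bq with opposite-degree s ca ap aq
      ... | inj₁ st = inj₁ st
      ... | inj₂ (w , w′ , rw , rw′ , ww′ , wp , wq , w′p , w′q) = inj₂ (≤-trans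
            (+-mono-≤ (degree-4 G (Sq.ab s) (~-sym G (Sq.da s)) ca cb (Sq.b≢d s) (ap ∘ sym) (bp ∘ sym) (aq ∘ sym) (bq ∘ sym) ab)
                      (degree-4 G (~-sym G (Sq.bc s)) (Sq.cd s) rw rw′ (Sq.b≢d s) (wp ∘ sym) (w′p ∘ sym) (wq ∘ sym) (w′q ∘ sym) ww′))
            (size-super (G ∩ touch ⟦ c ∷ [] ⟧) (G ∩ touch ⟦ r ∷ [] ⟧) (G ∩ touch ⟦ quad c p r q ⟧) (up (here refl))
              (up (there (there (here refl)))) disj))
        where
        one : ∀ {x y} → x ∈ᵇ ⟦ y ∷ [] ⟧ → x ≡ y
        one p with ⟦⟧⁻ _ p
        ... | here e = e
        up : ∀ {x} → x ∈ quad c p r q → (G ∩ touch ⟦ x ∷ [] ⟧) ⊆ᴳ (G ∩ touch ⟦ quad c p r q ⟧)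
        up {x} x∈ e with ∩⁻ G (touch ⟦ x ∷ [] ⟧) e
        ... | e′ , inj₁ m with one m
        ...   | refl = ∩⁺ G (touch ⟦ quad c p r q ⟧) e′ (inj₁ (⟦⟧⁺ _ x∈))
        up {x} x∈ e | e′ , inj₂ m with one m
        ...   | refl = ∩⁺ G (touch ⟦ quad c p r q ⟧) e′ (inj₂ (⟦⟧⁺ _ x∈))
        disj : ∀ {x y} → Adj (G ∩ touch ⟦ c ∷ [] ⟧) x y → Adj (G ∩ touch ⟦ r ∷ [] ⟧) x y → ⊥
        disj e f with ∩⁻ G (touch ⟦ c ∷ [] ⟧) e | ∩⁻ G (touch ⟦ r ∷ [] ⟧) f
        ... | _ , inj₁ m | _ , inj₁ m′ = Sq.a≢c s (trans (sym (one m)) (one m′))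
        ... | _ , inj₂ m | _ , inj₂ m′ = Sq.a≢c s (trans (sym (one m)) (one m′))
        ... | g , inj₁ m | _ , inj₂ m′ with one m | one m′
        ...   | refl | refl = chordless _ _ _ _ s g
        disj e f | g , inj₂ m | _ , inj₁ m′ with one m | one m′
        ...   | refl | refl = chordless _ _ _ _ s (~-sym G g)

    -- Four star edges and surplus 2 at the component of `c`. A square of it through `c` is touched
    -- by eight edges, `ca` and `cb` leading outside: 8 = 6 + 2 suits a C₄ and 8 = 5 + 3 a copy with
    -- deficit 1. A copy that misses `c` has two boundary edges, and `ca`, `cb` are two more.
    large-degree : ∀ {v a c b} → Sq G v a c b → Extra v a b → Strict G
    large-degree {v} {a} {c} {b} s (w , w′ , vw , vw′ , ww′ , wa , wb , w′a , w′b) = go (component G (∁ L) c (opp∉ s))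
      where
      L = ball G v []
      v∈ : v ∈ᵇ L
      v∈ = ball⁺ˡ G (inj₁ refl)
      vb = ~-sym G (Sq.da s)
      ca = ~-sym G (Sq.bc s)
      go : Σ[ C ∈ VSet n ] IsComp G (∁ L) c C → Strict G
      go (C , ic) = finish (chg-2 (Co.result vw v∈ ic))
        where
        out : ∀ {x} → Adj G v x → x ∉ᵇ C
        out e x∈ = ∁⁻ L (IsComp.sub ic x∈) (ball⁺ˡ G (inj₂ e))
        c∈ = IsComp.root∈ ic
        a∉ = out (Sq.ab s)
        b∉ = out vb
        finish : Strict G ⊎ Chg G v C 2 → Strict G
        finish (inj₁ st) = st
        finish (inj₂ h) = discharge G v (ball-kills G v) (chg-one G v (Co.chg-0 vw v∈) ic h)
          (+-monoˡ-≤ 2 (star-4 G (Sq.ab s) vb vw vw′ (Sq.b≢d s) (wa ∘ sym) (w′a ∘ sym) (wb ∘ sym) (w′b ∘ sym) ww′))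
        eight : ∀ {p q r t} → Sq (G [ C ]) p q r t → c ∈ quad p q r t → Strict G ⊎ 8 ≤ τ G ⟦ quad p q r t ⟧
        eight {p} {q} {r} {t} sq₁ c∈q with sq-at sq₁ c∈q
        ... | p′ , r′ , q′ , sq₂ , i = [ inj₁ , (λ le → inj₂ (≤-trans le (quad-τ G i))) ]′
              (two-stars (sq-up G sq₂) ca (Sq.cd s) (Sq.b≢d s) (ne a∉ p∈) (ne a∉ q∈) (ne b∉ p∈) (ne b∉ q∈))
          where
          p∈ = sq-in G sq₂ (there (here refl))
          q∈ = sq-in G sq₂ (there (there (there (here refl))))
          ne : ∀ {x y} → x ∉ᵇ C → y ∈ᵇ C → x ≢ y
          ne x∉ y∈ refl = x∉ y∈
        chg-2 : Result (G [ C ]) → Strict G ⊎ Chg G v C 2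
        chg-2 (isStrict t) = inj₂ (chg-strict G v t (size-2 (∂ G C) (∂⁺ G c∈ a∉ ca) (∂⁺ G c∈ b∉ (Sq.cd s))
          (λ { (inj₁ (_ , e)) → Sq.b≢d s (sym e) ; (inj₂ (refl , _)) → ~-irr G ca })))
        chg-2 (isExt (isK4m k)) = ⊥-elim (no-k4m k)
        chg-2 (isExt (isCons k)) with c ∈? copy G k (ConsG.base k)
        ... | no c∉ = inj₂ (chg-ext G v (isCons k) (≤-trans (n≤1+n 3) (copy-links′ G k i {2} (copy-big k i) c∉
              c∈ a∉ b∉ ca (Sq.cd s) (Sq.b≢d s))))
          where i = ConsG.base k
        ... | yes c∈q = [ inj₁ , (λ le → inj₂ (chg-ext G v (isCons k) (copy-links G k i {3} le))) ]′ (eight (copy-sq G k i) c∈q)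
          where i = ConsG.base k
        chg-2 (isC4 k) with C4G.covers k (proj₂ (comp-touched G ic (Sq.ab (C4G.square k)) c∈))
        ... | i , e = [ inj₁ , (λ le → inj₂ (chg-c4 G v k (≤-trans le (sq-τ G (C4G.square k))))) ]′
              (eight (C4G.square k) (subst (_∈ _) (sym e) (vec-quad i)))

    private
      alone : ∀ {a b c d} → Sq G a b c d → ¬ Leaves G conn IH inSq a b c d → C4G G
      alone {a} {b} {c} {d} s ¬l = c4g s (≤-antisym
        (size-cover G (map (λ (i , j) → vec4 a b c d i , vec4 a b c d j) c4-edges) cov)
        (size-embed G (vec4 a b c d) (vec-inj (sq-unique G s)) c4-edges (toWitness {a? = distinct? c4-edges} tt)
          (Sq.ab s ∷ Sq.bc s ∷ Sq.cd s ∷ Sq.da s ∷ [])))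
        where
        stays : ∀ {x y} → x ∈ quad a b c d → Star (Adj G) x y → y ∈ quad a b c d
        stays x∈ ε = x∈
        stays {x} x∈ (_◅_ {j = z} e p) with z ∈? quad a b c d
        ... | yes z∈ = stays z∈ p
        ... | no z∉ = ⊥-elim (¬l (x , z , x∈ , z∉ , e))
        all∈ : ∀ {x y} → Adj G x y → x ∈ quad a b c d
        all∈ e = stays (here refl) (conn-path G conn (Sq.ab s) e)
        cov : ∀ {x y} → Adj G x y → Any (λ e → SameEdge e (x , y)) (map (λ (i , j) → vec4 a b c d i , vec4 a b c d j) c4-edges)
        cov {x} {y} e = go (quad-vec (all∈ e)) (quad-vec (all∈ (~-sym G e)))
          where
          go : ∃[ i ] x ≡ vec4 a b c d i → ∃[ j ] y ≡ vec4 a b c d j →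
            Any (λ e → SameEdge e (x , y)) (map (λ (i , j) → vec4 a b c d i , vec4 a b c d j) c4-edges)
          go (0F , refl) (0F , refl) = ⊥-elim (~-irr G e)
          go (0F , refl) (1F , refl) = here (inj₁ (refl , refl))
          go (0F , refl) (2F , refl) = ⊥-elim (chordless _ _ _ _ s e)
          go (0F , refl) (3F , refl) = there (there (there (here (inj₂ (refl , refl)))))
          go (1F , refl) (0F , refl) = here (inj₂ (refl , refl))
          go (1F , refl) (1F , refl) = ⊥-elim (~-irr G e)
          go (1F , refl) (2F , refl) = there (here (inj₁ (refl , refl)))
          go (1F , refl) (3F , refl) = ⊥-elim (chordless _ _ _ _ (rot s) e)
          go (2F , refl) (0F , refl) = ⊥-elim (chordless _ _ _ _ (rot (rot s)) e)
          go (2F , refl) (1F , refl) = there (here (inj₂ (refl , refl)))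
          go (2F , refl) (2F , refl) = ⊥-elim (~-irr G e)
          go (2F , refl) (3F , refl) = there (there (here (inj₁ (refl , refl))))
          go (3F , refl) (0F , refl) = there (there (there (here (inj₁ (refl , refl)))))
          go (3F , refl) (1F , refl) = ⊥-elim (chordless _ _ _ _ (rot (rot (rot s))) e)
          go (3F , refl) (2F , refl) = there (there (here (inj₂ (refl , refl))))
          go (3F , refl) (3F , refl) = ⊥-elim (~-irr G e)

    chordless-result : ∀ {a b c d} → Sq G a b c d → Result G
    chordless-result {a} {b} {c} {d} s with leaves? G conn IH inSq a b c d
    ... | no ¬l = isC4 (alone s ¬l)
    ... | yes (x , y , x∈ , y∉ , xy) with sq-at s x∈
    ...   | p , r , q , t , i with opposite-degree t xy (λ { refl → y∉ (i (there (here refl))) })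
                                    (λ { refl → y∉ (i (there (there (there (here refl))))) })
    ...     | inj₁ st = isStrict st
    -- The corner `r` opposite to `x` is the vertex of large degree; the square is read from `r`
    -- with `p` and `q` in the order of `ex`.
    ...     | inj₂ ex = isStrict (large-degree (mirror (rot (rot t))) ex)

  square-result : ∀ {a b c d} → Sq G a b c d → Result G
  square-result s with allOr (λ a → allOr (λ b → allOr (λ c → allOr (λ d → chord-at a b c d))))
  ... | inj₁ r = r
  ... | inj₂ chordless = chordless-result chordless s

-- The induction on the number of edges

main-step : ∀ {n} (G : Graph (Fin n)) → Conn G →
  (∀ (H : Graph (Fin n)) → size H < size G → Conn H → Result H) → Result G
main-step {n} G conn IH = go (any? λ a → any? λ b → any? λ c → any? λ d → sq? G a b c d)
  where
  Info : Fin n → Fin n → Set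
  Info a b = Adj G a b → InSq G a b ⊎ Pend G a b ⊎ Pend G b a
  info : ∀ a b → Result G ⊎ Info a b
  info a b with adj? G a b
  ... | no ¬e = inj₂ (λ e → ⊥-elim (¬e e))
  ... | yes e with edge-info G conn IH e
  ...   | inj₁ r = inj₁ r
  ...   | inj₂ i = inj₂ (λ _ → i)
  Plain : Fin n → Fin n → Set
  Plain a b = Adj G a b → InSq G a b
  go : Dec (∃[ a ] ∃[ b ] ∃[ c ] ∃[ d ] Sq G a b c d) → Result G
  go (no ¬s) = isStrict ([] , (λ s → ⊥-elim (¬s (_ , _ , _ , _ , s))) , z≤n)
  go (yes (_ , _ , _ , _ , s)) with allOr (λ a → allOr (λ b → info a b))
  ... | inj₁ r = r
  ... | inj₂ inf with allOr (λ a → allOr (λ b → plain a b))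
    where
    plain : ∀ a b → Strict G ⊎ Plain a b
    plain a b with adj? G a b
    ... | no ¬e = inj₂ (λ e → ⊥-elim (¬e e))
    ... | yes e with inf a b e
    ...   | inj₁ i = inj₂ (λ _ → i)
    -- Pendant C₄s wait until all edges are classified, because the argument consults the edges that
    -- link other components to `x`.
    ...   | inj₂ (inj₁ p) = inj₁ (pendant-strict G conn IH (λ {a} {b} → inf a b) p)
    ...   | inj₂ (inj₂ p) = inj₁ (pendant-strict G conn IH (λ {a} {b} → inf a b) p)
  ...   | inj₁ st = isStrict st
  ...   | inj₂ plain with strict-or-big G conn IH (λ {a} {b} → plain a b)
  ...     | inj₁ st = isStrict st
  ...     | inj₂ big = square-result G conn IH (λ {a} {b} → plain a b) big s

main : ∀ {n} (G : Graph (Fin n)) → Conn G → Result G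
main {n} G = bounded (suc (size G)) G ≤-refl
  where
  bounded : ∀ k (G : Graph (Fin n)) → size G < k → Conn G → Result G
  bounded (suc k) G (s≤s le) conn = main-step G conn (λ H lt → bounded k H (≤-trans lt le))

-- Isolating subsets and isolating lists

insert : ∀ {n} → Fin n → Sub.Subset n → Sub.Subset n
insert fz (_ ∷ p) = true ∷ p
insert (fs x) (s ∷ p) = s ∷ insert x p

insert-size : ∀ {n} (x : Fin n) p → Sub.∣ insert x p ∣ ≤ suc Sub.∣ p ∣
insert-size fz (true ∷ p) = n≤1+n _
insert-size fz (false ∷ p) = ≤-refl
insert-size (fs x) (true ∷ p) = s≤s (insert-size x p)
insert-size (fs x) (false ∷ p) = insert-size x p

insert-new : ∀ {n} (x : Fin n) p → x Sub.∈ insert x p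
insert-new fz (_ ∷ p) = Vec.here
insert-new (fs x) (_ ∷ p) = Vec.there (insert-new x p)

insert-old : ∀ {n} (x : Fin n) {y p} → y Sub.∈ p → y Sub.∈ insert x p
insert-old fz Vec.here = Vec.here
insert-old fz (Vec.there q) = Vec.there q
insert-old (fs x) Vec.here = Vec.here
insert-old (fs x) (Vec.there q) = Vec.there (insert-old x q)

fromList : ∀ {n} → List (Fin n) → Sub.Subset n
fromList [] = Sub.⊥
fromList (x ∷ xs) = insert x (fromList xs)

fromList-size : ∀ {n} (xs : List (Fin n)) → Sub.∣ fromList xs ∣ ≤ length xs
fromList-size {n} [] = ≤-reflexive (∣⊥∣≡0 n)
fromList-size (x ∷ xs) = ≤-trans (insert-size x (fromList xs)) (s≤s (fromList-size xs))

fromList-∈ : ∀ {n} (xs : List (Fin n)) {x} → x ∈ xs → x Sub.∈ fromList xs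
fromList-∈ (x ∷ xs) (here refl) = insert-new x (fromList xs)
fromList-∈ (x ∷ xs) (there p) = insert-old x (fromList-∈ xs p)

elems : ∀ {n} → Sub.Subset n → List (Fin n)
elems [] = []
elems (true ∷ p) = fz ∷ map fs (elems p)
elems (false ∷ p) = map fs (elems p)

elems-size : ∀ {n} (p : Sub.Subset n) → length (elems p) ≡ Sub.∣ p ∣
elems-size [] = refl
elems-size (true ∷ p) = cong suc (trans (length-map fs (elems p)) (elems-size p))
elems-size (false ∷ p) = trans (length-map fs (elems p)) (elems-size p)

elems-∈ : ∀ {n} {p : Sub.Subset n} {x} → x Sub.∈ p → x ∈ elems p
elems-∈ {p = true ∷ p} Vec.here = here refl
elems-∈ {p = true ∷ p} (Vec.there q) = there (map⁺ (Any.map (cong fs) (elems-∈ q)))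
elems-∈ {p = false ∷ p} (Vec.there q) = map⁺ (Any.map (cong fs) (elems-∈ q))

module _ {n : ℕ} (G : Graph (Fin n)) where

  near-nbhd : ∀ D {x} → Near G D x → InClosedNbhd G (fromList D) x
  near-nbhd D = go D id
    where
    go : ∀ E → (∀ {u} → u ∈ E → u ∈ D) → ∀ {x} → Near G E x → InClosedNbhd G (fromList D) x
    go (u ∷ E) i (here (inj₁ refl)) = inj₁ (fromList-∈ D (i (here refl)))
    go (u ∷ E) i (here (inj₂ e)) = inj₂ (u , fromList-∈ D (i (here refl)) , e)
    go (u ∷ E) i (there p) = go E (λ q → i (there q)) p

  nbhd-near : ∀ {D x} → InClosedNbhd G D x → Near G (elems D) x
  nbhd-near (inj₁ x∈) = Any.map (λ e → inj₁ (sym e)) (elems-∈ x∈)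
  nbhd-near (inj₂ (u , u∈ , e)) = Any.map (λ { refl → inj₂ e }) (elems-∈ u∈)

  isol-subset : ∀ {D} → Isol G D → IsCkIsolating 4 G (fromList D)
  isol-subset {D} iso (f , inj , out , step) = go (iso (sq (step 0F 1F (inj₁ refl)) (step 1F 2F (inj₁ refl))
      (step 2F 3F (inj₁ refl)) (step 3F 0F (inj₂ (refl , refl))) (λ e → 0≢2 (inj e)) (λ e → 1≢3 (inj e))))
    where
    0≢2 : ¬ (_≡_ {A = Fin 4} 0F 2F)
    0≢2 ()
    1≢3 : ¬ (_≡_ {A = Fin 4} 1F 3F)
    1≢3 ()
    go : ¬ Any (Near G D) (quad (f 0F) (f 1F) (f 2F) (f 3F))
    go (here p) = out 0F (near-nbhd D p)
    go (there (here p)) = out 1F (near-nbhd D p)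
    go (there (there (here p))) = out 2F (near-nbhd D p)
    go (there (there (there (here p)))) = out 3F (near-nbhd D p)

  subset-isol : ∀ {D} → IsCkIsolating 4 G D → Isol G (elems D)
  subset-isol {D} iso {a} {b} {c} {d} s
    with Any.any? (λ x → Any.any? (λ u → (u ≟ x) ⊎-dec adj? G u x) (elems D)) (quad a b c d)
  ... | yes p = p
  ... | no ¬p = ⊥-elim (iso (vec4 a b c d , (λ {i} {j} → vec-inj (sq-unique G s) {i} {j}) ,
          (λ i q → ¬p (miss i (nbhd-near q))) , step))
    where
    miss : ∀ i → Near G (elems D) (vec4 a b c d i) → Any (Near G (elems D)) (quad a b c d)
    miss 0F p = here p
    miss 1F p = there (here p)
    miss 2F p = there (there (here p))
    miss 3F p = there (there (there (here p)))
    step : ∀ i j → CycSucc 4 i j → Adj G (vec4 a b c d i) (vec4 a b c d j)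
    step 0F 1F _ = Sq.ab s
    step 1F 2F _ = Sq.bc s
    step 2F 3F _ = Sq.cd s
    step 3F 0F _ = Sq.da s
    step 0F 0F (inj₁ ())
    step 0F 0F (inj₂ (() , _))
    step 0F 2F (inj₁ ())
    step 0F 2F (inj₂ (() , _))
    step 0F 3F (inj₁ ())
    step 0F 3F (inj₂ (() , _))
    step 1F 0F (inj₁ ())
    step 1F 0F (inj₂ (() , _))
    step 1F 1F (inj₁ ())
    step 1F 1F (inj₂ (() , _))
    step 1F 3F (inj₁ ())
    step 1F 3F (inj₂ (() , _))
    step 2F 0F (inj₁ ())
    step 2F 0F (inj₂ (() , _))
    step 2F 1F (inj₁ ())
    step 2F 1F (inj₂ (() , _))
    step 2F 2F (inj₁ ())
    step 2F 2F (inj₂ (() , _))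
    step 3F 1F (inj₁ ())
    step 3F 1F (inj₂ (_ , ()))
    step 3F 2F (inj₁ ())
    step 3F 2F (inj₂ (_ , ()))
    step 3F 3F (inj₁ ())
    step 3F 3F (inj₂ (_ , ()))

-- Isomorphisms

iso-by : ∀ {n} {B : Set} (G : Graph (Fin n)) (H : Graph B) (f : B → Fin n) → Injective _≡_ _≡_ f →
  (∀ v → ∃[ b ] v ≡ f b) → (∀ b b′ → adj G (f b) (f b′) ≡ adj H b b′) → G ≅ H
iso-by G H f inj surj eq = mk↔ₛ′ (λ v → proj₁ (surj v)) f (λ b → inj (sym (proj₂ (surj (f b))))) (λ v → sym (proj₂ (surj v))) ,
  λ x y → trans (sym (eq (proj₁ (surj x)) (proj₁ (surj y)))) (sym (cong₂ (adj G) (proj₂ (surj x)) (proj₂ (surj y))))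

bool-ext : ∀ {b c : Bool} → (b ≡ true → c ≡ true) → (c ≡ true → b ≡ true) → b ≡ c
bool-ext {true} f _ = sym (f refl)
bool-ext {false} {true} _ g = g refl
bool-ext {false} {false} _ _ = refl

module _ {n : ℕ} (G : Graph (Fin n)) where

  all-touched : Connected G → ∀ {p q} → Adj G p q → ∀ v → ∃[ w ] Adj G v w
  all-touched (_ , path) {p} pq v with v ≟ p
  ... | yes refl = _ , pq
  ... | no v≢p = star-touched G v≢p (path v p)

  embed-edge : ∀ {k} (f : Fin k → Fin n) es → Embeds G f es → ∀ {i j} → EdgeOf es i j → Adj G (f i) (f j)
  embed-edge f (_ ∷ es) (h ∷ hs) (here (inj₁ (refl , refl))) = h
  embed-edge f (_ ∷ es) (h ∷ hs) (here (inj₂ (refl , refl))) = ~-sym G h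
  embed-edge f (_ ∷ es) (h ∷ hs) (there p) = embed-edge f es hs p

  c4-iso : Connected G → C4G G → G ≅ C4
  c4-iso con c = iso-by G C4 vert inj (λ v → covers (proj₂ (all-touched con (Sq.ab square) v))) λ i j → bool-ext (fwd i j) (bwd i j)
    where
    open C4G c
    inj : Injective _≡_ _≡_ vert
    inj {i} {j} = vec-inj (sq-unique G square) {i} {j}
    table : ∀ i j → (EdgeOf c4-edges i j → c4adj i j ≡ true) × (c4adj i j ≡ true → EdgeOf c4-edges i j)
    table = toWitness {a? = all? λ i → all? λ j → (edgeOf? c4-edges i j →-dec (c4adj i j Bool.≟ true)) ×-dec
      ((c4adj i j Bool.≟ true) →-dec edgeOf? c4-edges i j)} tt
    fwd : ∀ i j → Adj G (vert i) (vert j) → c4adj i j ≡ true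
    fwd i j e with class e
    ... | i′ , j′ , p , q , m with inj {i} {i′} p | inj {j} {j′} q
    ...   | refl | refl = proj₁ (table i j) m
    bwd : ∀ i j → c4adj i j ≡ true → Adj G (vert i) (vert j)
    bwd i j e = embed-edge vert c4-edges (Sq.ab square ∷ Sq.bc square ∷ Sq.cd square ∷ Sq.da square ∷ [])
      (proj₂ (table i j) e)

  k4m-iso : Connected G → K4mG G → G ≅ K4⁻
  k4m-iso con c = iso-by G K4⁻ (vert ∘ π) inj surj λ i j → bool-ext (fwd i j) (bwd i j)
    where
    open K4mG c
    -- The missing edge is q₁q₃ here and {2 , 3} in K4⁻.
    π : Fin 4 → Fin 4
    π 1F = 2F
    π 2F = 1F
    π i = i
    ππ : ∀ i → π (π i) ≡ i
    ππ = toWitness {a? = all? λ i → π (π i) ≟ i} tt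
    vinj : Injective _≡_ _≡_ vert
    vinj {i} {j} = vec-inj (sq-unique G square) {i} {j}
    inj : Injective _≡_ _≡_ (vert ∘ π)
    inj {i} {j} e = trans (sym (ππ i)) (trans (cong π (vinj {π i} {π j} e)) (ππ j))
    surj : ∀ v → ∃[ i ] v ≡ vert (π i)
    surj v = let i , e = covers (proj₂ (all-touched con chord v)) in π i , trans e (cong vert (sym (ππ i)))
    table : ∀ i j → (EdgeOf k4m-edges (π i) (π j) → k4mAdj i j ≡ true) × (k4mAdj i j ≡ true → EdgeOf k4m-edges (π i) (π j))
    table = toWitness {a? = all? λ i → all? λ j → (edgeOf? k4m-edges (π i) (π j) →-dec (k4mAdj i j Bool.≟ true)) ×-dec
      ((k4mAdj i j Bool.≟ true) →-dec edgeOf? k4m-edges (π i) (π j))} tt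
    fwd : ∀ i j → Adj G (vert (π i)) (vert (π j)) → k4mAdj i j ≡ true
    fwd i j e with class e
    ... | i′ , j′ , p , q , m = proj₁ (table i j)
          (subst₂ (EdgeOf k4m-edges) (sym (vinj {π i} {i′} p)) (sym (vinj {π j} {j′} q)) m)
    bwd : ∀ i j → k4mAdj i j ≡ true → Adj G (vert (π i)) (vert (π j))
    bwd i j e = embed-edge vert k4m-edges
      (chord ∷ Sq.ab square ∷ Sq.bc square ∷ Sq.cd square ∷ Sq.da square ∷ []) (proj₂ (table i j) e)

eqb⁻ : ∀ {t} {i j : Fin t} → eqb i j ≡ true → i ≡ j
eqb⁻ {i = i} {j} = ⌊⌋⁻ (i ≟ j)

∧⁻ : ∀ {a b} → a ∧ b ≡ true → a ≡ true × b ≡ true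
∧⁻ {true} {true} _ = refl , refl

∧⁺ : ∀ {a b} → a ≡ true → b ≡ true → a ∧ b ≡ true
∧⁺ refl refl = refl

-- From blocks to cons(T, C₄)

module _ {n t : ℕ} {G : Graph (Fin n)} {bs : Fin t → Fin 5 → Fin n} (B : Blocks G bs) where
  open Blocks B

  topGraph : Graph (Fin t)
  topGraph = record
    { adj = λ i j → adj G (bs i fz) (bs j fz)
    ; adj-sym = λ i j → adj-sym G (bs i fz) (bs j fz)
    ; irrefl = λ i → irrefl G (bs i fz) }

  module _ (con : Connected G) (base : Fin t) where

    place : ∀ v → ∃[ i ] ∃[ j ] v ≡ bs i j
    place v with class (proj₂ (all-touched G con (local base 0F 1F refl) v))
    ... | inj₁ (i , j , _ , e , _) = i , j , e
    ... | inj₂ (i , _ , e , _) = i , fz , e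

    private
      code : Fin t ⊎ (Fin t × Fin 4) → Fin n
      code (inj₁ i) = bs i fz
      code (inj₂ (i , a)) = bs i (fs a)

      code-inj : Injective _≡_ _≡_ code
      code-inj {inj₁ i} {inj₁ j} e = cong inj₁ (proj₁ (inj e))
      code-inj {inj₁ i} {inj₂ _} e with proj₂ (inj e)
      ... | ()
      code-inj {inj₂ _} {inj₁ j} e with proj₂ (inj e)
      ... | ()
      code-inj {inj₂ (i , a)} {inj₂ (j , b)} e with inj e
      ... | refl , refl = refl

      code-surj : ∀ v → ∃[ b ] v ≡ code b
      code-surj v with place v
      ... | i , fz , e = inj₁ i , e
      ... | i , fs a , e = inj₂ (i , a) , e

      nbr : ∀ {i j j′ k} → Adj G (bs i j) (bs j′ (fs k)) → i ≡ j′ × b5 j (fs k) ≡ true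
      nbr e with nbr-in-block B e
      ... | _ , p , l with inj p
      ...   | refl , refl = refl , l

      code-adj : ∀ x y → adj G (code x) (code y) ≡ consAdj topGraph x y
      code-adj (inj₁ i) (inj₁ j) = refl
      code-adj (inj₁ i) (inj₂ (j , a)) = bool-ext
        (λ e → let p , l = nbr e in ∧⁺ (⌊⌋⁺ (i ≟ j) p) l) (λ e → go (∧⁻ e))
        where
        go : eqb i j ≡ true × eqb a fz ≡ true → Adj G (bs i fz) (bs j (fs a))
        go (p , q) with eqb⁻ {i = i} p
        ... | refl = local i fz (fs a) q
      code-adj (inj₂ (i , a)) (inj₁ j) = bool-ext
        (λ e → let p , l = nbr (~-sym G e) in ∧⁺ (⌊⌋⁺ (j ≟ i) p) l) (λ e → go (∧⁻ e))
        where
        go : eqb j i ≡ true × eqb a fz ≡ true → Adj G (bs i (fs a)) (bs j fz)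
        go (p , q) with eqb⁻ {i = j} p
        ... | refl = local i (fs a) fz q
      code-adj (inj₂ (i , a)) (inj₂ (j , b)) = bool-ext
        (λ e → let p , l = nbr e in ∧⁺ (⌊⌋⁺ (i ≟ j) p) l) (λ e → go (∧⁻ e))
        where
        go : eqb i j ≡ true × c4adj a b ≡ true → Adj G (bs i (fs a)) (bs j (fs b))
        go (p , q) with eqb⁻ {i = i} p
        ... | refl = local i (fs a) (fs b) q

    blocks-iso : G ≅ cons topGraph
    blocks-iso = iso-by G (cons topGraph) code code-inj code-surj code-adj

    private
      blk : Fin n → Fin t
      blk v = proj₁ (place v)

      blk≡ : ∀ {v i j} → v ≡ bs i j → blk v ≡ i
      blk≡ {v} e = proj₁ (inj (trans (sym (proj₂ (proj₂ (place v)))) e))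

      -- Steps inside a block are contracted and steps between tree vertices are kept.
      project : ∀ {x y} → Star (Adj G) x y → Star (Adj topGraph) (blk x) (blk y)
      project ε = ε
      project {x} {y} (_◅_ {j = z} e s) with class e
      ... | inj₁ (i , _ , _ , p , q , _) = subst (λ k → Star (Adj topGraph) k (blk y)) (trans (blk≡ q) (sym (blk≡ p))) (project s)
      ... | inj₂ (i , i′ , p , q) = subst₂ (Adj topGraph) (sym (blk≡ p)) (sym (blk≡ q)) (subst₂ (Adj G) p q e) ◅ project s

    top-connected : Connected topGraph
    top-connected = base , λ i j → subst₂ (Star (Adj topGraph)) (blk≡ refl) (blk≡ refl)
      (project (proj₂ con (bs i fz) (bs j fz)))

  -- Deleting an edge of a cycle of tree vertices keeps the graph connected and the blocks intact.
  top-acyclic : Conn G → suc (size G) ≤ 6 * t → Acyclic topGraph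
  top-acyclic conn few (suc (suc (suc k))) (s≤s (s≤s (s≤s _))) (f , f-inj , _ , step) = absurd (main G′ (del-conn G conn a⟶b))
    where
    g : Fin (3 + k) → Fin n
    g i = bs (f i) fz
    g-inj : ∀ {i j} → g i ≡ g j → i ≡ j
    g-inj e = f-inj (proj₁ (inj e))
    a = g 0F
    b = g 1F
    G′ = del G a b
    keep : ∀ {x y} → Adj G x y → ¬ SameEdge (a , b) (x , y) → Adj G′ x y
    keep = ∩⁺ G (not-rel (edge a b))
    -- The rest of the cycle, from index 1 upwards; its edges avoid index 0 and hence differ from
    -- the deleted one.
    path : ∀ m (j : Fin (3 + k)) → toℕ j ≡ suc m → Star (Adj G′) b (g j)
    path zero j e with toℕ-injective {i = j} {j = 1F} e
    ... | refl = ε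
    path (suc m) j e = path m j′ e′ ◅◅ (keep (step j′ j (inj₁ (trans e (cong suc (sym e′)))))
        (λ { (inj₁ (p , _)) → nz e′ (g-inj p) ; (inj₂ (_ , q)) → nz e (g-inj q) }) ◅ ε)
      where
      m<k : suc m < 3 + k
      m<k = <⇒≤ (subst (_< 3 + k) e (toℕ<n j))
      j′ : Fin (3 + k)
      j′ = fromℕ< m<k
      e′ : toℕ j′ ≡ suc m
      e′ = toℕ-fromℕ< m<k
      nz : ∀ {i : Fin (3 + k)} {l} → toℕ i ≡ suc l → ¬ (i ≡ 0F)
      nz () refl
    last : Fin (3 + k)
    last = fromℕ (2 + k)
    a⟶b : Star (Adj G′) a b
    a⟶b = reverse (~-sym G′) (path (suc k) last (toℕ-fromℕ (2 + k)) ◅◅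
      (keep (step last 0F (inj₂ (toℕ-fromℕ (2 + k) , refl)))
        (λ { (inj₁ (p , _)) → case₁ (g-inj p) ; (inj₂ (p , _)) → case₂ (g-inj p) }) ◅ ε))
      where
      case₁ : ¬ (last ≡ 0F)
      case₁ ()
      case₂ : ¬ (last ≡ 1F)
      case₂ ()
    B′ : Blocks G′ bs
    B′ = record
      { inj = inj
      ; local = λ i j j′ e → keep (local i j j′ e) λ
          { (inj₁ (p , q)) → no-top (proj₂ (inj p)) (proj₂ (inj q)) e
          ; (inj₂ (p , q)) → no-top (proj₂ (inj p)) (proj₂ (inj q)) e }
      ; class = λ e → class (∩-⊆ G _ e) }
      where
      no-top : ∀ {j j′} → j ≡ fz → j′ ≡ fz → ¬ (b5 j j′ ≡ true)
      no-top refl refl ()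
    lt : suc (size G′) ≤ size G
    lt = size-del< G (step 0F 1F (inj₁ refl))
    too-few : ∀ D → Isol G′ D → ¬ (6 * length D ≤ size G)
    too-few D iso le = <-irrefl refl (≤-trans few (≤-trans (*-monoʳ-≤ 6 (blocks-lower B′ D iso)) le))
    absurd : Result G′ → ⊥
    absurd (isStrict (D , iso , le)) = too-few D iso (≤-trans le (<⇒≤ lt))
    absurd (isExt e) = let D , iso , le = ext-weak e in too-few D iso (≤-trans le lt)
    -- The cycle uses at least three tree vertices, so `t ≥ 3`, whereas a single vertex isolates a
    -- C₄.
    absurd (isC4 c) with ≤-trans (injective⇒≤ f-inj) (blocks-lower B′ _ (c4-isol c))
    ... | s≤s ()

-- Trees on t vertices have at most t − 1 edges

data SPath {n : ℕ} (H : Graph (Fin n)) (z : Fin n) : Fin n → List (Fin n) → Set where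
  stop : SPath H z z (z ∷ [])
  _∷⟨_⟩_ : ∀ {x y xs} → Adj H x y → ¬ x ∈ xs → SPath H z y xs → SPath H z x (x ∷ xs)

module _ {n : ℕ} (H : Graph (Fin n)) {z : Fin n} where

  private
    suffix : ∀ {x y xs} → SPath H z y xs → x ∈ xs → ∃[ ys ] SPath H z x ys
    suffix stop (here refl) = _ , stop
    suffix p@(_ ∷⟨ _ ⟩ _) (here refl) = _ , p
    suffix (_ ∷⟨ _ ⟩ p) (there q) = suffix p q

  -- If the new starting vertex already occurs, the path is cut back to that occurrence.
  simple : ∀ {x} → Star (Adj H) x z → ∃[ xs ] SPath H z x xs
  simple ε = _ , stop
  simple {x} (e ◅ s) with simple s
  ... | xs , p with x ∈? xs
  ...   | yes q = suffix p q
  ...   | no ¬q = _ , e ∷⟨ ¬q ⟩ p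

  path-map : ∀ {K x xs} → H ⊆ᴳ K → SPath H z x xs → SPath K z x xs
  path-map f stop = stop
  path-map f (e ∷⟨ q ⟩ p) = f e ∷⟨ q ⟩ path-map f p

  path-unique : ∀ {x xs} → SPath H z x xs → Unique xs
  path-unique stop = [] ∷ []
  path-unique (e ∷⟨ q ⟩ p) = fresh q ∷ path-unique p

  path-head : ∀ {x xs} → SPath H z x xs → ∀ i → toℕ i ≡ 0 → lookup xs i ≡ x
  path-head stop fz _ = refl
  path-head (_ ∷⟨ _ ⟩ _) fz _ = refl

  path-last : ∀ {x xs} → SPath H z x xs → ∀ i → toℕ i ≡ length xs ∸ 1 → lookup xs i ≡ z
  path-last stop fz _ = refl
  path-last (_ ∷⟨ _ ⟩ (_∷⟨_⟩_ _ _ _)) fz ()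
  path-last (_ ∷⟨ _ ⟩ stop) (fs i) e = path-last stop i (suc-injective e)
  path-last (_ ∷⟨ _ ⟩ p@(_∷⟨_⟩_ _ _ _)) (fs i) e = path-last p i (suc-injective e)

  path-step : ∀ {x xs} → SPath H z x xs → ∀ i j → toℕ j ≡ suc (toℕ i) → Adj H (lookup xs i) (lookup xs j)
  path-step stop fz fz ()
  path-step (_∷⟨_⟩_ {x = x} e _ p) fz (fs j) q = subst (Adj H x) (sym (path-head p j (suc-injective q))) e
  path-step (_ ∷⟨ _ ⟩ p) (fs i) (fs j) q = path-step p i j (suc-injective q)

cycle-from-path : ∀ {n} (H : Graph (Fin n)) {x z xs} → SPath H z x xs → Adj H z x → HasCycleIn (length xs) H (λ _ → ⊤)
cycle-from-path H {x} {z} {xs} p zx = lookup xs , unique-lookup (path-unique H p) , (λ _ → tt) , step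
  where
  step : ∀ i j → CycSucc (length xs) i j → Adj H (lookup xs i) (lookup xs j)
  step i j (inj₁ e) = path-step H p i j e
  step i j (inj₂ (e , e′)) = subst₂ (Adj H) (sym (path-last H p i e)) (sym (path-head H p j e′)) zx

module _ {t : ℕ} (T : Graph (Fin t)) (acyclic : Acyclic T) where

  private
    Covers : List (Fin t × Fin t) → List (Fin t) → Set
    Covers es S = ∀ {x y} → x ∈ S → y ∈ S → Adj T x y → Any (λ e → SameEdge e (x , y)) es

    record Partial (S : List (Fin t)) : Set where
      field
        es    : List (Fin t × Fin t)
        count : suc (length es) ≡ length S
        cover : Covers es S
        paths : ∀ {x y} → x ∈ S → y ∈ S → Star (Adj (T [ ⟦ S ⟧ ])) x y

    short : ∀ {H : Graph (Fin t)} {x z xs} → SPath H z x xs → x ≢ z → 2 ≤ length xs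
    short stop ne = ⊥-elim (ne refl)
    short (_ ∷⟨ _ ⟩ stop) _ = s≤s (s≤s z≤n)
    short (_ ∷⟨ _ ⟩ (_ ∷⟨ _ ⟩ _)) _ = s≤s (s≤s z≤n)

    inside-path : ∀ {S x z xs} → x ∈ S → SPath (T [ ⟦ S ⟧ ]) z x xs → ∀ {w} → w ∈ xs → w ∈ S
    inside-path x∈ stop (here refl) = x∈
    inside-path x∈ (e ∷⟨ _ ⟩ p) (here refl) = x∈
    inside-path {S} x∈ (e ∷⟨ _ ⟩ p) (there q) = inside-path (⟦⟧⁻ S (proj₂ (proj₂ (ind⁻ T ⟦ S ⟧ e)))) p q

    -- A second neighbour of `y` in `S` would close a cycle with a simple path inside `S`, so each
    -- new vertex brings exactly one edge.
    step : ∀ {S x y} → Partial S → x ∈ S → ¬ y ∈ S → Adj T x y → Partial (y ∷ S)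
    step {S} {x} {y} P x∈ y∉ xy = record { es = (x , y) ∷ es ; count = cong suc count ; cover = cover′ ; paths = paths′ }
      where
      open Partial P
      only : ∀ {z} → z ∈ S → Adj T y z → z ≡ x
      only {z} z∈ yz with z ≟ x
      ... | yes e = e
      ... | no z≢x with simple (T [ ⟦ S ⟧ ]) (paths x∈ z∈)
      ...   | xs , p = ⊥-elim (acyclic _ (s≤s (short p (z≢x ∘ sym))) (cycle-from-path T
                (~-sym T xy ∷⟨ (λ q → y∉ (inside-path x∈ p q)) ⟩ path-map (T [ ⟦ S ⟧ ]) {K = T} (∩-⊆ T _) p) (~-sym T yz)))
      cover′ : Covers ((x , y) ∷ es) (y ∷ S)
      cover′ (here refl) (here refl) e = ⊥-elim (~-irr T e)
      cover′ (here refl) (there q) e = here (inj₂ (refl , only q e))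
      cover′ (there p) (here refl) e = here (inj₁ (only p (~-sym T e) , refl))
      cover′ (there p) (there q) e = there (cover p q e)
      old : ∀ {u w} → u ∈ S → w ∈ S → Star (Adj (T [ ⟦ y ∷ S ⟧ ])) u w
      old p q = Star.map (λ e → let e′ , u , w = ind⁻ T ⟦ S ⟧ e in
        ind⁺ T ⟦ y ∷ S ⟧ e′ (⟦⟧⁺ _ (there (⟦⟧⁻ S u))) (⟦⟧⁺ _ (there (⟦⟧⁻ S w)))) (paths p q)
      new : Adj (T [ ⟦ y ∷ S ⟧ ]) x y
      new = ind⁺ T ⟦ y ∷ S ⟧ xy (⟦⟧⁺ _ (there x∈)) (⟦⟧⁺ _ (here refl))
      paths′ : ∀ {u w} → u ∈ (y ∷ S) → w ∈ (y ∷ S) → Star (Adj (T [ ⟦ y ∷ S ⟧ ])) u w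
      paths′ (here refl) (here refl) = ε
      paths′ (here refl) (there q) = ~-sym (T [ ⟦ y ∷ S ⟧ ]) new ◅ old x∈ q
      paths′ (there p) (here refl) = old p x∈ ◅◅ (new ◅ ε)
      paths′ (there p) (there q) = old p q

  tree-edges : Connected T → Σ[ es ∈ List (Fin t × Fin t) ]
    (suc (length es) ≤ t × (∀ {x y} → Adj T x y → Any (λ e → SameEdge e (x , y)) es))
  tree-edges (u , path) = es , subst (_≤ t) (sym count) (unique-length (Grown.unique g)) , λ e → cover (all∈ _) (all∈ _) e
    where
    start : Partial (u ∷ [])
    start = record { es = [] ; count = refl ; cover = λ { (here refl) (here refl) e → ⊥-elim (~-irr T e) }
                   ; paths = λ { (here refl) (here refl) → ε } }
    g : Grown T Partial step (u ∷ [])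
    g = grow T Partial step u start
    open Partial (Grown.inv g)
    reach : ∀ {x y} → x ∈ Grown.set g → Star (Adj T) x y → y ∈ Grown.set g
    reach p ε = p
    reach p (e ◅ s) = reach (Grown.closed g p e) s
    all∈ : ∀ x → x ∈ Grown.set g
    all∈ x = reach (Grown.sub g (here refl)) (path u x)

concat-length : ∀ {A : Set} {k t} (g : Fin t → List A) → (∀ i → length (g i) ≡ k) → length (concat (tabulate g)) ≡ t * k
concat-length {t = zero} g _ = refl
concat-length {t = suc t} g e = trans (length-++ (g fz)) (cong₂ _+_ (e fz) (concat-length (λ i → g (fs i)) (λ i → e (fs i))))

module _ {n t : ℕ} {G : Graph (Fin n)} {bs : Fin t → Fin 5 → Fin n} (B : Blocks G bs) where
  open Blocks B

  -- Five edges per block and at most `t − 1` between tree vertices give at most `6t − 1`.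
  blocks-size : Tree (topGraph B) → suc (size G) ≤ 6 * t
  blocks-size (con , acy) with tree-edges (topGraph B) acy con
  ... | es , few , cov = begin
      suc (size G)                      ≤⟨ s≤s (size-cover G (locals ++ tops′) cover) ⟩
      suc (length (locals ++ tops′))    ≡⟨ cong suc (trans (length-++ locals) (cong₂ _+_ (concat-length block (λ _ → refl))
                                             (length-map pair es))) ⟩
      suc (t * 5 + length es)           ≡⟨ sym (+-suc (t * 5) (length es)) ⟩
      t * 5 + suc (length es)           ≤⟨ +-monoʳ-≤ (t * 5) few ⟩
      t * 5 + t                         ≡⟨ shuffle t ⟩
      6 * t                             ∎
    where
    open ≤-Reasoning
    shuffle : ∀ t → t * 5 + t ≡ 6 * t
    shuffle = solve-∀
    block : Fin t → List (Fin n × Fin n)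
    block i = map (λ (j , k) → bs i j , bs i k) b5-edges
    locals = concat (tabulate block)
    pair : Fin t × Fin t → Fin n × Fin n
    pair (i , j) = bs i fz , bs j fz
    tops′ = map pair es
    cover : ∀ {x y} → Adj G x y → Any (λ e → SameEdge e (x , y)) (locals ++ tops′)
    cover e with class e
    ... | inj₁ (i , j , k , refl , refl , l) = ++⁺ˡ (concat⁺ (tabulate⁺ i (map⁺ (Any.map
          (λ { (inj₁ (refl , refl)) → inj₁ (refl , refl) ; (inj₂ (refl , refl)) → inj₂ (refl , refl) }) (b5-edge j k l)))))
    ... | inj₂ (i , j , refl , refl) = ++⁺ʳ locals (map⁺ (Any.map
          (λ { (inj₁ (refl , refl)) → inj₁ (refl , refl) ; (inj₂ (refl , refl)) → inj₂ (refl , refl) }) (cov e)))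

-- Blocks and edge counts obtained from a given isomorphism

module _ {n t : ℕ} (G : Graph (Fin n)) (T : Graph (Fin t)) (e : Fin n ↔ (Fin t ⊎ (Fin t × Fin 4)))
  (eq : ∀ x y → consAdj T (Inverse.to e x) (Inverse.to e y) ≡ adj G x y) where

  private
    open Inverse e using (to; from; strictlyInverseˡ; strictlyInverseʳ)

    vertex : Fin t → Fin 5 → Fin t ⊎ (Fin t × Fin 4)
    vertex i fz = inj₁ i
    vertex i (fs a) = inj₂ (i , a)

    vertex-inj : ∀ {i j i′ j′} → vertex i j ≡ vertex i′ j′ → i ≡ i′ × j ≡ j′
    vertex-inj {j = fz} {j′ = fz} refl = refl , refl
    vertex-inj {j = fs _} {j′ = fs _} refl = refl , refl

    vertex-adj : ∀ x y → consAdj T x y ≡ true →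
      (∃[ i ] ∃[ j ] ∃[ j′ ] (x ≡ vertex i j × y ≡ vertex i j′ × b5 j j′ ≡ true)) ⊎
      (∃[ i ] ∃[ i′ ] (x ≡ vertex i fz × y ≡ vertex i′ fz))
    vertex-adj (inj₁ i) (inj₁ j) _ = inj₂ (i , j , refl , refl)
    vertex-adj (inj₁ i) (inj₂ (j , a)) p with ∧⁻ p
    ... | q , r with eqb⁻ {i = i} q
    ...   | refl = inj₁ (i , fz , fs a , refl , refl , r)
    vertex-adj (inj₂ (i , a)) (inj₁ j) p with ∧⁻ p
    ... | q , r with eqb⁻ {i = j} q
    ...   | refl = inj₁ (i , fs a , fz , refl , refl , r)
    vertex-adj (inj₂ (i , a)) (inj₂ (j , b)) p with ∧⁻ p
    ... | q , r with eqb⁻ {i = i} q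
    ...   | refl = inj₁ (i , fs a , fs b , refl , refl , r)

    bs : Fin t → Fin 5 → Fin n
    bs i j = from (vertex i j)

    adj-from : ∀ x y → adj G (from x) (from y) ≡ consAdj T x y
    adj-from x y = trans (sym (eq (from x) (from y))) (cong₂ (consAdj T) (strictlyInverseˡ x) (strictlyInverseˡ y))

    at : ∀ {x y} → to x ≡ y → x ≡ from y
    at {x} p = trans (sym (strictlyInverseʳ x)) (cong from p)

    local : ∀ i j j′ → b5 j j′ ≡ true → consAdj T (vertex i j) (vertex i j′) ≡ true
    local i fz fz ()
    local i fz (fs a) p = ∧⁺ (eqb-refl i) p
    local i (fs a) fz p = ∧⁺ (eqb-refl i) p
    local i (fs a) (fs b) p = ∧⁺ (eqb-refl i) p

  iso-blocks : Blocks G bs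
  iso-blocks = record
    { inj = λ {i} {j} {i′} {j′} p → vertex-inj (trans (sym (strictlyInverseˡ (vertex i j)))
        (trans (cong to p) (strictlyInverseˡ (vertex i′ j′))))
    ; local = λ i j j′ p → trans (adj-from (vertex i j) (vertex i j′)) (local i j j′ p)
    ; class = λ {x} {y} p → [ (λ (i , j , j′ , q , r , l) → inj₁ (i , j , j′ , at q , at r , l)) ,
        (λ (i , i′ , q , r) → inj₂ (i , i′ , at q , at r)) ]′ (vertex-adj (to x) (to y) (trans (eq x y) p)) }

  private
    same : ∀ i j → adj (topGraph iso-blocks) i j ≡ adj T i j
    same i j = adj-from (inj₁ i) (inj₁ j)

  iso-tree : Tree T → Tree (topGraph iso-blocks)
  iso-tree ((u , path) , acy) = (u , λ x y → Star.map (λ {i} {j} p → trans (same i j) p) (path x y)) ,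
    λ k k≥3 (f , inj , out , step) → acy k k≥3 (f , inj , out , λ i j s → trans (sym (same (f i) (f j))) (step i j s))

module _ {n : ℕ} (G : Graph (Fin n)) (e : Fin n ↔ Fin 4)
  (eq : ∀ x y → k4mAdj (Inverse.to e x) (Inverse.to e y) ≡ adj G x y) where

  private
    open Inverse e using (to; from; strictlyInverseˡ; strictlyInverseʳ)

    -- K4⁻ lacks the edge {2 , 3}, so its 4-cycle is 0 2 1 3 and its chord is 0 1.
    es : List (Fin 4 × Fin 4)
    es = (0F , 1F) ∷ (0F , 2F) ∷ (2F , 1F) ∷ (1F , 3F) ∷ (3F , 0F) ∷ []

    listed : ∀ i j → k4mAdj i j ≡ true → EdgeOf es i j
    listed = toWitness {a? = all? λ i → all? λ j → (k4mAdj i j Bool.≟ true) →-dec edgeOf? es i j} tt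

    adj-from : ∀ i j → k4mAdj i j ≡ true → Adj G (from i) (from j)
    adj-from i j p = trans (sym (eq (from i) (from j))) (trans (cong₂ k4mAdj (strictlyInverseˡ i) (strictlyInverseˡ j)) p)

    from-inj : ∀ {i j} → from i ≡ from j → i ≡ j
    from-inj {i} {j} p = trans (sym (strictlyInverseˡ i)) (trans (cong to p) (strictlyInverseˡ j))

  k4m-size : size G ≤ 5
  k4m-size = size-cover G (map (λ (i , j) → from i , from j) es) cover
    where
    cover : ∀ {x y} → Adj G x y → Any (λ e → SameEdge e (x , y)) (map (λ (i , j) → from i , from j) es)
    cover {x} {y} p = map⁺ (Any.map
      (λ { (inj₁ (q , r)) → inj₁ (at q , at r) ; (inj₂ (q , r)) → inj₂ (at q , at r) })
      (listed (to x) (to y) (trans (eq x y) p)))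
      where
      at : ∀ {x i} → to x ≡ i → x ≡ from i
      at {x} q = trans (sym (strictlyInverseʳ x)) (cong from q)

  k4m-square : Sq G (from 0F) (from 2F) (from 1F) (from 3F)
  k4m-square = sq (adj-from 0F 2F refl) (adj-from 2F 1F refl) (adj-from 1F 3F refl) (adj-from 3F 0F refl)
    (λ p → 0≢1 (from-inj p)) (λ p → 2≢3 (from-inj p))
    where
    0≢1 : ¬ (_≡_ {A = Fin 4} 0F 1F)
    0≢1 ()
    2≢3 : ¬ (_≡_ {A = Fin 4} 2F 3F)
    2≢3 ()

-- The bound and the case of equality

theorem1p4 : ∀ {n : ℕ} (G : Graph (Fin n)) → Connected G → ¬ (G ≅ C4) →
    ∀ (ι : ℕ) → IsIsolationNumber G 4 ι →
    (6 * ι ≤ size G + 1) ×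
    ((6 * ι ≡ size G + 1) ⇔
    ((G ≅ K4⁻) ⊎ Σ ℕ (λ t → Σ (Graph (Fin t)) (λ T → Tree T × (G ≅ cons T)))))
theorem1p4 {n} G con@(v , path) ≇C4 ι ((D₀ , iso₀ , ∣D₀∣) , least) = bound , mk⇔ only-if if
  where
  conn : Conn G
  conn = v , λ {x} _ → path v x

  res : Result G
  res = main G conn

  +1 : size G + 1 ≡ suc (size G)
  +1 = +-comm (size G) 1

  upper : ∀ D → Isol G D → ι ≤ length D
  upper D iso = ≤-trans (least (fromList D) (isol-subset G iso)) (fromList-size D)

  upper₆ : ∀ {m} → Bounded m G → 6 * ι ≤ m
  upper₆ (D , iso , le) = ≤-trans (*-monoʳ-≤ 6 (upper D iso)) le

  lower : Isol G (elems D₀)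
  lower = subset-isol G iso₀

  bound : 6 * ι ≤ size G + 1
  bound with res
  ... | isStrict s = ≤-trans (upper₆ s) (m≤m+n _ 1)
  ... | isExt e = ≤-trans (upper₆ (ext-weak e)) (≤-reflexive (sym +1))
  ... | isC4 c = ⊥-elim (≇C4 (c4-iso G con c))

  only-if : 6 * ι ≡ size G + 1 → (G ≅ K4⁻) ⊎ Σ ℕ (λ t → Σ (Graph (Fin t)) (λ T → Tree T × (G ≅ cons T)))
  only-if eq with res
  ... | isStrict s = ⊥-elim (<-irrefl refl (≤-trans (≤-reflexive (sym (trans eq +1))) (upper₆ s)))
  ... | isC4 c = ⊥-elim (≇C4 (c4-iso G con c))
  ... | isExt (isK4m k) = inj₁ (k4m-iso G con k)
  -- Equality gives `size G + 1 = 6ι`, and `ι ≤ t` because the tree vertices are isolating; this is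
  -- the edge bound that excludes cycles in T.
  ... | isExt (isCons (consg {t} bs B base _)) = inj₂ (t , topGraph B ,
        (top-connected B con base , top-acyclic B conn (≤-trans (≤-reflexive (sym (trans eq +1))) (*-monoʳ-≤ 6
          (≤-trans (upper (tops B) (blocks-isol B)) (≤-reflexive (length-tabulate (λ i → bs i fz))))))) ,
        blocks-iso B con base)

  if : (G ≅ K4⁻) ⊎ Σ ℕ (λ t → Σ (Graph (Fin t)) (λ T → Tree T × (G ≅ cons T))) → 6 * ι ≡ size G + 1
  -- K₄⁻ has at most five edges and contains a C₄, so the empty set is not isolating and `ι ≥ 1`.
  if (inj₁ (e , eq)) = ≤-antisym bound (≤-trans (≤-reflexive +1) (≤-trans (s≤s (k4m-size G e eq))
    (*-monoʳ-≤ 6 (subst (1 ≤_) (trans (elems-size D₀) ∣D₀∣) (nonempty (elems D₀) lower)))))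
    where
    nonempty : ∀ D → Isol G D → 1 ≤ length D
    nonempty (_ ∷ _) _ = s≤s z≤n
    nonempty [] iso with iso (k4m-square G e eq)
    ... | here ()
    ... | there (here ())
    ... | there (there (here ()))
    ... | there (there (there (here ())))
  -- The chain is `size G + 1 ≤ 6t ≤ 6ι`.
  if (inj₂ (t , T , tree , e , eq)) = ≤-antisym bound (≤-trans (≤-reflexive +1) (≤-trans
    (blocks-size (iso-blocks G T e eq) (iso-tree G T e eq tree))
    (*-monoʳ-≤ 6 (subst (t ≤_) (trans (elems-size D₀) ∣D₀∣) (blocks-lower (iso-blocks G T e eq) (elems D₀) lower)))))
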